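{- Let $n\ge 1$ and $k\ge 3$ be integers, let $\varepsilon>0$, and let $f:S_k^n\to[k]$ be a social choice function satisfying $\mathbf{D}(f,\mathrm{NONMANIP})\ge\varepsilon$. Let $\sigma\in S_k^n$ be chosen uniformly at random. Then $$\mathbb{P}(\sigma\in M(f))\ \ge\ \mathbb{P}(\sigma\in M_4(f))\ \ge\ \frac{\varepsilon^{15}}{10^{39}\,n^{67}\,k^{166}}.$$ In particular, $\mathbb{P}(\sigma\in M_4(f))$ is bounded below by a polynomial in $\varepsilon$, $1/n$ and $1/k$.
   Context: $[k]=\{1,\dots,k\}$ is the set of alternatives and $S_k$ is the set of total orderings (rankings) of $[k]$. A social choice function (SCF) is a map $f:S_k^n\to[k]$; an element $\sigma=(\sigma_1,\dots,\sigma_n)\in S_k^n$ is a ranking profile, $\sigma_i$ being the ranking of voter $i$. Write $a\overset{\sigma_i}{>}b$ if $\sigma_i$ ranks $a$ above $b$. A profile $\sigma$ is a manipulation point of $f$ if there exist $i\in[n]$ and $\sigma'\in S_k^n$ differing from $\sigma$ only in coordinate $i$ such that $f(\sigma')\overset{\sigma_i}{>}f(\sigma)$; $(\sigma,\sigma')$ is then called a manipulation pair. $\sigma$ is an $r$-manipulation point if there is such a manipulation pair in which $\sigma'_i$ is obtained from $\sigma_i$ by permuting (at most) $r$ alternatives occupying adjacent positions in $\sigma_i$ (for $r>k$ every manipulation point is an $r$-manipulation point). $M(f)$ and $M_r(f)$ denote the sets of manipulation points and of $r$-manipulation points. For nonempty $H\subseteq[k]$, $\mathrm{top}_H:S_k\to[k]$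 maps a ranking to its highest-ranked element of $H$. A SCF $f$ taking exactly two values $a,b$ is monotone if whenever $\sigma,\sigma'$ differ only in some coordinate $i$ and $f(\sigma)=a$, $f(\sigma')=b$, we have $a\overset{\sigma_i}{>}b$ and $b\overset{\sigma'_i}{>}a$. $\mathrm{NONMANIP}=\mathrm{NONMANIP}(n,k)$ is the set of SCFs $f:S_k^n\to[k]$ such that either there are $i\in[n]$ and nonempty $H\subseteq[k]$ with $f(\sigma)=\mathrm{top}_H(\sigma_i)$ for all $\sigma$, or $f$ is monotone and takes exactly two values. The distance between SCFs is $\mathbf{D}(f,g)=\mathbb{P}(f(\sigma)\ne g(\sigma))$ for uniform $\sigma\in S_k^n$, and $\mathbf{D}(f,G)=\min_{g\in G}\mathbf{D}(f,g)$ for a class $G$. -}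

module Defs where

open import Data.Nat as ℕ using (ℕ; zero; suc; _!)
open import Data.Nat.Properties using (_!≢0; m^n≢0; m*n≢0)
open import Data.Fin using (Fin; toℕ)
open import Data.Fin.Subset using (Subset; _∈_; Nonempty)
open import Data.Vec using (Vec; lookup; _[_]≔_)
open import Data.List using (List; length)
open import Data.List.Relation.Unary.All using (All)
open import Data.List.Relation.Unary.Unique.Propositional using (Unique)
open import Data.Integer using (+_)
open import Data.Rational using (ℚ; _/_; _≤_; _*_; 1ℚ; 0ℚ)
open import Data.Product using (Σ; ∃; ∃-syntax; _×_)
open import Data.Sum using (_⊎_)
open import Relation.Binary.PropositionalEquality using (_≡_; _≢_)

-- Rankings of the alternatives [k] = Fin k.
-- A ranking lists the alternatives from best (position 0) to worst;
-- the list is a bijection position ↦ alternative.  The injectivity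
-- proof is an irrelevant field, so two rankings are equal (≡) iff
-- their orders are equal; hence distinctness of rankings is the
-- correct one for counting.

record Ranking (k : ℕ) : Set where
  constructor ranking
  field
    order    : Vec (Fin k) k
    .distinct : ∀ {p q : Fin k} → lookup order p ≡ lookup order q → p ≡ q
open Ranking public

_>[_]_ : ∀ {k} → Fin k → Ranking k → Fin k → Set
a >[ ρ ] b = ∃[ p ] ∃[ q ] (toℕ p ℕ.< toℕ q × lookup (order ρ) p ≡ a × lookup (order ρ) q ≡ b)

Profile : ℕ → ℕ → Set
Profile k n = Vec (Ranking k) n

SCF : ℕ → ℕ → Set
SCF k n = Profile k n → Fin k

IsManipulationPoint : ∀ {k n} → SCF k n → Profile k n → Set
IsManipulationPoint f σ =
  ∃[ i ] ∃[ τ ] (f (σ [ i ]≔ τ) >[ lookup σ i ] f σ)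

-- τ is obtained from ρ by permuting (at most) r alternatives occupying
-- adjacent positions: there is a window of r consecutive positions
-- [s, s + r) outside of which ρ and τ agree.
AdjacentPermutation : ∀ {k} → ℕ → Ranking k → Ranking k → Set
AdjacentPermutation {k} r ρ τ =
  Σ ℕ λ s → ∀ (p : Fin k) → (toℕ p ℕ.< s ⊎ s ℕ.+ r ℕ.≤ toℕ p) →
    lookup (order ρ) p ≡ lookup (order τ) p

IsRManipulationPoint : ∀ {k n} → ℕ → SCF k n → Profile k n → Set
IsRManipulationPoint r f σ =
  ∃[ i ] ∃[ τ ] (AdjacentPermutation r (lookup σ i) τ
                 × f (σ [ i ]≔ τ) >[ lookup σ i ] f σ)

IsTop : ∀ {k} → Subset k → Ranking k → Fin k → Set
IsTop H ρ a = a ∈ H × (∀ b → b ∈ H → b ≢ a → a >[ ρ ] b)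

IsTopHDictator : ∀ {k n} → SCF k n → Set
IsTopHDictator {k} {n} f =
  ∃[ i ] Σ (Subset k) λ H → Nonempty H × (∀ σ → IsTop H (lookup σ i) (f σ))

TakesExactlyTwoValues : ∀ {k n} → SCF k n → Fin k → Fin k → Set
TakesExactlyTwoValues f a b =
  a ≢ b × (∀ σ → f σ ≡ a ⊎ f σ ≡ b) × (∃[ σ ] f σ ≡ a) × (∃[ σ ] f σ ≡ b)

IsMonotoneTwoValued : ∀ {k n} → SCF k n → Set
IsMonotoneTwoValued f =
  ∃[ a ] ∃[ b ] (TakesExactlyTwoValues f a b ×
    (∀ σ i τ → f σ ≡ a → f (σ [ i ]≔ τ) ≡ b →
       (a >[ lookup σ i ] b) × (b >[ τ ] a)))

NONMANIP : ∀ {k n} → SCF k n → Set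
NONMANIP f = IsTopHDictator f ⊎ IsMonotoneTwoValued f

-- Probabilities for uniform σ ∈ S_k^n, |S_k^n| = (k !)^n.
-- "P(σ ∈ A) ≥ r" : there are m distinct profiles in A with
-- r ≤ m / (k!)^n  (i.e. |A| / (k!)^n ≥ r).

ProbAtLeast : ∀ k n → (Profile k n → Set) → ℚ → Set
ProbAtLeast k n A r =
  Σ (List (Profile k n)) λ L → Unique L × All A L ×
    (r ≤ (+ length L / ((k !) ℕ.^ n)) {{m^n≢0 (k !) n {{k !≢0}}}})

DistAtLeast : ∀ {k n} → SCF k n → SCF k n → ℚ → Set
DistAtLeast {k} {n} f g ε = ProbAtLeast k n (λ σ → f σ ≢ g σ) ε

DistNONMANIPAtLeast : ∀ {k n} → SCF k n → ℚ → Set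
DistNONMANIPAtLeast f ε = ∀ g → NONMANIP g → DistAtLeast f g ε

_^ℚ_ : ℚ → ℕ → ℚ
x ^ℚ zero  = 1ℚ
x ^ℚ suc m = x * (x ^ℚ m)

-- Only used for n ≥ 1 and k ≥ 3; the value for n = 0 or k = 0 is junk.
bound : ℕ → ℕ → ℚ → ℚ
bound (suc n) (suc k) ε =
  (ε ^ℚ 15) * (+ 1 / (10 ℕ.^ 39 ℕ.* (suc n ℕ.^ 67) ℕ.* (suc k ℕ.^ 166)))
    {{m*n≢0 _ _ {{m*n≢0 _ _ {{m^n≢0 10 39}} {{m^n≢0 (suc n) 67}}}} {{m^n≢0 (suc k) 166}}}}
bound _ _ ε = 0ℚ

{-# OPTIONS --safe #-}
{-
Call two profiles an edge if they differ by a swap of neighbours x, y in one ballot.  If neither end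
of an edge is manipulable by such a swap, then the outcome can only change from the lowered
alternative x to the raised alternative y; in particular a winner stays the winner while it is raised.
Any two profiles are joined by words in these swaps, each of which permutes the set of profiles, so an
event that rarely changes along edges is almost sure or almost impossible, and an event that rarely
changes along swaps of pairs other than {a, b} is essentially a function of the votes on {a, b}.

Say that i is pivotal for {a, b} at a profile if f elects a when i ranks a first and b second, and b when
i ranks b first and a second.  Away from manipulable profiles this event does not change under swaps of other pairs
(the edge between the two ballots of i forbids it), so it depends on the votes on {a, b} only.  If i is
often pivotal for {a, b} and j ≠ i for another pair {c, d}, then by reverse hypercontractivity (the votes on
the two pairs have correlation at most 1/2) both events often occur together.  Choose x in {a, b} but not
in {c, d} and y in {c, d} but not in {a, b}: if i raises x and j raises y to the top, then both x and y
have to win, so there are many manipulable profiles.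

Otherwise only one voter i is often pivotal, or only one pair {a, b} is.  In the first case f hardly depends on the
other voters and is close to the top, in the ballot of i, of the alternatives that win when i puts them on
top.  In the second case f is close to constant or to a function of the votes on {a, b}, which becomes
monotone after sorting it coordinate by coordinate.
-}
module Submission where

open import Defs
open import Data.Bool as Bool using (Bool; true; false; _xor_; _∧_; _∨_; not; if_then_else_)
open import Data.Bool.Properties using (xor-same; xor-comm; ∧-identityʳ; ∧-comm; ¬-not)
open import Data.Empty using (⊥; ⊥-elim; ⊥-elim-irr)
open import Data.Fin as Fin using (Fin; toℕ)
open import Data.Fin.Permutation.Components using (transpose)
open import Data.Fin.Properties as Fin using (toℕ-injective; injective⇒≤; punchOut-injective; any?; toℕ<n; toℕ-fromℕ<; toℕ-inject; ¬∀⟶∃¬-smallest)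
open import Data.Fin.Subset using (Subset; Nonempty; ⁅_⁆) renaming (_∈_ to _∈ₛ_)
open import Data.Fin.Subset.Properties using (_∈?_; x∈⁅x⁆; x∈⁅y⁆⇒x≡y; nonempty?)
import Data.Integer as ℤ
import Data.Integer.Properties as ℤ
open import Data.List using (List; []; _∷_; map; length; _++_; concatMap; cartesianProductWith; allFin; upTo; filter)
open import Data.List.Membership.Propositional using (_∈_; find; lose)
open import Data.List.Membership.Propositional.Properties using (∈-map⁺; ∈-map⁻; ∈-concatMap⁺; ∈-cartesianProductWith⁺; ∈-allFin; ∈-upTo⁺; ∈-filter⁺; ∈-∃++; ∈-++⁻; ∈-++⁺ˡ; ∈-++⁺ʳ)
open import Data.List.Membership.Propositional.Properties.WithK using (unique∧set⇒bag)
open import Data.List.Properties as List using (length-map; length-++; length-tabulate; length-upTo; map-tabulate; map-concatMap; concatMap-cong; map-∘; map-cong)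
open import Data.List.Relation.Binary.BagAndSetEquality using (∼bag⇒↭)
open import Data.List.Relation.Binary.Permutation.Propositional as ↭ using (_↭_)
open import Data.List.Relation.Unary.All as All using (All; []; _∷_)
import Data.List.Relation.Unary.All.Properties as All
open import Data.List.Relation.Unary.AllPairs as AllPairs using ([]; _∷_)
import Data.List.Relation.Unary.AllPairs.Properties as AllPairs
open import Data.List.Relation.Unary.Any as Any using (here; there)
open import Data.List.Relation.Unary.Unique.Propositional using (Unique)
import Data.List.Relation.Unary.Unique.Propositional.Properties as Unique
open import Data.Nat as ℕ using (ℕ; zero; suc; _+_; _*_; _∸_; _^_; _⊔_; _≤_; _<_; z≤n; s≤s; NonZero; _!)
open import Data.Nat.Properties
open import Data.Nat.Tactic.RingSolver using (solve-∀)
open import Data.Product using (Σ; ∃-syntax; _×_; _,_; proj₁; proj₂)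
open import Data.Rational as ℚ using (ℚ; 0ℚ; 1ℚ; _/_)
import Data.Rational.Properties as ℚ
open import Data.Rational.Unnormalised as ℚᵘ using (mkℚᵘ; *≤*)
import Data.Rational.Unnormalised.Properties as ℚᵘ
open import Data.Sum using (_⊎_; inj₁; inj₂)
open import Data.Vec as Vec using (Vec; []; _∷_; lookup; updateAt; removeAt; toList; zipWith)
open import Data.Vec.Properties using (∷-injective; lookup-map; lookup-allFin; lookup∘tabulate; lookup∘updateAt; lookup∘updateAt′; lookup⇒[]=; []=⇒lookup; removeAt-punchOut; tabulate∘lookup; tabulate-cong; updateAt-id; updateAt-id-local; updateAt-updateAt; updateAt-cong-local; updateAt-commutes)
open import Function using (_∘_; id; mk⇔)
open import Relation.Binary.Definitions using (tri<; tri≈; tri>)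
open import Relation.Binary.PropositionalEquality as ≡ using (_≡_; _≢_; refl; sym; trans; cong; cong₂; subst; subst₂)
open import Relation.Nullary using (¬_; Dec; yes; no; does)
open import Relation.Nullary.Decidable using (dec-true; dec-false; decidable-stable; map′; ¬?; _×-dec_; _⊎-dec_)

-- All probabilities are counts among N profiles, and the unit of error is the number `m` of
-- profiles manipulable by one swap of neighbours. A union bound has to know how many profiles a map
-- sends to the same bad one: one for a swap, at most k for raising an alternative to the top. Hence
-- nearly every estimate is linear in `m`, with a factor polynomial in n and k. Passing from single
-- swaps to resampled ballots stays linear too: a fresh ballot is a random word of at most k² swaps
-- applied to the old one, and every swap preserves the uniform law.
--
-- The one nonlinear step is reverse hypercontractivity: two events of at least μ profiles each,
-- depending on the votes on different pairs, meet in at least μ⁴/N³ profiles. This dictates the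
-- threshold θ between often and rarely pivotal: up to polynomial factors it is the fourth root of
-- N³m. The number D of profiles at which f differs from a suitable member of `NONMANIP` then
-- satisfies D⁴ ≤ K m N³, that is, ε⁴/K is at most the probability of a manipulable profile. The
-- exponent 15 follows because ε ≤ 1.

private variable
  A X Y : Set
  k n : ℕ

-- Finite sums

∑ : List X → (X → ℕ) → ℕ
∑ []       φ = 0
∑ (x ∷ xs) φ = φ x + ∑ xs φ

∑-cong : ∀ (xs : List X) {φ ψ} → (∀ x → φ x ≡ ψ x) → ∑ xs φ ≡ ∑ xs ψ
∑-cong []       e = refl
∑-cong (x ∷ xs) e = cong₂ _+_ (e x) (∑-cong xs e)

∑-mono : ∀ (xs : List X) {φ ψ} → (∀ x → φ x ≤ ψ x) → ∑ xs φ ≤ ∑ xs ψ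
∑-mono []       e = z≤n
∑-mono (x ∷ xs) e = +-mono-≤ (e x) (∑-mono xs e)

∑-+ : ∀ (xs : List X) φ ψ → ∑ xs (λ x → φ x + ψ x) ≡ ∑ xs φ + ∑ xs ψ
∑-+ []       φ ψ = refl
∑-+ (x ∷ xs) φ ψ = trans (cong (φ x + ψ x +_) (∑-+ xs φ ψ))
  (eq (φ x) (ψ x) (∑ xs φ) (∑ xs ψ))
  where
  eq : ∀ a b c d → a + b + (c + d) ≡ a + c + (b + d)
  eq = solve-∀

∑-* : ∀ (xs : List X) c φ → ∑ xs (λ x → c * φ x) ≡ c * ∑ xs φ
∑-* []       c φ = sym (*-zeroʳ c)
∑-* (x ∷ xs) c φ = trans (cong (c * φ x +_) (∑-* xs c φ)) (sym (*-distribˡ-+ c (φ x) (∑ xs φ)))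

∑-const : ∀ (xs : List X) c → ∑ xs (λ _ → c) ≡ length xs * c
∑-const []       c = refl
∑-const (x ∷ xs) c = cong (c +_) (∑-const xs c)

∑-zero : ∀ (xs : List X) → ∑ xs (λ _ → 0) ≡ 0
∑-zero xs = trans (∑-const xs 0) (*-zeroʳ (length xs))

∑-≤-const : ∀ (xs : List X) {φ} c → (∀ x → φ x ≤ c) → ∑ xs φ ≤ length xs * c
∑-≤-const xs c h = ≤-trans (∑-mono xs h) (≤-reflexive (∑-const xs c))

∑-swap : ∀ (xs : List X) (ys : List Y) (φ : X → Y → ℕ) →
  ∑ xs (λ x → ∑ ys (φ x)) ≡ ∑ ys (λ y → ∑ xs (λ x → φ x y))
∑-swap [] ys φ = sym (∑-zero ys)
∑-swap (x ∷ xs) ys φ = trans (cong (∑ ys (φ x) +_) (∑-swap xs ys φ)) (sym (∑-+ ys (φ x) _))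

∑-map : ∀ (g : X → Y) xs (φ : Y → ℕ) → ∑ (map g xs) φ ≡ ∑ xs (φ ∘ g)
∑-map g []       φ = refl
∑-map g (x ∷ xs) φ = cong (φ (g x) +_) (∑-map g xs φ)

∑-++ : ∀ (xs ys : List X) φ → ∑ (xs ++ ys) φ ≡ ∑ xs φ + ∑ ys φ
∑-++ []       ys φ = refl
∑-++ (x ∷ xs) ys φ = trans (cong (φ x +_) (∑-++ xs ys φ)) (sym (+-assoc (φ x) _ _))

∑-↭ : ∀ {xs ys : List X} φ → xs ↭ ys → ∑ xs φ ≡ ∑ ys φ
∑-↭ φ ↭.refl         = refl
∑-↭ φ (↭.prep x p)   = cong (φ x +_) (∑-↭ φ p)
∑-↭ φ (↭.swap {xs} {ys} x y p) = trans (cong (λ s → φ x + (φ y + s)) (∑-↭ φ p)) (eq (φ x) (φ y) (∑ ys φ))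
  where
  eq : ∀ a b c → a + (b + c) ≡ b + (a + c)
  eq = solve-∀
∑-↭ φ (↭.trans p q)  = trans (∑-↭ φ p) (∑-↭ φ q)

∑-∈ : ∀ {xs : List X} {x} φ → x ∈ xs → φ x ≤ ∑ xs φ
∑-∈ φ (here refl) = m≤m+n _ _
∑-∈ φ (there {x = y} m) = ≤-trans (∑-∈ φ m) (m≤n+m _ (φ y))

∑-allFin-suc : ∀ n (φ : Fin (suc n) → ℕ) →
  ∑ (allFin (suc n)) φ ≡ φ Fin.zero + ∑ (allFin n) (φ ∘ Fin.suc)
∑-allFin-suc n φ = cong (φ Fin.zero +_)
  (trans (cong (λ l → ∑ l φ) (sym (map-tabulate id Fin.suc))) (∑-map Fin.suc (allFin n) φ))

∑-average : ∀ (xs : List X) φ c → 0 < length xs → ∑ xs φ ≤ length xs * c → ∃[ x ] φ x ≤ c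
∑-average (x ∷ xs) φ c _ h = go x xs h
  where
  go : ∀ x xs → ∑ (x ∷ xs) φ ≤ suc (length xs) * c → ∃[ y ] φ y ≤ c
  go x []       h = x , ≤-trans (m≤m+n _ _) (≤-trans h (≤-reflexive (+-identityʳ c)))
  go x (y ∷ xs) h with φ x ≤? c
  ... | yes p = x , p
  ... | no ¬p = go y xs (+-cancelˡ-≤ c _ _ (≤-trans (+-monoˡ-≤ _ (<⇒≤ (≰⇒> ¬p))) h))

-- Vectors over a finite list

vecs : List A → ∀ n → List (Vec A n)
vecs xs zero    = [] ∷ []
vecs xs (suc n) = cartesianProductWith _∷_ xs (vecs xs n)

∑-vecs-suc : ∀ (xs : List A) n φ →
  ∑ (vecs xs (suc n)) φ ≡ ∑ xs (λ x → ∑ (vecs xs n) (λ v → φ (x ∷ v)))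
∑-vecs-suc xs n φ = go xs
  where
  go : ∀ ys → ∑ (cartesianProductWith _∷_ ys (vecs xs n)) φ ≡ ∑ ys (λ x → ∑ (vecs xs n) (λ v → φ (x ∷ v)))
  go []       = refl
  go (y ∷ ys) = trans (∑-++ (map (y ∷_) (vecs xs n)) _ φ)
    (cong₂ _+_ (∑-map (y ∷_) (vecs xs n) φ) (go ys))

length-∑ : ∀ (xs : List X) → ∑ xs (λ _ → 1) ≡ length xs
length-∑ xs = trans (∑-const xs 1) (*-identityʳ _)

length-vecs : ∀ (xs : List A) n → length (vecs xs n) ≡ length xs ^ n
length-vecs xs zero    = refl
length-vecs xs (suc n) = trans (sym (length-∑ (vecs xs (suc n)))) (trans (∑-vecs-suc xs n _)
  (trans (∑-cong xs (λ _ → trans (length-∑ (vecs xs n)) (length-vecs xs n))) (∑-const xs _)))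

vecs-complete : ∀ {xs : List A} → (∀ a → a ∈ xs) → ∀ {n} (v : Vec A n) → v ∈ vecs xs n
vecs-complete h []      = here refl
vecs-complete h (x ∷ v) = ∈-cartesianProductWith⁺ _∷_ (h x) (vecs-complete h v)

vecs-unique : ∀ {xs : List A} → Unique xs → ∀ n → Unique (vecs xs n)
vecs-unique u zero    = [] ∷ []
vecs-unique u (suc n) = Unique.cartesianProductWith⁺ _∷_ ∷-injective u (vecs-unique u n)

-- Maps with bounded fibres

-- The image of the uniform law under `T` has density at most `c`. Testing against all weights φ
-- makes composition a substitution and avoids speaking of fibres.
record Expands (xs : List X) (c : ℕ) (T : X → X) : Set where
  constructor expands
  field ∑-∘ : ∀ (φ : X → ℕ) → ∑ xs (φ ∘ T) ≤ c * ∑ xs φ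
open Expands public

expands-id : ∀ {xs : List X} → Expands xs 1 id
expands-id .∑-∘ φ = ≤-reflexive (sym (+-identityʳ _))

expands-∘ : ∀ {xs : List X} {c d S T} → Expands xs c S → Expands xs d T → Expands xs (d * c) (S ∘ T)
expands-∘ {c = c} {d} {S} s t .∑-∘ φ = ≤-trans (∑-∘ t (φ ∘ S))
  (≤-trans (*-monoʳ-≤ d (∑-∘ s φ)) (≤-reflexive (sym (*-assoc d c _))))

-- Which `w y` agrees with `T` may vary from point to point; summing φ over the whole family only
-- overcounts.
expands-cover : ∀ {xs : List X} {T} (Ω : List Y) (w : Y → X → X) → (∀ y → Expands xs 1 (w y)) →
  (∀ x → ∃[ y ] (y ∈ Ω × T x ≡ w y x)) → Expands xs (length Ω) T
expands-cover {xs = xs} {T} Ω w e cov .∑-∘ φ = begin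
  ∑ xs (φ ∘ T)  ≤⟨ ∑-mono xs covered ⟩
  ∑ xs (λ x → ∑ Ω (λ y → φ (w y x)))  ≡⟨ ∑-swap xs Ω _ ⟩
  ∑ Ω (λ y → ∑ xs (φ ∘ w y))  ≤⟨ ∑-≤-const Ω _ (λ y → ≤-trans (∑-∘ (e y) φ) (≤-reflexive (+-identityʳ _))) ⟩
  length Ω * ∑ xs φ  ∎
  where
  open ≤-Reasoning
  covered : ∀ x → φ (T x) ≤ ∑ Ω (λ y → φ (w y x))
  covered x with cov x
  ... | y , m , e rewrite e = ∑-∈ (λ y → φ (w y x)) m

expands-updateAt : ∀ {xs : List A} {c T} → Expands xs c T → ∀ {n} v → Expands (vecs xs n) c (λ σ → updateAt σ v T)
expands-updateAt {xs = xs} {c} {T} e {suc n} Fin.zero .∑-∘ φ = begin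
  ∑ (vecs xs (suc n)) _  ≡⟨ ∑-vecs-suc xs n _ ⟩
  ∑ xs (λ x → ∑ (vecs xs n) (λ v → φ (T x ∷ v)))  ≤⟨ ∑-∘ e (λ x → ∑ (vecs xs n) (λ v → φ (x ∷ v))) ⟩
  c * ∑ xs (λ x → ∑ (vecs xs n) (λ v → φ (x ∷ v)))  ≡⟨ cong (c *_) (∑-vecs-suc xs n φ) ⟨
  c * ∑ (vecs xs (suc n)) φ  ∎
  where open ≤-Reasoning
expands-updateAt {xs = xs} {c} {T} e {suc n} (Fin.suc v) .∑-∘ φ = begin
  ∑ (vecs xs (suc n)) _  ≡⟨ ∑-vecs-suc xs n _ ⟩
  ∑ xs (λ x → ∑ (vecs xs n) (λ σ → φ (x ∷ updateAt σ v T)))  ≤⟨ ∑-mono xs (λ x → ∑-∘ (expands-updateAt e v) (λ σ → φ (x ∷ σ))) ⟩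
  ∑ xs (λ x → c * ∑ (vecs xs n) (λ σ → φ (x ∷ σ)))  ≡⟨ ∑-* xs c _ ⟩
  c * ∑ xs (λ x → ∑ (vecs xs n) (λ v → φ (x ∷ v)))  ≡⟨ cong (c *_) (∑-vecs-suc xs n φ) ⟨
  c * ∑ (vecs xs (suc n)) φ  ∎
  where open ≤-Reasoning

-- Counting events

𝟙 : Bool → ℕ
𝟙 true  = 1
𝟙 false = 0

𝟙≤1 : ∀ b → 𝟙 b ≤ 1
𝟙≤1 true  = s≤s z≤n
𝟙≤1 false = z≤n

# : List X → (X → Bool) → ℕ
# xs P = ∑ xs (𝟙 ∘ P)

xor-triangle : ∀ a b c → 𝟙 (a xor c) ≤ 𝟙 (a xor b) + 𝟙 (b xor c)
xor-triangle true  true  c     = ≤-refl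
xor-triangle true  false true  = z≤n
xor-triangle true  false false = s≤s z≤n
xor-triangle false true  true  = s≤s z≤n
xor-triangle false true  false = z≤n
xor-triangle false false c     = ≤-refl

#-≤ : ∀ (xs : List X) P {φ} → (∀ x → P x ≡ true → 1 ≤ φ x) → # xs P ≤ ∑ xs φ
#-≤ xs P {φ} h = ∑-mono xs (λ x → go x (P x) refl)
  where
  go : ∀ x b → P x ≡ b → 𝟙 b ≤ φ x
  go x true  e = h x e
  go x false e = z≤n

unless : ∀ (Q : Bool) {r} → (Q ≡ false → 1 ≤ r) → 1 ≤ 𝟙 Q + r
unless true  h = s≤s z≤n
unless false h = h refl

surely : ∀ (Q : Bool) → (Q ≡ false → ⊥) → 1 ≤ 𝟙 Q
surely true  h = s≤s z≤n
surely false h = ⊥-elim (h refl)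

influence : List A → (Vec A n → Bool) → Fin n → ℕ
influence {n = n} xs B v =
  ∑ (vecs xs n) λ σ → ∑ xs λ ρ → 𝟙 (B σ xor B (updateAt σ v (λ _ → ρ)))

-- The way from `ρ ∷ σ` to `ρ′ ∷ τ` leads through `ρ′ ∷ σ`: the first half is the influence of the
-- head, the second half is the induction. Divided by the number of triples, this says that two
-- independent vectors are separated by `B` at most as often as the single resamplings together
-- change `B`.
efron-stein : ∀ (xs : List A) {n} (B : Vec A n → Bool) →
  length xs * ∑ (vecs xs n) (λ σ → ∑ (vecs xs n) λ τ → 𝟙 (B σ xor B τ))
    ≤ length (vecs xs n) * ∑ (allFin n) (influence xs B)
efron-stein xs {zero}  B rewrite xor-same (B []) | *-zeroʳ (length xs) = z≤n
efron-stein {A} xs {suc n} B = begin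
  r * ∑ Vₛ (λ σ → ∑ Vₛ λ τ → 𝟙 (B σ xor B τ))  ≡⟨ cong (r *_) expand ⟩
  r * ∑⁴ (λ ρ ρ′ σ τ → 𝟙 (B (ρ ∷ σ) xor B (ρ′ ∷ τ)))
    ≤⟨ *-monoʳ-≤ r (mono⁴ λ ρ ρ′ σ τ → xor-triangle (B (ρ ∷ σ)) (B (ρ′ ∷ σ)) (B (ρ′ ∷ τ))) ⟩
  r * ∑⁴ (λ ρ ρ′ σ τ → 𝟙 (B (ρ ∷ σ) xor B (ρ′ ∷ σ)) + 𝟙 (B (ρ′ ∷ σ) xor B (ρ′ ∷ τ)))
    ≡⟨ cong (r *_) split⁴ ⟩
  r * (∑⁴ (λ ρ ρ′ σ τ → 𝟙 (B (ρ ∷ σ) xor B (ρ′ ∷ σ))) + ∑⁴ (λ ρ ρ′ σ τ → 𝟙 (B (ρ′ ∷ σ) xor B (ρ′ ∷ τ))))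
    ≡⟨ cong₂ (λ a b → r * (a + b)) head-part tail-part ⟩
  r * (N * I₀ + r * T)  ≡⟨ *-distribˡ-+ r (N * I₀) (r * T) ⟩
  r * (N * I₀) + r * (r * T)  ≤⟨ +-monoʳ-≤ (r * (N * I₀)) (*-monoʳ-≤ r tail-bound) ⟩
  r * (N * I₀) + r * (N * J)  ≡⟨ eq r N I₀ J ⟩
  r * N * (I₀ + J)  ≡⟨ cong₂ _*_ (sym lengthₛ) (sym influences) ⟩
  length Vₛ * ∑ (allFin (suc n)) (influence xs B)  ∎
  where
  open ≤-Reasoning
  r = length xs
  V = vecs xs n
  Vₛ = vecs xs (suc n)
  N = length V
  ∑⁴ : (A → A → Vec A n → Vec A n → ℕ) → ℕ
  ∑⁴ φ = ∑ xs λ ρ → ∑ xs λ ρ′ → ∑ V λ σ → ∑ V λ τ → φ ρ ρ′ σ τ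
  I₀ = influence xs B Fin.zero
  T = ∑ xs λ ρ′ → ∑ V λ σ → ∑ V λ τ → 𝟙 (B (ρ′ ∷ σ) xor B (ρ′ ∷ τ))
  J = ∑ (allFin n) (influence xs B ∘ Fin.suc)
  lengthₛ : length Vₛ ≡ r * N
  lengthₛ = trans (length-vecs xs (suc n)) (cong (r *_) (sym (length-vecs xs n)))
  influences : ∑ (allFin (suc n)) (influence xs B) ≡ I₀ + J
  influences = ∑-allFin-suc n (influence xs B)
  expand : ∑ Vₛ (λ σ → ∑ Vₛ λ τ → 𝟙 (B σ xor B τ)) ≡ ∑⁴ (λ ρ ρ′ σ τ → 𝟙 (B (ρ ∷ σ) xor B (ρ′ ∷ τ)))
  expand = trans (∑-vecs-suc xs n _) (∑-cong xs λ ρ →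
    trans (∑-cong V λ σ → ∑-vecs-suc xs n _) (∑-swap V xs _))
  mono⁴ : ∀ {φ ψ} → (∀ ρ ρ′ σ τ → φ ρ ρ′ σ τ ≤ ψ ρ ρ′ σ τ) → ∑⁴ φ ≤ ∑⁴ ψ
  mono⁴ h = ∑-mono xs λ ρ → ∑-mono xs λ ρ′ → ∑-mono V λ σ → ∑-mono V λ τ → h ρ ρ′ σ τ
  split⁴ : ∀ {φ ψ} → ∑⁴ (λ ρ ρ′ σ τ → φ ρ ρ′ σ τ + ψ ρ ρ′ σ τ) ≡ ∑⁴ φ + ∑⁴ ψ
  split⁴ = trans (∑-cong xs λ ρ → trans (∑-cong xs λ ρ′ → trans (∑-cong V λ σ → ∑-+ V _ _)
    (∑-+ V _ _)) (∑-+ xs _ _)) (∑-+ xs _ _)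
  head-part : ∑⁴ (λ ρ ρ′ σ τ → 𝟙 (B (ρ ∷ σ) xor B (ρ′ ∷ σ))) ≡ N * I₀
  head-part = trans (∑-cong xs λ ρ → trans (∑-cong xs λ ρ′ → trans (∑-cong V λ σ → ∑-const V _)
      (∑-* V N _)) (∑-* xs N _))
    (trans (∑-* xs N _) (cong (N *_) (trans (∑-cong xs λ ρ → ∑-swap xs V _) (sym (∑-vecs-suc xs n _)))))
  tail-part : ∑⁴ (λ ρ ρ′ σ τ → 𝟙 (B (ρ′ ∷ σ) xor B (ρ′ ∷ τ))) ≡ r * T
  tail-part = ∑-const xs T
  tail-bound : r * T ≤ N * J
  tail-bound = begin
    r * T  ≡⟨ ∑-* xs r _ ⟨
    ∑ xs (λ ρ → r * ∑ V λ σ → ∑ V λ τ → 𝟙 (B (ρ ∷ σ) xor B (ρ ∷ τ)))  ≤⟨ ∑-mono xs (λ ρ → efron-stein xs (B ∘ (ρ ∷_))) ⟩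
    ∑ xs (λ ρ → N * ∑ (allFin n) (influence xs (B ∘ (ρ ∷_))))  ≡⟨ ∑-* xs N _ ⟩
    N * ∑ xs (λ ρ → ∑ (allFin n) (influence xs (B ∘ (ρ ∷_))))  ≡⟨ cong (N *_) (∑-swap xs (allFin n) _) ⟩
    N * ∑ (allFin n) (λ v → ∑ xs (λ ρ → influence xs (B ∘ (ρ ∷_)) v))  ≡⟨ cong (N *_) (∑-cong (allFin n) λ v → sym (∑-vecs-suc xs n _)) ⟩
    N * J  ∎
  eq : ∀ r N a b → r * (N * a) + r * (N * b) ≡ r * N * (a + b)
  eq = solve-∀

-- Swapping neighbours in a vector

-- Total in `p`: without a pair at `p` and `p + 1` the vector stays as it is, so swaps can be
-- indexed by all natural numbers.
swapAt : ℕ → Vec A n → Vec A n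
swapAt p       []          = []
swapAt zero    (x ∷ [])    = x ∷ []
swapAt zero    (x ∷ y ∷ v) = y ∷ x ∷ v
swapAt (suc p) (x ∷ v)     = x ∷ swapAt p v

swapFin : ℕ → Fin n → Fin n
swapFin {suc zero}    zero    i                     = i
swapFin {suc (suc n)} zero    Fin.zero              = Fin.suc Fin.zero
swapFin {suc (suc n)} zero    (Fin.suc Fin.zero)    = Fin.zero
swapFin {suc (suc n)} zero    (Fin.suc (Fin.suc i)) = Fin.suc (Fin.suc i)
swapFin (suc p) Fin.zero    = Fin.zero
swapFin (suc p) (Fin.suc i) = Fin.suc (swapFin p i)

lookup-swapAt : ∀ p (v : Vec A n) i → lookup (swapAt p v) i ≡ lookup v (swapFin p i)
lookup-swapAt zero    (x ∷ [])    i                     = refl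
lookup-swapAt zero    (x ∷ y ∷ v) Fin.zero              = refl
lookup-swapAt zero    (x ∷ y ∷ v) (Fin.suc Fin.zero)    = refl
lookup-swapAt zero    (x ∷ y ∷ v) (Fin.suc (Fin.suc i)) = refl
lookup-swapAt (suc p) (x ∷ v)     Fin.zero              = refl
lookup-swapAt (suc p) (x ∷ v)     (Fin.suc i)           = lookup-swapAt p v i

swapFin-involutive : ∀ p (i : Fin n) → swapFin p (swapFin p i) ≡ i
swapFin-involutive {suc zero}    zero    i                     = refl
swapFin-involutive {suc (suc n)} zero    Fin.zero              = refl
swapFin-involutive {suc (suc n)} zero    (Fin.suc Fin.zero)    = refl
swapFin-involutive {suc (suc n)} zero    (Fin.suc (Fin.suc i)) = refl
swapFin-involutive (suc p) Fin.zero    = refl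
swapFin-involutive (suc p) (Fin.suc i) = cong Fin.suc (swapFin-involutive p i)

swapFin-injective : ∀ p {i j : Fin n} → swapFin p i ≡ swapFin p j → i ≡ j
swapFin-injective p {i} {j} e = trans (sym (swapFin-involutive p i)) (trans (cong (swapFin p) e) (swapFin-involutive p j))

swapFin-< : ∀ p (i j : Fin n) → i Fin.< j →
  swapFin p i Fin.< swapFin p j ⊎ (toℕ i ≡ p × toℕ j ≡ suc p)
swapFin-< {suc zero}    zero Fin.zero (Fin.suc ())
swapFin-< {suc (suc n)} zero Fin.zero (Fin.suc Fin.zero)    _ = inj₂ (refl , refl)
swapFin-< {suc (suc n)} zero Fin.zero (Fin.suc (Fin.suc j)) _ = inj₁ (s≤s (s≤s z≤n))
swapFin-< {suc (suc n)} zero (Fin.suc Fin.zero) (Fin.suc Fin.zero) (s≤s ())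
swapFin-< {suc (suc n)} zero (Fin.suc Fin.zero) (Fin.suc (Fin.suc j)) _ = inj₁ (s≤s z≤n)
swapFin-< {suc (suc n)} zero (Fin.suc (Fin.suc i)) (Fin.suc Fin.zero) (s≤s ())
swapFin-< {suc (suc n)} zero (Fin.suc (Fin.suc i)) (Fin.suc (Fin.suc j)) h = inj₁ h
swapFin-< (suc p) Fin.zero    (Fin.suc j) h       = inj₁ (s≤s z≤n)
swapFin-< (suc p) (Fin.suc i) (Fin.suc j) (s≤s h) with swapFin-< p i j h
... | inj₁ l       = inj₁ (s≤s l)
... | inj₂ (e , f) = inj₂ (cong suc e , cong suc f)

swapFin-pred : ∀ p (i : Fin n) → toℕ i ≡ suc p → toℕ (swapFin p i) ≡ p
swapFin-pred {suc (suc n)} zero (Fin.suc Fin.zero) e = refl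
swapFin-pred (suc p) (Fin.suc i) e = cong suc (swapFin-pred p i (suc-injective e))

swapFin-fix : ∀ {n} p (i : Fin n) → toℕ i ≢ p → toℕ i ≢ suc p → swapFin p i ≡ i
swapFin-fix {suc zero}    zero    i                     _ _ = refl
swapFin-fix {suc (suc n)} zero    Fin.zero              h _ = ⊥-elim (h refl)
swapFin-fix {suc (suc n)} zero    (Fin.suc Fin.zero)    _ h = ⊥-elim (h refl)
swapFin-fix {suc (suc n)} zero    (Fin.suc (Fin.suc i)) _ _ = refl
swapFin-fix (suc p) Fin.zero    _ _ = refl
swapFin-fix (suc p) (Fin.suc i) g h = cong Fin.suc (swapFin-fix p i (g ∘ cong suc) (h ∘ cong suc))

swapAt-involutive : ∀ p (v : Vec A n) → swapAt p (swapAt p v) ≡ v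
swapAt-involutive p       []          = refl
swapAt-involutive zero    (x ∷ [])    = refl
swapAt-involutive zero    (x ∷ y ∷ v) = refl
swapAt-involutive (suc p) (x ∷ v)     = cong (x ∷_) (swapAt-involutive p v)

swapAt-trivial : ∀ p (v : Vec A n) → n ≤ suc p → swapAt p v ≡ v
swapAt-trivial p       []          h       = refl
swapAt-trivial zero    (x ∷ [])    h       = refl
swapAt-trivial zero    (x ∷ y ∷ v) (s≤s ())
swapAt-trivial (suc p) (x ∷ v)     (s≤s h) = cong (x ∷_) (swapAt-trivial p v h)

swapAt-map : ∀ {B : Set} (g : A → B) p (v : Vec A n) → swapAt p (Vec.map g v) ≡ Vec.map g (swapAt p v)
swapAt-map g p       []          = refl
swapAt-map g zero    (x ∷ [])    = refl
swapAt-map g zero    (x ∷ y ∷ v) = refl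
swapAt-map g (suc p) (x ∷ v)     = cong (g x ∷_) (swapAt-map g p v)

swapList : ℕ → List A → List A
swapList p       []          = []
swapList zero    (x ∷ [])    = x ∷ []
swapList zero    (x ∷ y ∷ v) = y ∷ x ∷ v
swapList (suc p) (x ∷ v)     = x ∷ swapList p v

toList-swapAt : ∀ p (v : Vec A n) → toList (swapAt p v) ≡ swapList p (toList v)
toList-swapAt p       []          = refl
toList-swapAt zero    (x ∷ [])    = refl
toList-swapAt zero    (x ∷ y ∷ v) = refl
toList-swapAt (suc p) (x ∷ v)     = cong (x ∷_) (toList-swapAt p v)

toList-injective : ∀ (v w : Vec A n) → toList v ≡ toList w → v ≡ w
toList-injective []      []      e = refl
toList-injective (x ∷ v) (y ∷ w) e = cong₂ _∷_ (List.∷-injectiveˡ e) (toList-injective v w (List.∷-injectiveʳ e))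

vec-ext : ∀ (v w : Vec A n) → (∀ i → lookup v i ≡ lookup w i) → v ≡ w
vec-ext v w h = trans (sym (tabulate∘lookup v)) (trans (tabulate-cong h) (tabulate∘lookup w))

-- Positions in a ranking

order-injective : ∀ (ρ : Ranking k) {p q} → lookup (order ρ) p ≡ lookup (order ρ) q → p ≡ q
order-injective (ranking o d) {p} {q} e with p Fin.≟ q
... | yes p≡q = p≡q
... | no  p≢q = ⊥-elim-irr (p≢q (d e))

ranking-ext : ∀ {ρ ρ′ : Ranking k} → order ρ ≡ order ρ′ → ρ ≡ ρ′
ranking-ext {ρ = ranking _ _} {ranking _ _} refl = refl

abstract
  -- A missed alternative would let `punchOut` inject k positions into k - 1 values. Abstract, so
  -- that `pos` never unfolds and is known only through `lookup-pos`.
  position : ∀ (ρ : Ranking k) a → ∃[ p ] lookup (order ρ) p ≡ a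
  position {suc k} ρ a with any? (λ p → lookup (order ρ) p Fin.≟ a)
  ... | yes w = w
  ... | no ¬w = ⊥-elim (1+n≰n (injective⇒≤ {f = λ p → Fin.punchOut (missed p)}
        (λ {p} {q} e → order-injective ρ (punchOut-injective (missed p) (missed q) e))))
    where
    missed : ∀ p → a ≢ lookup (order ρ) p
    missed p e = ¬w (p , sym e)

pos : Ranking k → Fin k → Fin k
pos ρ a = proj₁ (position ρ a)

lookup-pos : ∀ (ρ : Ranking k) a → lookup (order ρ) (pos ρ a) ≡ a
lookup-pos ρ a = proj₂ (position ρ a)

pos-unique : ∀ (ρ : Ranking k) {a p} → lookup (order ρ) p ≡ a → pos ρ a ≡ p
pos-unique ρ {a} e = order-injective ρ (trans (lookup-pos ρ a) (sym e))

pos-injective : ∀ (ρ : Ranking k) {a b} → pos ρ a ≡ pos ρ b → a ≡ b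
pos-injective ρ {a} {b} e = trans (sym (lookup-pos ρ a)) (trans (cong (lookup (order ρ)) e) (lookup-pos ρ b))

above : Ranking k → Fin k → Fin k → Bool
above ρ x y = does (pos ρ x Fin.<? pos ρ y)

does-true : ∀ {P : Set} (P? : Dec P) → does P? ≡ true → P
does-true (yes p) _ = p

above⇒< : ∀ (ρ : Ranking k) x y → above ρ x y ≡ true → pos ρ x Fin.< pos ρ y
above⇒< ρ x y = does-true (pos ρ x Fin.<? pos ρ y)

<⇒above : ∀ (ρ : Ranking k) x y → pos ρ x Fin.< pos ρ y → above ρ x y ≡ true
<⇒above ρ x y l = dec-true (pos ρ x Fin.<? pos ρ y) l

above-irrefl : ∀ (ρ : Ranking k) x → above ρ x x ≡ false
above-irrefl ρ x = dec-false (pos ρ x Fin.<? pos ρ x) (<-irrefl refl)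

above-total : ∀ (ρ : Ranking k) {x y} → x ≢ y → above ρ x y ≡ false → above ρ y x ≡ true
above-total ρ {x} {y} x≢y e with Fin.<-cmp (pos ρ x) (pos ρ y)
... | tri< l _ _ with () ← trans (sym e) (<⇒above ρ x y l)
... | tri≈ _ e′ _ = ⊥-elim (x≢y (pos-injective ρ e′))
... | tri> _ _ l = <⇒above ρ y x l

above-asym : ∀ (ρ : Ranking k) {x y} → above ρ x y ≡ true → above ρ y x ≡ false
above-asym ρ {x} {y} e = dec-false (pos ρ y Fin.<? pos ρ x) (<-asym (above⇒< ρ x y e))

above-flip : ∀ (ρ : Ranking k) {x y} → x ≢ y → above ρ y x ≡ not (above ρ x y)
above-flip ρ {x} {y} x≢y with above ρ x y in e
... | true  = above-asym ρ e
... | false = above-total ρ x≢y e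

>⇒above : ∀ {ρ : Ranking k} {x y} → x >[ ρ ] y → above ρ x y ≡ true
>⇒above {ρ = ρ} {x} {y} (p , q , l , e , f) = <⇒above ρ x y
  (subst₂ Fin._<_ (sym (pos-unique ρ e)) (sym (pos-unique ρ f)) l)

above⇒> : ∀ (ρ : Ranking k) x y → above ρ x y ≡ true → x >[ ρ ] y
above⇒> ρ x y e = pos ρ x , pos ρ y , above⇒< ρ x y e , lookup-pos ρ x , lookup-pos ρ y

above-cong : ∀ (ρ ρ′ : Ranking k) {x y x′ y′} → pos ρ x ≡ pos ρ′ x′ → pos ρ y ≡ pos ρ′ y′ →
  above ρ x y ≡ above ρ′ x′ y′
above-cong ρ ρ′ e f = cong₂ (λ i j → does (i Fin.<? j)) e f

-- Adjacent swaps

sw : ℕ → Ranking k → Ranking k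
sw p ρ = ranking (swapAt p (order ρ)) λ {i} {j} e → swapFin-injective p
  (order-injective ρ (trans (sym (lookup-swapAt p (order ρ) i)) (trans e (lookup-swapAt p (order ρ) j))))

sw-involutive : ∀ p (ρ : Ranking k) → sw p (sw p ρ) ≡ ρ
sw-involutive p ρ = ranking-ext (swapAt-involutive p (order ρ))

sw-trivial : ∀ p (ρ : Ranking k) → k ≤ suc p → sw p ρ ≡ ρ
sw-trivial p ρ h = ranking-ext (swapAt-trivial p (order ρ) h)

pos-sw : ∀ p (ρ : Ranking k) x → pos (sw p ρ) x ≡ swapFin p (pos ρ x)
pos-sw p ρ x = pos-unique (sw p ρ) (trans (lookup-swapAt p (order ρ) _)
  (trans (cong (lookup (order ρ)) (swapFin-involutive p _)) (lookup-pos ρ x)))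

Adjacent : ℕ → Ranking k → Fin k → Fin k → Set
Adjacent p ρ x y = toℕ (pos ρ x) ≡ p × toℕ (pos ρ y) ≡ suc p

above-sw : ∀ p (ρ : Ranking k) x y → above ρ x y ≡ true →
  above (sw p ρ) x y ≡ true ⊎ Adjacent p ρ x y
above-sw p ρ x y e with swapFin-< p (pos ρ x) (pos ρ y) (above⇒< ρ x y e)
... | inj₁ l = inj₁ (<⇒above (sw p ρ) x y (subst₂ Fin._<_ (sym (pos-sw p ρ x)) (sym (pos-sw p ρ y)) l))
... | inj₂ a = inj₂ a

above-sw-changes : ∀ p (ρ : Ranking k) x y → above ρ x y ≢ above (sw p ρ) x y →
  Adjacent p ρ x y ⊎ Adjacent p ρ y x
above-sw-changes p ρ x y ne with x Fin.≟ y
... | yes refl = ⊥-elim (ne (trans (above-irrefl ρ x) (sym (above-irrefl (sw p ρ) x))))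
... | no x≢y with above ρ x y in e
...   | true with above-sw p ρ x y e
...     | inj₁ e′ = ⊥-elim (ne (sym e′))
...     | inj₂ a = inj₁ a
above-sw-changes p ρ x y ne | no x≢y | false with above-sw p ρ y x (above-total ρ x≢y e)
...     | inj₁ e′ = ⊥-elim (ne (sym (above-asym (sw p ρ) e′)))
...     | inj₂ a = inj₂ a

adjacent-sw : ∀ {p} {ρ : Ranking k} {x y} → Adjacent p ρ x y → pos (sw p ρ) y ≡ pos ρ x × pos (sw p ρ) x ≡ pos ρ y
adjacent-sw {p = p} {ρ} {x} {y} (a , b) = y≡x ,
  trans (pos-sw p ρ x) (trans (cong (swapFin p) (trans (sym y≡x) (pos-sw p ρ y))) (swapFin-involutive p _))
  where
  y≡x : pos (sw p ρ) y ≡ pos ρ x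
  y≡x = trans (pos-sw p ρ y) (toℕ-injective (trans (swapFin-pred p (pos ρ y) b) (sym a)))

-- Exchanging the names of two alternatives

transpose-i : ∀ (a b : Fin k) → transpose a b a ≡ b
transpose-i a b with a Fin.≟ a
... | yes _ = refl
... | no ¬e = ⊥-elim (¬e refl)

transpose-j : ∀ (a b : Fin k) → transpose a b b ≡ a
transpose-j a b with b Fin.≟ a
... | yes e = e
... | no _ with b Fin.≟ b
...   | yes _ = refl
...   | no ¬e = ⊥-elim (¬e refl)

transpose-k : ∀ {a b x : Fin k} → x ≢ a → x ≢ b → transpose a b x ≡ x
transpose-k {a = a} {b} {x} x≢a x≢b with x Fin.≟ a
... | yes e = ⊥-elim (x≢a e)
... | no _ with x Fin.≟ b
...   | yes e = ⊥-elim (x≢b e)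
...   | no _ = refl

transpose-involutive : ∀ (a b x : Fin k) → transpose a b (transpose a b x) ≡ x
transpose-involutive a b x with x Fin.≟ a
... | yes refl = transpose-j x b
... | no x≢a with x Fin.≟ b
...   | yes refl = transpose-i a x
...   | no x≢b = transpose-k x≢a x≢b

relabel : Fin k → Fin k → Ranking k → Ranking k
relabel a b ρ = ranking (Vec.map (transpose a b) (order ρ)) λ {i} {j} e → order-injective ρ
  (trans (sym (transpose-involutive a b _)) (trans (cong (transpose a b)
    (trans (sym (lookup-map i (transpose a b) (order ρ))) (trans e (lookup-map j (transpose a b) (order ρ)))))
    (transpose-involutive a b _)))

pos-relabel : ∀ (a b : Fin k) ρ x → pos (relabel a b ρ) x ≡ pos ρ (transpose a b x)
pos-relabel a b ρ x = pos-unique (relabel a b ρ) (trans (lookup-map _ (transpose a b) (order ρ))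
  (trans (cong (transpose a b) (lookup-pos ρ _)) (transpose-involutive a b x)))

above-relabel : ∀ (a b : Fin k) ρ x y → above (relabel a b ρ) x y ≡ above ρ (transpose a b x) (transpose a b y)
above-relabel a b ρ x y = above-cong (relabel a b ρ) ρ (pos-relabel a b ρ x) (pos-relabel a b ρ y)

pos-ext : ∀ {ρ ρ′ : Ranking k} → (∀ x → pos ρ x ≡ pos ρ′ x) → ρ ≡ ρ′
pos-ext {ρ = ρ} {ρ′} h = ranking-ext (vec-ext _ _ λ i →
  sym (trans (cong (lookup (order ρ′)) (trans (sym (pos-unique ρ refl)) (h _))) (lookup-pos ρ′ _)))

relabel-involutive : ∀ (a b : Fin k) ρ → relabel a b (relabel a b ρ) ≡ ρ
relabel-involutive a b ρ = pos-ext λ x → trans (pos-relabel a b _ x)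
  (trans (pos-relabel a b ρ _) (cong (pos ρ) (transpose-involutive a b x)))

relabel-comm : ∀ (a b : Fin k) ρ → relabel a b ρ ≡ relabel b a ρ
relabel-comm a b ρ = pos-ext λ x → trans (pos-relabel a b ρ x) (trans (cong (pos ρ) (eq x)) (sym (pos-relabel b a ρ x)))
  where
  eq : ∀ x → transpose a b x ≡ transpose b a x
  eq x with x Fin.≟ a
  ... | yes refl = sym (transpose-j b x)
  ... | no x≢a with x Fin.≟ b
  ...   | yes refl = refl
  ...   | no x≢b with x Fin.≟ a
  ...     | yes e = ⊥-elim (x≢a e)
  ...     | no _ = refl

relabel-sw : ∀ (a b : Fin k) p ρ → relabel a b (sw p ρ) ≡ sw p (relabel a b ρ)
relabel-sw a b p ρ = ranking-ext (sym (swapAt-map (transpose a b) p (order ρ)))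

-- For neighbours, exchanging positions and exchanging names coincide. This is why `fix` cannot see
-- a swap of `a` and `b`.
adjacent⇒relabel : ∀ {p} {ρ : Ranking k} {x y} → Adjacent p ρ x y → sw p ρ ≡ relabel x y ρ
adjacent⇒relabel {p = p} {ρ} {x} {y} adj = pos-ext λ z → trans (go z) (sym (pos-relabel x y ρ z))
  where
  go : ∀ z → pos (sw p ρ) z ≡ pos ρ (transpose x y z)
  go z with z Fin.≟ x
  ... | yes refl = proj₂ (adjacent-sw {ρ = ρ} adj)
  ... | no z≢x with z Fin.≟ y
  ...   | yes refl = proj₁ (adjacent-sw {ρ = ρ} adj)
  ...   | no z≢y = trans (pos-sw p ρ z) (swapFin-fix p (pos ρ z)
      (λ e → z≢x (pos-injective ρ (toℕ-injective (trans e (sym (proj₁ adj))))))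
      (λ e → z≢y (pos-injective ρ (toℕ-injective (trans e (sym (proj₂ adj)))))))

-- Raising an alternative to the top

front : ℕ → Ranking k → Ranking k
front zero    ρ = ρ
front (suc j) ρ = front j (sw j ρ)

-- A rotation by successive swaps, not an exchange with the top alternative: the comparisons among
-- the others survive, and every stage is an edge.
lift : Fin k → Ranking k → Ranking k
lift a ρ = front (toℕ (pos ρ a)) ρ

pos-sw-suc : ∀ {j} (ρ : Ranking k) a → toℕ (pos ρ a) ≡ suc j → toℕ (pos (sw j ρ) a) ≡ j
pos-sw-suc {j = j} ρ a e = trans (cong toℕ (pos-sw j ρ a)) (swapFin-pred j (pos ρ a) e)

pos-front : ∀ j (ρ : Ranking k) a → toℕ (pos ρ a) ≡ j → toℕ (pos (front j ρ) a) ≡ 0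
pos-front zero    ρ a e = e
pos-front (suc j) ρ a e = pos-front j (sw j ρ) a (pos-sw-suc ρ a e)

pos-lift : ∀ (a : Fin k) ρ → toℕ (pos (lift a ρ) a) ≡ 0
pos-lift a ρ = pos-front _ ρ a refl

above-front : ∀ j (ρ : Ranking k) {a x y} → toℕ (pos ρ a) ≡ j → x ≢ a → y ≢ a →
  above (front j ρ) x y ≡ above ρ x y
above-front zero    ρ e x≢a y≢a = refl
above-front (suc j) ρ {a} {x} {y} e x≢a y≢a = trans (above-front j (sw j ρ) (pos-sw-suc ρ a e) x≢a y≢a)
  (sym (decidable-stable (above ρ x y Bool.≟ above (sw j ρ) x y) (no-a ∘ above-sw-changes j ρ x y)))
  where
  no-a : Adjacent j ρ x y ⊎ Adjacent j ρ y x → ⊥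
  no-a (inj₁ (_ , f)) = y≢a (pos-injective ρ (toℕ-injective (trans f (sym e))))
  no-a (inj₂ (_ , f)) = x≢a (pos-injective ρ (toℕ-injective (trans f (sym e))))

above-lift : ∀ (a : Fin k) ρ {x y} → x ≢ a → y ≢ a → above (lift a ρ) x y ≡ above ρ x y
above-lift a ρ = above-front _ ρ refl

lift-top : ∀ (a : Fin k) ρ {x} → x ≢ a → above (lift a ρ) a x ≡ true
lift-top a ρ {x} x≢a = <⇒above (lift a ρ) a x (≤-trans (s≤s (≤-reflexive (pos-lift a ρ))) (n≢0⇒n>0
  λ e → x≢a (pos-injective (lift a ρ) (toℕ-injective (trans e (sym (pos-lift a ρ)))))))

without : Fin k → List (Fin k) → List (Fin k)
without a []       = []
without a (x ∷ xs) with x Fin.≟ a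
... | yes _ = without a xs
... | no  _ = x ∷ without a xs

without-comm : ∀ (a b : Fin k) xs → without a (without b xs) ≡ without b (without a xs)
without-comm a b []       = refl
without-comm a b (x ∷ xs) with x Fin.≟ b in eb | x Fin.≟ a in ea
... | yes _ | yes _ = without-comm a b xs
... | yes _ | no  _ rewrite eb = without-comm a b xs
... | no  _ | yes _ rewrite ea = without-comm a b xs
... | no  _ | no  _ rewrite ea | eb = cong (x ∷_) (without-comm a b xs)

without-swap : ∀ (a : Fin k) p xs → without a (swapList p xs) ≡ without a xs
  ⊎ (∃[ q ] without a (swapList p xs) ≡ swapList q (without a xs))
without-swap a p       []           = inj₁ refl
without-swap a zero    (x ∷ [])     = inj₁ refl
without-swap a zero    (x ∷ y ∷ xs) with x Fin.≟ a in ex | y Fin.≟ a in ey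
... | yes _ | yes _ rewrite ex | ey = inj₁ refl
... | yes _ | no  _ rewrite ex | ey = inj₁ refl
... | no  _ | yes _ rewrite ex | ey = inj₁ refl
... | no  _ | no  _ rewrite ex | ey = inj₂ (0 , refl)
without-swap a (suc p) (x ∷ xs) with x Fin.≟ a
... | yes _ = without-swap a p xs
... | no  _ with without-swap a p xs
...   | inj₁ e = inj₁ (cong (x ∷_) e)
...   | inj₂ (q , e) = inj₂ (suc q , cong (x ∷_) e)

without-swap-at : ∀ {m} (a : Fin k) j (v : Vec (Fin k) m) i → toℕ i ≡ suc j → lookup v i ≡ a →
  without a (swapList j (toList v)) ≡ without a (toList v)
without-swap-at a zero (x ∷ y ∷ v) (Fin.suc Fin.zero) e refl with x Fin.≟ y in ex | y Fin.≟ y in ey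
... | yes _ | yes _ rewrite ex | ey = refl
... | no  _ | yes _ rewrite ex | ey = refl
... | _     | no ¬r = ⊥-elim (¬r refl)
without-swap-at a (suc j) (x ∷ v) (Fin.suc i) e f with x Fin.≟ a
... | yes _ = without-swap-at a j v i (suc-injective e) f
... | no  _ = cong (x ∷_) (without-swap-at a j v i (suc-injective e) f)

without-absent : ∀ {m} (a : Fin k) (v : Vec (Fin k) m) → (∀ i → lookup v i ≢ a) → without a (toList v) ≡ toList v
without-absent a []      h = refl
without-absent a (x ∷ v) h with x Fin.≟ a
... | yes e = ⊥-elim (h Fin.zero e)
... | no  _ = cong (x ∷_) (without-absent a v (h ∘ Fin.suc))

without-head : ∀ {m} (a : Fin k) (v : Vec (Fin k) (suc m)) → lookup v Fin.zero ≡ a →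
  (∀ i → lookup v (Fin.suc i) ≢ a) → toList v ≡ a ∷ without a (toList v)
without-head a (x ∷ v) refl h with x Fin.≟ x
... | no ¬r  = ⊥-elim (¬r refl)
... | yes _  = cong (x ∷_) (sym (without-absent x v h))

toList-front : ∀ j (ρ : Ranking k) a → toℕ (pos ρ a) ≡ j →
  toList (order (front j ρ)) ≡ a ∷ without a (toList (order ρ))
toList-front {suc k} zero ρ a e = without-head a (order ρ)
  (trans (cong (lookup (order ρ)) (sym pos≡0)) (lookup-pos ρ a))
  (λ i g → 0≢1+i (trans (sym pos≡0) (pos-unique ρ g)))
  where
  pos≡0 : pos ρ a ≡ Fin.zero
  pos≡0 = toℕ-injective e
  0≢1+i : ∀ {n} {i : Fin n} → Fin.zero ≢ Fin.suc i
  0≢1+i ()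
toList-front (suc j) ρ a e = trans (toList-front j (sw j ρ) a (pos-sw-suc ρ a e)) (cong (a ∷_)
  (trans (cong (without a) (toList-swapAt j (order ρ)))
    (without-swap-at a j (order ρ) (pos ρ a) e (lookup-pos ρ a))))

-- A normal form, in which identities between lifts become identities between deletions from a list.
toList-lift : ∀ (a : Fin k) ρ → toList (order (lift a ρ)) ≡ a ∷ without a (toList (order ρ))
toList-lift a ρ = toList-front _ ρ a refl

toList-ext : ∀ {ρ ρ′ : Ranking k} → toList (order ρ) ≡ toList (order ρ′) → ρ ≡ ρ′
toList-ext e = ranking-ext (toList-injective _ _ e)

-- Deleting `a` turns a swap into a swap or into nothing. The index is `suc q` because `a` stands in
-- front, so the top is left alone; `top-stable` rests on this.
lift-sw : ∀ (a : Fin k) p ρ → lift a (sw p ρ) ≡ lift a ρ ⊎ (∃[ q ] lift a (sw p ρ) ≡ sw (suc q) (lift a ρ))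
lift-sw a p ρ with without-swap a p (toList (order ρ))
... | inj₁ e = inj₁ (toList-ext (trans (toList-lift a (sw p ρ)) (trans (cong (a ∷_)
      (trans (cong (without a) (toList-swapAt p (order ρ))) e)) (sym (toList-lift a ρ)))))
... | inj₂ (q , e) = inj₂ (q , toList-ext (trans (toList-lift a (sw p ρ)) (trans (cong (a ∷_)
      (trans (cong (without a) (toList-swapAt p (order ρ))) e))
      (sym (trans (toList-swapAt (suc q) (order (lift a ρ))) (cong (swapList (suc q)) (toList-lift a ρ)))))))

without-keep : ∀ {a b : Fin k} xs → b ≢ a → without a (b ∷ xs) ≡ b ∷ without a xs
without-keep {a = a} {b} xs b≢a with b Fin.≟ a
... | yes e = ⊥-elim (b≢a e)
... | no  _ = refl

-- Behind `a` and `b` both rankings list the remaining alternatives alike. Thus the two ballots that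
-- test pivotality form an edge.
lift-lift : ∀ {a b : Fin k} ρ → a ≢ b → lift b (lift a ρ) ≡ sw 0 (lift a (lift b ρ))
lift-lift {a = a} {b} ρ a≢b = toList-ext (trans (twice a≢b)
  (sym (trans (toList-swapAt 0 (order (lift a (lift b ρ)))) (trans (cong (swapList 0) (twice (a≢b ∘ sym)))
    (cong (λ l → b ∷ a ∷ l) (without-comm a b xs))))))
  where
  xs = toList (order ρ)
  twice : ∀ {a b} → a ≢ b → toList (order (lift b (lift a ρ))) ≡ b ∷ a ∷ without b (without a xs)
  twice {a} {b} a≢b = trans (toList-lift b (lift a ρ)) (cong (b ∷_)
    (trans (cong (without b) (toList-lift a ρ)) (without-keep _ a≢b)))

lift-adjacent : ∀ {p} {ρ : Ranking k} {x y} → Adjacent p ρ x y → lift y (sw p ρ) ≡ lift y ρ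
lift-adjacent {p = p} {ρ} {x} {y} (_ , e) = toList-ext (trans (toList-lift y (sw p ρ)) (trans (cong (y ∷_)
  (trans (cong (without y) (toList-swapAt p (order ρ))) (without-swap-at y p (order ρ) (pos ρ y) e (lookup-pos ρ y))))
  (sym (toList-lift y ρ))))

-- Words in the adjacent swaps

down : ℕ → List ℕ
down zero    = []
down (suc j) = map suc (down j) ++ 0 ∷ []

_▹_ : Fin n → List ℕ → List ℕ
j ▹ w = down (toℕ j) ++ map suc w

-- Every arrangement of n entries is reached by exactly one word: its first letters bring the
-- required entry to the front, the others arrange the remaining entries.
words : ℕ → List (List ℕ)
words zero    = [] ∷ []
words (suc n) = concatMap (λ j → map (j ▹_) (words n)) (allFin (suc n))

actVec : List ℕ → Vec A n → Vec A n
actVec []      v = v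
actVec (p ∷ w) v = actVec w (swapAt p v)

actVec-++ : ∀ w w′ (v : Vec A n) → actVec (w ++ w′) v ≡ actVec w′ (actVec w v)
actVec-++ []      w′ v = refl
actVec-++ (p ∷ w) w′ v = actVec-++ w w′ (swapAt p v)

actVec-suc : ∀ w x (v : Vec A n) → actVec (map suc w) (x ∷ v) ≡ x ∷ actVec w v
actVec-suc []      x v = refl
actVec-suc (p ∷ w) x v = actVec-suc w x (swapAt p v)

actVec-down : ∀ (v : Vec A (suc n)) j → actVec (down (toℕ j)) v ≡ lookup v j ∷ removeAt v j
actVec-down (x ∷ v)       Fin.zero    = refl
actVec-down (x ∷ y ∷ v) (Fin.suc j)
  rewrite actVec-++ (map suc (down (toℕ j))) (0 ∷ []) (x ∷ y ∷ v)
        | actVec-suc (down (toℕ j)) x (y ∷ v)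
        | actVec-down (y ∷ v) j = refl

length-down : ∀ j → length (down j) ≡ j
length-down zero    = refl
length-down (suc j) = trans (length-++ (map suc (down j))) (trans (cong₂ _+_
  (trans (length-map suc (down j)) (length-down j)) refl) (+-comm j 1))

∑-concatMap : ∀ {Y : Set} (g : X → List Y) xs φ → ∑ (concatMap g xs) φ ≡ ∑ xs (λ x → ∑ (g x) φ)
∑-concatMap g []       φ = refl
∑-concatMap g (x ∷ xs) φ = trans (∑-++ (g x) _ φ) (cong (∑ (g x) φ +_) (∑-concatMap g xs φ))

length-allFin : ∀ n → length (allFin n) ≡ n
length-allFin n = length-tabulate id

length-words : ∀ n → length (words n) ≡ n !
length-words zero    = refl
length-words (suc n) = begin
  length (words (suc n))  ≡⟨ length-∑ (words (suc n)) ⟨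
  ∑ (words (suc n)) (λ _ → 1)  ≡⟨ ∑-concatMap (λ j → map (j ▹_) (words n)) (allFin (suc n)) (λ _ → 1) ⟩
  ∑ (allFin (suc n)) (λ j → ∑ (map (j ▹_) (words n)) (λ _ → 1))
    ≡⟨ ∑-cong (allFin (suc n)) (λ j → trans (length-∑ (map (j ▹_) (words n)))
         (trans (length-map (j ▹_) (words n)) (length-words n))) ⟩
  ∑ (allFin (suc n)) (λ _ → n !)  ≡⟨ ∑-const (allFin (suc n)) (n !) ⟩
  length (allFin (suc n)) * n !  ≡⟨ cong (_* n !) (length-allFin (suc n)) ⟩
  suc n !  ∎
  where open ≡.≡-Reasoning

-- Each of the n entries is brought forward by fewer than n swaps. This is the source of the factor
-- `k * k` in `influence-bound`.
short-words : ∀ n → All (λ w → length w ≤ n * n) (words n)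
short-words zero    = z≤n ∷ []
short-words (suc n) = All.concat⁺ (All.map⁺ {f = λ j → map (j ▹_) (words n)} (All.universal (λ j → All.map⁺ {f = j ▹_}
  (All.map (λ {w} → longer j w) (short-words n))) (allFin (suc n))))
  where
  longer : ∀ (j : Fin (suc n)) w → length w ≤ n * n → length (j ▹ w) ≤ suc n * suc n
  longer j w h = begin
    length (j ▹ w)  ≡⟨ length-++ (down (toℕ j)) ⟩
    length (down (toℕ j)) + length (map suc w) ≡⟨ cong₂ _+_ (length-down (toℕ j)) (length-map suc w) ⟩
    toℕ j + length w  ≤⟨ +-mono-≤ (<⇒≤ (toℕ<n j)) h ⟩
    suc n + n * n  ≤⟨ +-monoʳ-≤ (suc n) (*-monoʳ-≤ n (n≤1+n n)) ⟩
    suc n + n * suc n  ∎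
    where open ≤-Reasoning

arrangements : Vec A n → List (Vec A n)
arrangements {n = n} v = map (λ w → actVec w v) (words n)

arrangements-suc : ∀ (v : Vec A (suc n)) →
  arrangements v ≡ concatMap (λ j → map (lookup v j ∷_) (arrangements (removeAt v j))) (allFin (suc n))
arrangements-suc {n = n} v = trans (map-concatMap _ _ (allFin (suc n))) (concatMap-cong go (allFin (suc n)))
  where
  go : ∀ j → map (λ w → actVec w v) (map (j ▹_) (words n))
    ≡ map (lookup v j ∷_) (arrangements (removeAt v j))
  go j = trans (sym (map-∘ (words n))) (trans (map-cong (λ w →
    trans (actVec-++ (down (toℕ j)) (map suc w) v) (trans (cong (actVec (map suc w)) (actVec-down v j))
      (actVec-suc w _ _))) (words n)) (map-∘ (words n)))

InjectiveVec : Vec A n → Set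
InjectiveVec v = ∀ {i j} → lookup v i ≡ lookup v j → i ≡ j

lookup-removeAt : ∀ (v : Vec A (suc n)) j i → lookup (removeAt v j) i ≡ lookup v (Fin.punchIn j i)
lookup-removeAt (x ∷ v)     Fin.zero    i           = refl
lookup-removeAt (x ∷ y ∷ v) (Fin.suc j) Fin.zero    = refl
lookup-removeAt (x ∷ y ∷ v) (Fin.suc j) (Fin.suc i) = lookup-removeAt (y ∷ v) j i

removeAt-injective : ∀ (v : Vec A (suc n)) j → InjectiveVec v → InjectiveVec (removeAt v j)
removeAt-injective v j inj e = Fin.punchIn-injective j _ _
  (inj (trans (sym (lookup-removeAt v j _)) (trans e (lookup-removeAt v j _))))

arrangements-unique : ∀ {n} (v : Vec A n) → InjectiveVec v → Unique (arrangements v)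
arrangements-unique {n = zero}  v inj = [] ∷ []
arrangements-unique {n = suc n} v inj = subst Unique (sym (arrangements-suc v)) (Unique.concat⁺
  (All.map⁺ (All.tabulate λ {j} _ → Unique.map⁺ (proj₂ ∘ ∷-injective) (arrangements-unique (removeAt v j) (removeAt-injective v j inj))))
  (AllPairs.map⁺ (AllPairs.map (λ {i} {j} → disjoint i j) (Unique.allFin⁺ (suc n)))))
  where
  disjoint : ∀ i j → i ≢ j → ∀ {u} → u ∈ map (lookup v i ∷_) (arrangements (removeAt v i))
    × u ∈ map (lookup v j ∷_) (arrangements (removeAt v j)) → ⊥
  disjoint i j i≢j (p , q) with ∈-map⁻ _ p | ∈-map⁻ _ q
  ... | _ , _ , refl | _ , _ , e = i≢j (inj (proj₁ (∷-injective e)))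

arrangements-complete : ∀ {n} (v u : Vec A n) → InjectiveVec u → (∀ i → ∃[ j ] lookup v j ≡ lookup u i) → u ∈ arrangements v
arrangements-complete {n = zero}  []      []      _   _ = here refl
arrangements-complete {n = suc n} v (x ∷ u) inj h with h Fin.zero
... | j , refl = subst ((x ∷ u) ∈_) (sym (arrangements-suc v)) (∈-concatMap⁺ _ (Any.map
    (λ { refl → ∈-map⁺ (x ∷_) (arrangements-complete (removeAt v j) u (λ e → Fin.suc-injective (inj e)) rest) })
    (∈-allFin j)))
  where
  rest : ∀ i → ∃[ j′ ] lookup (removeAt v j) j′ ≡ lookup u i
  rest i with h (Fin.suc i)
  ... | j′ , e = Fin.punchOut j≢j′ , trans (removeAt-punchOut v j≢j′) e
    where
    j≢j′ : j ≢ j′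
    j≢j′ refl with () ← inj {Fin.zero} {Fin.suc i} e

-- The list of all rankings

act : List ℕ → Ranking k → Ranking k
act []      ρ = ρ
act (p ∷ w) ρ = act w (sw p ρ)

order-act : ∀ w (ρ : Ranking k) → order (act w ρ) ≡ actVec w (order ρ)
order-act []      ρ = refl
order-act (p ∷ w) ρ = order-act w (sw p ρ)

images : Ranking k → List (Ranking k)
images {k} ρ = map (λ w → act w ρ) (words k)

images-orders : ∀ (ρ : Ranking k) → map order (images ρ) ≡ arrangements (order ρ)
images-orders {k} ρ = trans (sym (map-∘ (words k))) (map-cong (λ w → order-act w ρ) (words k))

images-unique : ∀ (ρ : Ranking k) → Unique (images ρ)
images-unique ρ = Unique.map⁻ (subst Unique (sym (images-orders ρ)) (arrangements-unique (order ρ) (order-injective ρ)))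

images-complete : ∀ (ρ ρ′ : Ranking k) → ρ′ ∈ images ρ
images-complete ρ ρ′ with ∈-map⁻ order (subst (order ρ′ ∈_) (sym (images-orders ρ)) (arrangements-complete (order ρ) (order ρ′)
    (order-injective ρ′) (λ i → pos ρ (lookup (order ρ′) i) , lookup-pos ρ _)))
... | ρ″ , m , e = subst (_∈ images ρ) (sym (ranking-ext e)) m

identity : Ranking k
identity {k} = ranking (Vec.allFin k) λ {p} {q} e → trans (sym (lookup-allFin p)) (trans e (lookup-allFin q))

rankings : ∀ k → List (Ranking k)
rankings k = images identity

unique-complete⇒↭ : ∀ {xs ys : List X} → Unique xs → Unique ys → (∀ x → x ∈ xs) → (∀ x → x ∈ ys) → xs ↭ ys
unique-complete⇒↭ u u′ c c′ = ∼bag⇒↭ (unique∧set⇒bag u u′ (mk⇔ (λ _ → c′ _) (λ _ → c _)))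

length-rankings : ∀ k → length (rankings k) ≡ k !
length-rankings k = trans (length-map _ (words k)) (length-words k)

-- The words reach every ranking exactly once from any start `ρ`, so a fresh uniform ranking is a
-- uniform word applied to the present one.
∑-act : ∀ (φ : Ranking k → ℕ) ρ → ∑ (rankings k) φ ≡ ∑ (words k) (λ w → φ (act w ρ))
∑-act {k} φ ρ = trans (∑-↭ φ (unique-complete⇒↭ (images-unique _) (images-unique ρ) (images-complete _) (images-complete ρ)))
  (∑-map _ (words k) φ)

∑-involution : ∀ {T : Ranking k → Ranking k} → (∀ ρ → T (T ρ) ≡ ρ) → ∀ φ → ∑ (rankings k) (φ ∘ T) ≡ ∑ (rankings k) φ
∑-involution {k} {T} inv φ = trans (sym (∑-map T (rankings k) φ)) (∑-↭ φ (unique-complete⇒↭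
  (Unique.map⁺ (λ {x} {y} e → trans (sym (inv x)) (trans (cong T e) (inv y))) (images-unique _)) (images-unique _)
  (λ ρ → subst (_∈ map T (rankings k)) (inv ρ) (∈-map⁺ T (images-complete _ (T ρ)))) (images-complete _)))

expands-involution : ∀ {T : Ranking k → Ranking k} → (∀ ρ → T (T ρ) ≡ ρ) → Expands (rankings k) 1 T
expands-involution inv .∑-∘ φ = ≤-reflexive (trans (∑-involution inv φ) (sym (+-identityʳ _)))

expands-sw : ∀ p → Expands (rankings k) 1 (sw p)
expands-sw p = expands-involution (sw-involutive p)

expands-front : ∀ j → Expands (rankings k) 1 (front j)
expands-front zero    = expands-id
expands-front (suc j) = expands-∘ (expands-front j) (expands-sw j)

-- On the rankings with `a` at position j, `lift a` is the bijection `front j`, and j takes k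
-- values.
expands-lift : ∀ (a : Fin k) → Expands (rankings k) k (lift a)
expands-lift {k} a = subst (λ c → Expands (rankings k) c (lift a)) (length-upTo k)
  (expands-cover (upTo k) front expands-front λ ρ → toℕ (pos ρ a) , ∈-upTo⁺ (toℕ<n (pos ρ a)) , refl)

-- Profiles

profiles : ∀ k n → List (Profile k n)
profiles k n = vecs (rankings k) n

at : Fin n → (Ranking k → Ranking k) → Profile k n → Profile k n
at v T σ = updateAt σ v T

expands-at : ∀ {c T} → Expands (rankings k) c T → ∀ (v : Fin n) → Expands (profiles k n) c (at v T)
expands-at e v = expands-updateAt e v

length-profiles : ∀ k n → length (profiles k n) ≡ (k !) ^ n
length-profiles k n = trans (length-vecs (rankings k) n) (cong (_^ n) (length-rankings k))

profiles-nonempty : ∀ k n → 0 < length (profiles k n)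
profiles-nonempty k n = subst (0 <_) (sym (length-profiles k n)) (n≢0⇒n>0 (ℕ.≢-nonZero⁻¹ _ {{m^n≢0 (k !) n {{k !≢0}}}}))

-- A whole family of events is resampled at once, with errors summed over `s`, because
-- `sign-determined` needs a single τ that serves all sign vectors.
module Resampling {S : Set} (ss : List S) (B : S → Profile k n → Bool) (Δ : ℕ)
  (local : ∀ v p → ∑ ss (λ s → # (profiles k n) λ σ → B s σ xor B s (at v (sw p) σ)) ≤ Δ) where

  private
    Ω = profiles k n

  -- Telescoping along the word: a swap is a bijection, so every intermediate profile is again
  -- uniform and each letter costs `Δ`.
  act-bound : ∀ v w → ∑ ss (λ s → # Ω λ σ → B s σ xor B s (at v (act w) σ)) ≤ length w * Δ
  act-bound v []      = ≤-reflexive (trans (∑-cong ss λ s → trans (∑-cong Ω λ σ →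
    cong 𝟙 (trans (cong (λ τ → B s σ xor B s τ) (updateAt-id v σ)) (xor-same (B s σ))))
    (∑-zero Ω)) (∑-zero ss))
  act-bound v (p ∷ w) = begin
    ∑ ss (λ s → # Ω λ σ → B s σ xor B s (at v (act (p ∷ w)) σ))
      ≤⟨ ∑-mono ss (λ s → ∑-mono Ω λ σ → xor-triangle (B s σ) (B s (at v (sw p) σ)) _) ⟩
    ∑ ss (λ s → ∑ Ω λ σ → 𝟙 (B s σ xor B s (at v (sw p) σ)) + 𝟙 (B s (at v (sw p) σ) xor B s (at v (act (p ∷ w)) σ)))
      ≡⟨ trans (∑-cong ss λ s → ∑-+ Ω _ _) (∑-+ ss _ _) ⟩
    ∑ ss (λ s → # Ω λ σ → B s σ xor B s (at v (sw p) σ)) + ∑ ss (λ s → # Ω λ σ → B s (at v (sw p) σ) xor B s (at v (act (p ∷ w)) σ))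
      ≤⟨ +-mono-≤ (local v p) (≤-trans (≤-reflexive (∑-cong ss λ s → ∑-cong Ω λ σ →
           cong (λ τ → 𝟙 (B s (at v (sw p) σ) xor B s τ)) (sym (updateAt-updateAt v σ))))
         (≤-trans (∑-mono ss λ s → ≤-trans (∑-∘ (expands-at (expands-sw p) v) (λ σ → 𝟙 (B s σ xor B s (at v (act w) σ))))
           (≤-reflexive (+-identityʳ _))) (act-bound v w))) ⟩
    Δ + length w * Δ  ∎
    where open ≤-Reasoning

  influence-bound : ∀ v → ∑ ss (λ s → influence (rankings k) (B s) v) ≤ k ! * (k * k * Δ)
  influence-bound v = begin
    ∑ ss (λ s → ∑ Ω λ σ → ∑ (rankings k) λ ρ → 𝟙 (B s σ xor B s (updateAt σ v (λ _ → ρ))))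
      -- The starting ranking is the present ballot of `v` and varies with σ, but the set of words
      -- does not, so the sums can be exchanged afterwards.
      ≡⟨ ∑-cong ss (λ s → ∑-cong Ω λ σ → trans (∑-act _ (lookup σ v)) (∑-cong (words k) λ w →
           cong (λ τ → 𝟙 (B s σ xor B s τ)) (updateAt-cong-local v σ refl))) ⟩
    ∑ ss (λ s → ∑ Ω λ σ → ∑ (words k) λ w → 𝟙 (B s σ xor B s (at v (act w) σ)))
      ≡⟨ trans (∑-cong ss λ s → ∑-swap Ω (words k) _) (∑-swap ss (words k) _) ⟩
    ∑ (words k) (λ w → ∑ ss λ s → # Ω λ σ → B s σ xor B s (at v (act w) σ))
      ≤⟨ ∑-mono-All (short-words k) (λ w h → ≤-trans (act-bound v w) (*-monoˡ-≤ Δ h)) ⟩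
    ∑ (words k) (λ _ → k * k * Δ)  ≡⟨ ∑-const (words k) _ ⟩
    length (words k) * (k * k * Δ)  ≡⟨ cong (_* (k * k * Δ)) (length-words k) ⟩
    k ! * (k * k * Δ)  ∎
    where
    open ≤-Reasoning
    ∑-mono-All : ∀ {X : Set} {P : X → Set} {xs φ ψ} → All P xs → (∀ x → P x → φ x ≤ ψ x) → ∑ xs φ ≤ ∑ xs ψ
    ∑-mono-All []       h = z≤n
    ∑-mono-All (p ∷ ps) h = +-mono-≤ (h _ p) (∑-mono-All ps h)

  resample : ∑ ss (λ s → ∑ Ω λ σ → ∑ Ω λ τ → 𝟙 (B s σ xor B s τ)) ≤ length Ω * (n * (k * k) * Δ)
  resample = *-cancelˡ-≤ (k !) {{k !≢0}} (begin
    k ! * ∑ ss (λ s → D s)  ≡⟨ ∑-* ss (k !) D ⟨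
    ∑ ss (λ s → k ! * D s)  ≡⟨ ∑-cong ss (λ s → cong (_* D s) (sym (length-rankings k))) ⟩
    ∑ ss (λ s → length (rankings k) * D s)  ≤⟨ ∑-mono ss (λ s → efron-stein (rankings k) (B s)) ⟩
    ∑ ss (λ s → length Ω * ∑ (allFin n) (I s))  ≡⟨ ∑-* ss (length Ω) _ ⟩
    length Ω * ∑ ss (λ s → ∑ (allFin n) (I s))  ≡⟨ cong (length Ω *_) (∑-swap ss (allFin n) I) ⟩
    length Ω * ∑ (allFin n) (λ v → ∑ ss (λ s → I s v))  ≤⟨ *-monoʳ-≤ (length Ω) (∑-≤-const (allFin n) _ influence-bound) ⟩
    length Ω * (length (allFin n) * (k ! * (k * k * Δ)))  ≡⟨ cong (λ l → length Ω * (l * (k ! * (k * k * Δ)))) (length-allFin n) ⟩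
    length Ω * (n * (k ! * (k * k * Δ)))  ≡⟨ eq (length Ω) n (k !) k Δ ⟩
    k ! * (length Ω * (n * (k * k) * Δ))  ∎)
    where
    open ≤-Reasoning
    D : S → ℕ
    D s = ∑ Ω λ σ → ∑ Ω λ τ → 𝟙 (B s σ xor B s τ)
    I : S → Fin n → ℕ
    I s v = influence (rankings k) (B s) v
    eq : ∀ N n r k Δ → N * (n * (r * (k * k * Δ))) ≡ r * (N * (n * (k * k) * Δ))
    eq = solve-∀

  typical : ∃[ τ ] ∑ ss (λ s → # Ω λ σ → B s σ xor B s τ) ≤ n * (k * k) * Δ
  typical = ∑-average Ω _ _ (profiles-nonempty k n) (≤-trans (≤-reflexive
    (trans (∑-swap Ω ss _) (∑-cong ss λ s → ∑-swap Ω Ω _))) resample)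

-- For a single event the comparison value `B τ` is a constant, and it decides which of the two
-- alternatives holds.
zero-one : ∀ (B : Profile k n → Bool) Δ →
  (∀ v p → # (profiles k n) (λ σ → B σ xor B (at v (sw p) σ)) ≤ Δ) →
  # (profiles k n) B ≤ n * (k * k) * Δ ⊎ # (profiles k n) (not ∘ B) ≤ n * (k * k) * Δ
zero-one {k} {n} B Δ local with Resampling.typical (0 ∷ []) (λ _ → B) Δ
  (λ v p → ≤-trans (≤-reflexive (+-identityʳ _)) (local v p))
... | τ , h with B τ
...   | true  = inj₂ (≤-trans (≤-reflexive (∑-cong (profiles k n) λ σ → cong 𝟙 (sym (xor-comm (B σ) true)))) (≤-trans (m≤m+n _ 0) h))
...   | false = inj₁ (≤-trans (≤-reflexive (∑-cong (profiles k n) λ σ → cong 𝟙 (sym (xor-comm (B σ) false)))) (≤-trans (m≤m+n _ 0) h))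

-- Sign vectors of a pair of alternatives

bools : List Bool
bools = true ∷ false ∷ []

cube : ∀ n → List (Vec Bool n)
cube n = vecs bools n

signs : Fin k → Fin k → Profile k n → Vec Bool n
signs a b σ = Vec.map (λ ρ → above ρ a b) σ

-- Overwrites the vote on `a` against `b` by exchanging the two names. A ranking and its relabelling
-- are hit equally often, so uniform `s` and `ρ` give a uniform result (`∑-fix`).
fix : Fin k → Fin k → Bool → Ranking k → Ranking k
fix a b s ρ = if above ρ a b xor s then relabel a b ρ else ρ

fixes : Fin k → Fin k → Vec Bool n → Profile k n → Profile k n
fixes a b s σ = zipWith (fix a b) s σ

above-relabel-self : ∀ {a b : Fin k} ρ → a ≢ b → above (relabel a b ρ) a b ≡ not (above ρ a b)
above-relabel-self {a = a} {b} ρ a≢b = trans (above-relabel a b ρ a b)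
  (trans (cong₂ (above ρ) (transpose-i a b) (transpose-j a b)) (above-flip ρ a≢b))

above-fix : ∀ {a b : Fin k} s ρ → a ≢ b → above (fix a b s ρ) a b ≡ s
above-fix {a = a} {b} s ρ a≢b with above ρ a b in e
above-fix true  ρ a≢b | true  = e
above-fix false ρ a≢b | true  = trans (above-relabel-self ρ a≢b) (cong not e)
above-fix true  ρ a≢b | false = trans (above-relabel-self ρ a≢b) (cong not e)
above-fix false ρ a≢b | false = e

fix-relabel : ∀ {a b : Fin k} s ρ → a ≢ b → fix a b s (relabel a b ρ) ≡ fix a b s ρ
fix-relabel {a = a} {b} s ρ a≢b rewrite above-relabel-self ρ a≢b with above ρ a b
fix-relabel {a = a} {b} true  ρ a≢b | true  = relabel-involutive a b ρ
fix-relabel {a = a} {b} false ρ a≢b | true  = refl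
fix-relabel {a = a} {b} true  ρ a≢b | false = refl
fix-relabel {a = a} {b} false ρ a≢b | false = relabel-involutive a b ρ

-- A swap that reverses `a` and `b` exchanges their names, which `fix` undoes; every other swap
-- commutes with that exchange. So exactly the swaps about which `sign-determined` assumes nothing
-- are filtered out.
fix-sw : ∀ {a b : Fin k} s p ρ → a ≢ b →
  fix a b s (sw p ρ) ≡ fix a b s ρ ⊎ fix a b s (sw p ρ) ≡ sw p (fix a b s ρ)
fix-sw {a = a} {b} s p ρ a≢b with above ρ a b Bool.≟ above (sw p ρ) a b
... | no ne = inj₁ (trans (cong (fix a b s) (sw≡relabel (above-sw-changes p ρ a b ne))) (fix-relabel s ρ a≢b))
  where
  sw≡relabel : Adjacent p ρ a b ⊎ Adjacent p ρ b a → sw p ρ ≡ relabel a b ρ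
  sw≡relabel (inj₁ h) = adjacent⇒relabel {ρ = ρ} h
  sw≡relabel (inj₂ h) = trans (adjacent⇒relabel {ρ = ρ} h) (relabel-comm b a ρ)
... | yes e rewrite sym e with above ρ a b xor s
...   | true  = inj₂ (relabel-sw a b p ρ)
...   | false = inj₂ refl

signs-fixes : ∀ {a b : Fin k} → a ≢ b → ∀ (s : Vec Bool n) σ → signs a b (fixes a b s σ) ≡ s
signs-fixes a≢b []      []      = refl
signs-fixes a≢b (s ∷ t) (ρ ∷ σ) = cong₂ _∷_ (above-fix s ρ a≢b) (signs-fixes a≢b t σ)

lookup-fixes : ∀ (a b : Fin k) (s : Vec Bool n) σ v → lookup (fixes a b s σ) v ≡ fix a b (lookup s v) (lookup σ v)
lookup-fixes a b (s ∷ t) (ρ ∷ σ) Fin.zero    = refl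
lookup-fixes a b (s ∷ t) (ρ ∷ σ) (Fin.suc v) = lookup-fixes a b t σ v

fixes-at : ∀ (a b : Fin k) (s : Vec Bool n) σ v {T T′} →
  fix a b (lookup s v) (T (lookup σ v)) ≡ T′ (fix a b (lookup s v) (lookup σ v)) →
  fixes a b s (at v T σ) ≡ at v T′ (fixes a b s σ)
fixes-at a b (s ∷ t) (ρ ∷ σ) Fin.zero    e = cong (_∷ fixes a b t σ) e
fixes-at a b (s ∷ t) (ρ ∷ σ) (Fin.suc v) e = cong (fix a b s ρ ∷_) (fixes-at a b t σ v e)

∑-fix : ∀ (a b : Fin k) φ → ∑ bools (λ s → ∑ (rankings k) (φ ∘ fix a b s)) ≡ 2 * ∑ (rankings k) φ
∑-fix {k} a b φ = begin
  ∑ R (φ ∘ fix a b true) + (∑ R (φ ∘ fix a b false) + 0)  ≡⟨ cong (∑ R (φ ∘ fix a b true) +_) (+-identityʳ _) ⟩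
  ∑ R (φ ∘ fix a b true) + ∑ R (φ ∘ fix a b false)  ≡⟨ ∑-+ R _ _ ⟨
  ∑ R (λ ρ → φ (fix a b true ρ) + φ (fix a b false ρ))  ≡⟨ ∑-cong R pointwise ⟩
  ∑ R (λ ρ → φ ρ + φ (relabel a b ρ))  ≡⟨ ∑-+ R _ _ ⟩
  ∑ R φ + ∑ R (φ ∘ relabel a b)  ≡⟨ cong (∑ R φ +_) (∑-involution (relabel-involutive a b) φ) ⟩
  ∑ R φ + ∑ R φ  ≡⟨ cong (∑ R φ +_) (+-identityʳ _) ⟨
  2 * ∑ R φ  ∎
  where
  open ≡.≡-Reasoning
  R = rankings k
  pointwise : ∀ ρ → φ (fix a b true ρ) + φ (fix a b false ρ) ≡ φ ρ + φ (relabel a b ρ)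
  pointwise ρ with above ρ a b
  ... | true  = refl
  ... | false = +-comm (φ (relabel a b ρ)) (φ ρ)

∑-fixes : ∀ (a b : Fin k) n φ →
  ∑ (cube n) (λ s → ∑ (profiles k n) (φ ∘ fixes a b s)) ≡ 2 ^ n * ∑ (profiles k n) φ
∑-fixes a b zero    φ = refl
∑-fixes {k} a b (suc n) φ = begin
  ∑ (cube (suc n)) (λ s → ∑ (profiles k (suc n)) (φ ∘ fixes a b s))
    ≡⟨ trans (∑-vecs-suc bools n _) (∑-cong bools λ s → ∑-cong (cube n) λ t → ∑-vecs-suc R n (φ ∘ fixes a b (s ∷ t))) ⟩
  ∑ bools (λ s → ∑ (cube n) λ t → ∑ R λ ρ → ∑ Ω λ σ → φ (fix a b s ρ ∷ fixes a b t σ))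
    ≡⟨ ∑-cong bools (λ s → trans (∑-swap (cube n) R _) (∑-cong R λ ρ → ∑-fixes a b n (φ ∘ (fix a b s ρ ∷_)))) ⟩
  ∑ bools (λ s → ∑ R λ ρ → 2 ^ n * ∑ Ω λ σ → φ (fix a b s ρ ∷ σ))
    ≡⟨ ∑-fix a b (λ ρ → 2 ^ n * ∑ Ω λ σ → φ (ρ ∷ σ)) ⟩
  2 * ∑ R (λ ρ → 2 ^ n * ∑ Ω λ σ → φ (ρ ∷ σ))
    ≡⟨ cong (2 *_) (∑-* R (2 ^ n) _) ⟩
  2 * (2 ^ n * ∑ R (λ ρ → ∑ Ω λ σ → φ (ρ ∷ σ)))
    ≡⟨ *-assoc 2 (2 ^ n) _ ⟨
  2 ^ suc n * ∑ R (λ ρ → ∑ Ω λ σ → φ (ρ ∷ σ))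
    ≡⟨ cong (2 ^ suc n *_) (∑-vecs-suc R n φ) ⟨
  2 ^ suc n * ∑ (profiles k (suc n)) φ ∎
  where
  open ≡.≡-Reasoning
  R = rankings k
  Ω = profiles k n

∑-signs : ∀ {a b : Fin k} → a ≢ b → ∀ n (ψ : Vec Bool n → ℕ) →
  2 ^ n * ∑ (profiles k n) (ψ ∘ signs a b) ≡ length (profiles k n) * ∑ (cube n) ψ
∑-signs {k} {a} {b} a≢b n ψ = begin
  2 ^ n * ∑ (profiles k n) (ψ ∘ signs a b)  ≡⟨ ∑-fixes a b n (ψ ∘ signs a b) ⟨
  ∑ (cube n) (λ s → ∑ (profiles k n) λ σ → ψ (signs a b (fixes a b s σ)))  ≡⟨ ∑-cong (cube n) (λ s →
    trans (∑-cong (profiles k n) λ σ → cong ψ (signs-fixes a≢b s σ)) (∑-const (profiles k n) (ψ s))) ⟩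
  ∑ (cube n) (λ s → length (profiles k n) * ψ s)  ≡⟨ ∑-* (cube n) (length (profiles k n)) ψ ⟩
  length (profiles k n) * ∑ (cube n) ψ  ∎
  where open ≡.≡-Reasoning

2^n≢0 : ∀ n → NonZero (2 ^ n)
2^n≢0 n = m^n≢0 2 n

-- An event that hardly changes under the swaps of neighbours other than {a, b} is essentially
-- a function of the votes on {a, b}: for each sign vector s resample the event σ ↦ A (fixes a b s σ),
-- on which swaps of a and b have no effect at all.
sign-determined : ∀ {a b : Fin k} → a ≢ b → ∀ (A : Profile k n → Bool) Δ →
  (∀ v p → # (profiles k n) (λ σ → (A σ xor A (at v (sw p) σ)) ∧
    not (above (lookup σ v) a b xor above (sw p (lookup σ v)) a b)) ≤ Δ) →
  ∃[ G ] # (profiles k n) (λ σ → A σ xor G (signs a b σ)) ≤ n * (k * k) * Δ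
sign-determined {k} {n} {a} {b} a≢b A Δ local = G , *-cancelˡ-≤ (2 ^ n) {{2^n≢0 n}} (begin
  2 ^ n * # Ω (λ σ → A σ xor G (signs a b σ))  ≡⟨ ∑-fixes a b n (λ σ → 𝟙 (A σ xor G (signs a b σ))) ⟨
  ∑ (cube n) (λ s → # Ω λ σ → A (fixes a b s σ) xor G (signs a b (fixes a b s σ)))
    ≡⟨ ∑-cong (cube n) (λ s → ∑-cong Ω λ σ → cong (λ t → 𝟙 (A (fixes a b s σ) xor G t)) (signs-fixes a≢b s σ)) ⟩
  ∑ (cube n) (λ s → # Ω λ σ → B s σ xor B s τ)  ≤⟨ proj₂ typical ⟩
  n * (k * k) * (2 ^ n * Δ)  ≡⟨ eq (n * (k * k)) (2 ^ n) Δ ⟩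
  2 ^ n * (n * (k * k) * Δ)  ∎)
  where
  open ≤-Reasoning
  Ω = profiles k n
  B : Vec Bool n → Profile k n → Bool
  B s σ = A (fixes a b s σ)
  χ : Fin n → ℕ → Profile k n → Bool
  χ v p σ = (A σ xor A (at v (sw p) σ)) ∧ not (above (lookup σ v) a b xor above (sw p (lookup σ v)) a b)
  pointwise : ∀ v p s σ → 𝟙 (B s σ xor B s (at v (sw p) σ)) ≤ 𝟙 (χ v p (fixes a b s σ))
  pointwise v p s σ with fix-sw (lookup s v) p (lookup σ v) a≢b
  ... | inj₁ e rewrite fixes-at a b s σ v {T = sw p} {id} e | updateAt-id v (fixes a b s σ) | xor-same (A (fixes a b s σ)) = z≤n
  ... | inj₂ e rewrite fixes-at a b s σ v {T = sw p} {sw p} e | lookup-fixes a b s σ v | sym e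
      | above-fix (lookup s v) (lookup σ v) a≢b | above-fix (lookup s v) (sw p (lookup σ v)) a≢b
      | xor-same (lookup s v) = ≤-reflexive (cong 𝟙 (sym (∧-identityʳ _)))
  local′ : ∀ v p → ∑ (cube n) (λ s → # Ω λ σ → B s σ xor B s (at v (sw p) σ)) ≤ 2 ^ n * Δ
  local′ v p = begin
    ∑ (cube n) (λ s → # Ω λ σ → B s σ xor B s (at v (sw p) σ))  ≤⟨ ∑-mono (cube n) (λ s → ∑-mono Ω (pointwise v p s)) ⟩
    ∑ (cube n) (λ s → ∑ Ω λ σ → 𝟙 (χ v p (fixes a b s σ)))  ≡⟨ ∑-fixes a b n (𝟙 ∘ χ v p) ⟩
    2 ^ n * # Ω (χ v p)  ≤⟨ *-monoʳ-≤ (2 ^ n) (local v p) ⟩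
    2 ^ n * Δ  ∎
  typical = Resampling.typical (cube n) B (2 ^ n * Δ) local′
  τ = proj₁ typical
  G : Vec Bool n → Bool
  G s = B s τ
  eq : ∀ c t d → c * (t * d) ≡ t * (c * d)
  eq = solve-∀

-- Reverse hypercontractivity for two pairs

Different : Fin k → Fin k → Fin k → Fin k → Set
Different a b c d = ¬ (a ≡ c × b ≡ d) × ¬ (a ≡ d × b ≡ c)

module _ {k} {a b c d : Fin k} (a≢b : a ≢ b) (c≢d : c ≢ d) (diff : Different a b c d) where

  private
    R = rankings k
    ψ : Ranking k → Bool
    ψ ρ = above ρ a b ∧ above ρ d c

  above-trans : ∀ ρ {x y z : Fin k} → above ρ x y ≡ true → above ρ y z ≡ true → above ρ x z ≡ true
  above-trans ρ {x} {y} {z} e f = <⇒above ρ x z (<-trans (above⇒< ρ x y e) (above⇒< ρ y z f))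

  above-relabel₂ : ∀ {w x y z y₁ z₁ y₂ z₂ : Fin k} {w′ x′} ρ → transpose w x y ≡ y₁ → transpose w x z ≡ z₁ →
    transpose w′ x′ y₁ ≡ y₂ → transpose w′ x′ z₁ ≡ z₂ →
    above ρ y₂ z₂ ≡ true → above (relabel w x (relabel w′ x′ ρ)) y z ≡ true
  above-relabel₂ {w} {x} {y} {z} ρ refl refl refl refl h = trans (above-relabel w x _ y z) (trans (above-relabel _ _ ρ _ _) h)

  above-relabel₁ : ∀ {w x y z y₁ z₁ : Fin k} ρ → transpose w x y ≡ y₁ → transpose w x z ≡ z₁ →
    above ρ y₁ z₁ ≡ true → above (relabel w x ρ) y z ≡ true
  above-relabel₁ {w} {x} {y} {z} ρ refl refl h = trans (above-relabel w x ρ y z) h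

  -- Exchanging the names of `c` and `d` reverses the second comparison but may spoil the first when
  -- the pairs share an alternative. A preliminary exchange of `b`, `d` or of `a`, `c` then repairs
  -- it.
  reversal : ∀ ρ → above ρ a b ≡ true → above ρ c d ≡ true →
    ψ (relabel c d ρ) ≡ true ⊎ ψ (relabel c d (relabel b d ρ)) ≡ true ⊎ ψ (relabel c d (relabel a c ρ)) ≡ true
  reversal ρ ab cd = go (a Fin.≟ c) (b Fin.≟ d) (a Fin.≟ d) (b Fin.≟ c)
    where
    both : ∀ {x y} → x ≡ true → y ≡ true → x ∧ y ≡ true
    both refl refl = refl
    dc : above (relabel c d ρ) d c ≡ true
    dc = above-relabel₁ ρ (transpose-j c d) (transpose-i c d) cd
    first : ∀ {a₁ b₁} → transpose c d a ≡ a₁ → transpose c d b ≡ b₁ → above ρ a₁ b₁ ≡ true →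
      ψ (relabel c d ρ) ≡ true
    first e f h = both (above-relabel₁ ρ e f h) dc
    go : Dec (a ≡ c) → Dec (b ≡ d) → Dec (a ≡ d) → Dec (b ≡ c) →
      ψ (relabel c d ρ) ≡ true ⊎ ψ (relabel c d (relabel b d ρ)) ≡ true ⊎ ψ (relabel c d (relabel a c ρ)) ≡ true
    go (yes refl) (yes b≡d) _ _ = ⊥-elim (proj₁ diff (refl , b≡d))
    go (yes refl) (no b≢d) _ _ with above ρ d b in e
    ... | true  = inj₁ (first (transpose-i a d) (transpose-k (a≢b ∘ sym) b≢d) e)
    ... | false = inj₂ (inj₁ (both
          (above-relabel₂ ρ (transpose-i a d) (transpose-k (a≢b ∘ sym) b≢d) (transpose-j b d) (transpose-i b d)
            (above-total ρ (b≢d ∘ sym) e))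
          (above-relabel₂ ρ (transpose-j a d) (transpose-i a d) (transpose-k a≢b c≢d) (transpose-j b d) ab)))
    go (no a≢c) (yes refl) _ _ with above ρ a c in e
    ... | true  = inj₁ (first (transpose-k a≢c a≢b) (transpose-j c b) e)
    ... | false = inj₂ (inj₂ (both
          (above-relabel₂ ρ (transpose-k a≢c a≢b) (transpose-j c b) (transpose-i a c) (transpose-j a c)
            (above-total ρ a≢c e))
          (above-relabel₂ ρ (transpose-j c b) (transpose-i c b) (transpose-j a c) (transpose-k (a≢b ∘ sym) (c≢d ∘ sym)) ab)))
    go (no _) (no b≢d) (yes refl) (yes b≡c) = ⊥-elim (proj₂ diff (refl , b≡c))
    go (no _) (no b≢d) (yes refl) (no b≢c) = inj₁ (first (transpose-j c a) (transpose-k b≢c b≢d) (above-trans ρ cd ab))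
    go (no a≢c) (no _) (no a≢d) (yes refl) = inj₁ (first (transpose-k a≢c a≢d) (transpose-i b d) (above-trans ρ ab cd))
    go (no a≢c) (no b≢d) (no a≢d) (no b≢c) = inj₁ (first (transpose-k a≢c a≢d) (transpose-k b≢c b≢d) ab)

  -- Three bijections cover all cases. Used for both orientations of `c` and `d`, the factor 3
  -- confines the probability that the two votes agree to the range from 1/4 to 3/4, which is
  -- correlation at most 1/2.
  reversal-count : # R (λ ρ → above ρ a b ∧ above ρ c d) ≤ 3 * # R (λ ρ → above ρ a b ∧ above ρ d c)
  reversal-count = begin
    # R (λ ρ → above ρ a b ∧ above ρ c d)
      ≤⟨ ∑-mono R pointwise ⟩
    ∑ R (λ ρ → 𝟙 (ψ (relabel c d ρ)) + (𝟙 (ψ (relabel c d (relabel b d ρ))) + 𝟙 (ψ (relabel c d (relabel a c ρ)))))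
      ≡⟨ trans (∑-+ R _ _) (cong (# R (ψ ∘ relabel c d) +_) (∑-+ R _ _)) ⟩
    # R (ψ ∘ relabel c d) + (# R (ψ ∘ relabel c d ∘ relabel b d) + # R (ψ ∘ relabel c d ∘ relabel a c))
      ≡⟨ cong₂ _+_ one (cong₂ _+_ (trans (∑-involution {T = relabel b d} (relabel-involutive b d) (𝟙 ∘ ψ ∘ relabel c d)) one)
           (trans (∑-involution {T = relabel a c} (relabel-involutive a c) (𝟙 ∘ ψ ∘ relabel c d)) one)) ⟩
    # R ψ + (# R ψ + # R ψ)  ≡⟨ eq (# R ψ) ⟩
    3 * # R ψ  ∎
    where
    open ≤-Reasoning
    one : # R (ψ ∘ relabel c d) ≡ # R ψ
    one = ∑-involution (relabel-involutive c d) (𝟙 ∘ ψ)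
    eq : ∀ x → x + (x + x) ≡ 3 * x
    eq = solve-∀
    pointwise : ∀ ρ → 𝟙 (above ρ a b ∧ above ρ c d) ≤
      𝟙 (ψ (relabel c d ρ)) + (𝟙 (ψ (relabel c d (relabel b d ρ))) + 𝟙 (ψ (relabel c d (relabel a c ρ))))
    pointwise ρ with above ρ a b in e | above ρ c d in f
    ... | false | _     = z≤n
    ... | true  | false = z≤n
    ... | true  | true with reversal ρ e f
    ...   | inj₁ h rewrite h = s≤s z≤n
    ...   | inj₂ (inj₁ h) rewrite h = ≤-trans (s≤s z≤n) (m≤n+m _ (𝟙 (ψ (relabel c d ρ))))
    ...   | inj₂ (inj₂ h) rewrite h = ≤-trans (≤-trans (m≤n+m 1 (𝟙 (ψ (relabel c d (relabel b d ρ)))))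
              ≤-refl) (m≤n+m _ (𝟙 (ψ (relabel c d ρ))))

am-gm : ∀ x y → 2 * (x * y) ≤ x * x + y * y
am-gm x y with ≤-total x y
... | inj₁ h = subst (λ z → 2 * (x * z) ≤ x * x + z * z) (m+[n∸m]≡n h) (go x (y ∸ x))
  where
  eq : ∀ x d → 2 * (x * (x + d)) + d * d ≡ x * x + (x + d) * (x + d)
  eq = solve-∀
  go : ∀ x d → 2 * (x * (x + d)) ≤ x * x + (x + d) * (x + d)
  go x d = ≤-trans (m≤m+n _ (d * d)) (≤-reflexive (eq x d))
... | inj₂ h = subst (λ z → 2 * (z * y) ≤ z * z + y * y) (m+[n∸m]≡n h) (go y (x ∸ y))
  where
  eq : ∀ x d → 2 * ((x + d) * x) + d * d ≡ (x + d) * (x + d) + x * x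
  eq = solve-∀
  go : ∀ x d → 2 * ((x + d) * x) ≤ (x + d) * (x + d) + x * x
  go x d = ≤-trans (m≤m+n _ (d * d)) (≤-reflexive (eq x d))

square : ℕ → ℕ
square x = x * x

-- Twice AM-GM, using p q = r t for the products p, q and r, t of opposite pairs.
two-point : ∀ u₁ u₀ v₁ v₀ → square ((u₁ + u₀) * (v₁ + v₀)) ≤
  6 * (square (u₁ * v₁) + square (u₀ * v₀)) + 2 * (square (u₁ * v₀) + square (u₀ * v₁))
two-point u₁ u₀ v₁ v₀ = begin
  square ((u₁ + u₀) * (v₁ + v₀))  ≡⟨ e₁ u₁ u₀ v₁ v₀ ⟩
  square P + 2 * (P * Q) + square Q  ≤⟨ +-monoˡ-≤ (square Q) (+-monoʳ-≤ (square P) (am-gm P Q)) ⟩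
  square P + (square P + square Q) + square Q  ≡⟨ e₂ u₁ u₀ v₁ v₀ ⟩
  2 * (square p + square q) + 2 * (square r + square t) + 4 * (2 * (p * q))
    ≤⟨ +-monoʳ-≤ (2 * (square p + square q) + 2 * (square r + square t)) (*-monoʳ-≤ 4 (am-gm p q)) ⟩
  2 * (square p + square q) + 2 * (square r + square t) + 4 * (square p + square q)
    ≡⟨ e₃ (square p + square q) (square r + square t) ⟩
  6 * (square p + square q) + 2 * (square r + square t)  ∎
  where
  open ≤-Reasoning
  p = u₁ * v₁
  q = u₀ * v₀
  r = u₁ * v₀
  t = u₀ * v₁
  P = p + q
  Q = r + t
  e₁ : ∀ a b c d → ((a + b) * (c + d)) * ((a + b) * (c + d)) ≡
    (a * c + b * d) * (a * c + b * d) + 2 * ((a * c + b * d) * (a * d + b * c)) + (a * d + b * c) * (a * d + b * c)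
  e₁ = solve-∀
  e₂ : ∀ a b c d → (a * c + b * d) * (a * c + b * d) + ((a * c + b * d) * (a * c + b * d) + (a * d + b * c) * (a * d + b * c)) + (a * d + b * c) * (a * d + b * c)
    ≡ 2 * ((a * c) * (a * c) + (b * d) * (b * d)) + 2 * ((a * d) * (a * d) + (b * c) * (b * c)) + 4 * (2 * ((a * c) * (b * d)))
  e₂ = solve-∀
  e₃ : ∀ x y → 2 * x + 2 * y + 4 * x ≡ 6 * x + 2 * y
  e₃ = solve-∀

-- The hypotheses on α and β say that the correlation is at most 1/2 in absolute value.
correlated-two-point : ∀ α β u₁ u₀ v₁ v₀ → α ≤ 3 * β → β ≤ 3 * α →
  (α + β) * 2 * square ((u₁ + u₀) * (v₁ + v₀)) ≤
  16 * (α * (square (u₁ * v₁) + square (u₀ * v₀)) + β * (square (u₁ * v₀) + square (u₀ * v₁)))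
correlated-two-point α β u₁ u₀ v₁ v₀ h g =
  +-cancelʳ-≤ (β * (6 * P + 2 * Q) + α * (2 * P + 6 * Q)) _ _ (begin
    (α + β) * 2 * S + (β * (6 * P + 2 * Q) + α * (2 * P + 6 * Q))
      ≡⟨ cong (_+ (β * (6 * P + 2 * Q) + α * (2 * P + 6 * Q))) (trans (cong (_* S) ξ+η) (*-distribʳ-+ S ξ η)) ⟩
    ξ * S + η * S + (β * (6 * P + 2 * Q) + α * (2 * P + 6 * Q))
      ≤⟨ +-monoˡ-≤ _ (+-mono-≤ (*-monoʳ-≤ ξ (two-point u₁ u₀ v₁ v₀)) (*-monoʳ-≤ η flipped)) ⟩
    ξ * (6 * P + 2 * Q) + η * (2 * P + 6 * Q) + (β * (6 * P + 2 * Q) + α * (2 * P + 6 * Q))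
      ≡⟨ e₁ ξ η α β P Q ⟩
    (β + ξ) * (6 * P + 2 * Q) + (α + η) * (2 * P + 6 * Q)
      ≡⟨ cong₂ (λ x y → x * (6 * P + 2 * Q) + y * (2 * P + 6 * Q)) (m+[n∸m]≡n g) (m+[n∸m]≡n h) ⟩
    3 * α * (6 * P + 2 * Q) + 3 * β * (2 * P + 6 * Q)
      ≡⟨ e₂ α β P Q ⟩
    16 * (α * P + β * Q) + (β * (6 * P + 2 * Q) + α * (2 * P + 6 * Q)) ∎)
  where
  open ≤-Reasoning
  P = square (u₁ * v₁) + square (u₀ * v₀)
  Q = square (u₁ * v₀) + square (u₀ * v₁)
  S = square ((u₁ + u₀) * (v₁ + v₀))
  -- Weighting `two-point` by ξ and its mirror image by η is exact: 6ξ + 2η = 16α and 2ξ + 6η = 16β.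
  -- The hypotheses keep both differences from being truncated, and the term added on both sides
  -- avoids any further subtraction.
  ξ = 3 * α ∸ β
  η = 3 * β ∸ α
  ξ+η : (α + β) * 2 ≡ ξ + η
  ξ+η = +-cancelʳ-≡ (β + α) _ _ (trans (e α β) (trans (cong₂ _+_ (sym (m+[n∸m]≡n g)) (sym (m+[n∸m]≡n h))) (e′ α β ξ η)))
    where
    e : ∀ α β → (α + β) * 2 + (β + α) ≡ 3 * α + 3 * β
    e = solve-∀
    e′ : ∀ α β ξ η → β + ξ + (α + η) ≡ ξ + η + (β + α)
    e′ = solve-∀
  flipped : S ≤ 2 * P + 6 * Q
  flipped = ≤-trans (≤-reflexive (cong (λ z → square ((u₁ + u₀) * z)) (+-comm v₁ v₀)))
    (≤-trans (two-point u₁ u₀ v₀ v₁) (≤-reflexive (+-comm (6 * Q) (2 * P))))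
  e₁ : ∀ ξ η α β P Q → ξ * (6 * P + 2 * Q) + η * (2 * P + 6 * Q) + (β * (6 * P + 2 * Q) + α * (2 * P + 6 * Q))
    ≡ (β + ξ) * (6 * P + 2 * Q) + (α + η) * (2 * P + 6 * Q)
  e₁ = solve-∀
  e₂ : ∀ α β P Q → 3 * α * (6 * P + 2 * Q) + 3 * β * (2 * P + 6 * Q)
    ≡ 16 * (α * P + β * Q) + (β * (6 * P + 2 * Q) + α * (2 * P + 6 * Q))
  e₂ = solve-∀

∑-by-signs : ∀ (xs : List X) (x y : X → Bool) (F : Bool → Bool → ℕ) →
  ∑ xs (λ ρ → F (x ρ) (y ρ)) ≡
    # xs (λ ρ → x ρ ∧ y ρ) * F true true + # xs (λ ρ → x ρ ∧ not (y ρ)) * F true false +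
    (# xs (λ ρ → not (x ρ) ∧ y ρ) * F false true + # xs (λ ρ → not (x ρ) ∧ not (y ρ)) * F false false)
∑-by-signs []       x y F = refl
∑-by-signs (ρ ∷ xs) x y F rewrite ∑-by-signs xs x y F = go (x ρ) (y ρ)
  (# xs λ ρ → x ρ ∧ y ρ) (# xs λ ρ → x ρ ∧ not (y ρ)) (# xs λ ρ → not (x ρ) ∧ y ρ) (# xs λ ρ → not (x ρ) ∧ not (y ρ))
  where
  go : ∀ s t a b c d →
    F s t + (a * F true true + b * F true false + (c * F false true + d * F false false)) ≡
    (𝟙 (s ∧ t) + a) * F true true + (𝟙 (s ∧ not t) + b) * F true false +
    ((𝟙 (not s ∧ t) + c) * F false true + (𝟙 (not s ∧ not t) + d) * F false false)
  go true  true  a b c d = eq a b c d (F true true) (F true false) (F false true) (F false false)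
    where
    eq : ∀ a b c d f g h i → f + (a * f + b * g + (c * h + d * i)) ≡ (1 + a) * f + b * g + (c * h + d * i)
    eq = solve-∀
  go true  false a b c d = eq a b c d (F true true) (F true false) (F false true) (F false false)
    where
    eq : ∀ a b c d f g h i → g + (a * f + b * g + (c * h + d * i)) ≡ a * f + (1 + b) * g + (c * h + d * i)
    eq = solve-∀
  go false true  a b c d = eq a b c d (F true true) (F true false) (F false true) (F false false)
    where
    eq : ∀ a b c d f g h i → h + (a * f + b * g + (c * h + d * i)) ≡ a * f + b * g + ((1 + c) * h + d * i)
    eq = solve-∀
  go false false a b c d = eq a b c d (F true true) (F true false) (F false true) (F false false)
    where
    eq : ∀ a b c d f g h i → i + (a * f + b * g + (c * h + d * i)) ≡ a * f + b * g + (c * h + (1 + d) * i)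
    eq = solve-∀

module _ {k} {a b c d : Fin k} (a≢b : a ≢ b) (c≢d : c ≢ d) (diff : Different a b c d) where

  private
    R = rankings k
    x y : Ranking k → Bool
    x ρ = above ρ a b
    y ρ = above ρ c d
    N₁₁ = # R λ ρ → x ρ ∧ y ρ
    N₁₀ = # R λ ρ → x ρ ∧ not (y ρ)
    N₀₁ = # R λ ρ → not (x ρ) ∧ y ρ
    N₀₀ = # R λ ρ → not (x ρ) ∧ not (y ρ)

    split : ∀ (p q : Ranking k → Bool) → # R p ≡ # R (λ ρ → p ρ ∧ q ρ) + # R (λ ρ → p ρ ∧ not (q ρ))
    split p q = trans (∑-cong R λ ρ → go (p ρ) (q ρ)) (∑-+ R _ _)
      where
      go : ∀ s t → 𝟙 s ≡ 𝟙 (s ∧ t) + 𝟙 (s ∧ not t)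
      go true  true  = refl
      go true  false = refl
      go false t     = refl

    balanced : ∀ {a b : Fin k} → a ≢ b → # R (λ ρ → above ρ a b) ≡ # R (λ ρ → not (above ρ a b))
    balanced {a} {b} a≢b = trans (sym (∑-involution {T = relabel a b} (relabel-involutive a b) _))
      (∑-cong R λ ρ → cong 𝟙 (above-relabel-self ρ a≢b))

    swap-∧ : ∀ (p q : Ranking k → Bool) → # R (λ ρ → p ρ ∧ q ρ) ≡ # R (λ ρ → q ρ ∧ p ρ)
    swap-∧ p q = ∑-cong R λ ρ → cong 𝟙 (∧-comm (p ρ) (q ρ))

    row : N₁₁ + N₁₀ ≡ N₀₁ + N₀₀
    row = trans (sym (split x y)) (trans (balanced a≢b) (split (not ∘ x) y))

    column : N₁₁ + N₀₁ ≡ N₁₀ + N₀₀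
    column = trans (cong₂ _+_ (swap-∧ x y) (swap-∧ (not ∘ x) y)) (trans (sym (split y x)) (trans (balanced c≢d)
      (trans (split (not ∘ y) x) (cong₂ _+_ (swap-∧ (not ∘ y) x) (swap-∧ (not ∘ y) (not ∘ x))))))

    N₁₀≡N₀₁ : N₁₀ ≡ N₀₁
    N₁₀≡N₀₁ = *-cancelˡ-≡ N₁₀ N₀₁ 2 (+-cancelʳ-≡ (N₁₁ + N₀₀) _ _
      (trans (e₁ N₁₁ N₁₀ N₀₀) (trans (cong₂ _+_ row (sym column)) (e₂ N₁₁ N₀₁ N₀₀))))
      where
      e₁ : ∀ p q s → 2 * q + (p + s) ≡ p + q + (q + s)
      e₁ = solve-∀
      e₂ : ∀ p r s → r + s + (p + r) ≡ 2 * r + (p + s)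
      e₂ = solve-∀

    N₁₁≡N₀₀ : N₁₁ ≡ N₀₀
    N₁₁≡N₀₀ = +-cancelʳ-≡ N₁₀ N₁₁ N₀₀ (trans row (trans (cong (_+ N₀₀) (sym N₁₀≡N₀₁)) (+-comm N₁₀ N₀₀)))

    not-y : N₁₀ ≡ # R (λ ρ → above ρ a b ∧ above ρ d c)
    not-y = ∑-cong R λ ρ → cong (λ s → 𝟙 (x ρ ∧ s)) (sym (above-flip ρ c≢d))

    N₁₁≤ : N₁₁ ≤ 3 * N₁₀
    N₁₁≤ = subst (λ z → N₁₁ ≤ 3 * z) (sym not-y) (reversal-count a≢b c≢d diff)

    N₁₀≤ : N₁₀ ≤ 3 * N₁₁
    N₁₀≤ = subst (_≤ 3 * N₁₁) (sym not-y) (reversal-count a≢b (c≢d ∘ sym) (proj₂ diff , proj₁ diff))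

    total : length R ≡ (N₁₁ + N₁₀) * 2
    total = begin
      length R  ≡⟨ length-∑ R ⟨
      # R (λ _ → true)  ≡⟨ split (λ _ → true) x ⟩
      # R x + # R (not ∘ x)  ≡⟨ cong (# R x +_) (balanced a≢b) ⟨
      # R x + # R x  ≡⟨ cong (λ z → z + z) (split x y) ⟩
      N₁₁ + N₁₀ + (N₁₁ + N₁₀)  ≡⟨ e (N₁₁ + N₁₀) ⟩
      (N₁₁ + N₁₀) * 2  ∎
      where
      open ≡.≡-Reasoning
      e : ∀ z → z + z ≡ z * 2
      e = solve-∀

  -- Each vote is balanced, so the joint law of the two votes is determined by `N₁₁` and `N₁₀`. In
  -- expectations the claim reads (E u · E v)² ≤ E (u v)², a form that passes to products.
  one-voter : ∀ u₁ u₀ v₁ v₀ → length R * square ((u₁ + u₀) * (v₁ + v₀)) ≤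
    16 * ∑ R (λ ρ → square ((if above ρ a b then u₁ else u₀) * (if above ρ c d then v₁ else v₀)))
  one-voter u₁ u₀ v₁ v₀ = begin
    length R * S  ≡⟨ cong (_* S) total ⟩
    (N₁₁ + N₁₀) * 2 * S  ≤⟨ correlated-two-point N₁₁ N₁₀ u₁ u₀ v₁ v₀ N₁₁≤ N₁₀≤ ⟩
    16 * (N₁₁ * (F true true + F false false) + N₁₀ * (F true false + F false true))
      ≡⟨ cong (16 *_) (e N₁₁ N₁₀ (F true true) (F false false) (F true false) (F false true)) ⟩
    16 * (N₁₁ * F true true + N₁₀ * F true false + (N₁₀ * F false true + N₁₁ * F false false))
      ≡⟨ cong₂ (λ p q → 16 * (N₁₁ * F true true + N₁₀ * F true false + (p * F false true + q * F false false))) N₁₀≡N₀₁ N₁₁≡N₀₀ ⟩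
    16 * (N₁₁ * F true true + N₁₀ * F true false + (N₀₁ * F false true + N₀₀ * F false false))
      ≡⟨ cong (16 *_) (∑-by-signs R x y F) ⟨
    16 * ∑ R (λ ρ → F (x ρ) (y ρ)) ∎
    where
    open ≤-Reasoning
    S = square ((u₁ + u₀) * (v₁ + v₀))
    F : Bool → Bool → ℕ
    F s t = square ((if s then u₁ else u₀) * (if t then v₁ else v₀))
    e : ∀ α β p q r t → α * (p + q) + β * (r + t) ≡ α * p + β * r + (β * t + α * q)
    e = solve-∀

  -- Condition on the first voter, apply the induction hypothesis to each ballot, and feed the
  -- conditional counts to `one-voter`. For densities γ and η of `g` and `h` on the cube, the joint
  -- probability is at least (γη)².
  reverse-hypercontractivity : ∀ {n} (g h : Vec Bool n → Bool) →
    length (profiles k n) * square (# (cube n) g * # (cube n) h) ≤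
    16 ^ n * # (profiles k n) (λ σ → g (signs a b σ) ∧ h (signs c d σ))
  reverse-hypercontractivity {zero} g h with g [] | h []
  ... | true  | true  = ≤-refl
  ... | true  | false = z≤n
  ... | false | _     = z≤n
  reverse-hypercontractivity {suc n} g h = begin
    length (profiles k (suc n)) * square (# (cube (suc n)) g * # (cube (suc n)) h)
      ≡⟨ cong₂ _*_ lengthₛ (cong square (cong₂ _*_ (halves g) (halves h))) ⟩
    length R * N * square ((|g| true + |g| false) * (|h| true + |h| false))
      ≡⟨ e₁ (length R) N _ ⟩
    N * (length R * square ((|g| true + |g| false) * (|h| true + |h| false)))
      ≤⟨ *-monoʳ-≤ N (one-voter (|g| true) (|g| false) (|h| true) (|h| false)) ⟩
    N * (16 * ∑ R (λ ρ → square ((if x ρ then |g| true else |g| false) * (if y ρ then |h| true else |h| false))))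
      ≡⟨ cong (λ z → N * (16 * z)) (∑-cong R λ ρ → cong₂ (λ p q → square (p * q)) (fold |g| (x ρ)) (fold |h| (y ρ))) ⟩
    N * (16 * ∑ R (λ ρ → square (|g| (x ρ) * |h| (y ρ))))
      ≡⟨ e₂ N (∑ R λ ρ → square (|g| (x ρ) * |h| (y ρ))) ⟩
    16 * (N * ∑ R (λ ρ → square (|g| (x ρ) * |h| (y ρ))))
      ≡⟨ cong (16 *_) (∑-* R N (λ ρ → square (|g| (x ρ) * |h| (y ρ)))) ⟨
    16 * ∑ R (λ ρ → N * square (|g| (x ρ) * |h| (y ρ)))
      ≤⟨ *-monoʳ-≤ 16 (∑-mono R λ ρ → reverse-hypercontractivity (g ∘ (x ρ ∷_)) (h ∘ (y ρ ∷_))) ⟩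
    16 * ∑ R (λ ρ → 16 ^ n * # (profiles k n) (λ σ → g (x ρ ∷ signs a b σ) ∧ h (y ρ ∷ signs c d σ)))
      ≡⟨ cong (16 *_) (∑-* R (16 ^ n) _) ⟩
    16 * (16 ^ n * ∑ R (λ ρ → # (profiles k n) (λ σ → g (x ρ ∷ signs a b σ) ∧ h (y ρ ∷ signs c d σ))))
      ≡⟨ *-assoc 16 (16 ^ n) _ ⟨
    16 ^ suc n * ∑ R (λ ρ → # (profiles k n) (λ σ → g (x ρ ∷ signs a b σ) ∧ h (y ρ ∷ signs c d σ)))
      ≡⟨ cong (16 ^ suc n *_) (∑-vecs-suc R n _) ⟨
    16 ^ suc n * # (profiles k (suc n)) (λ σ → g (signs a b σ) ∧ h (signs c d σ)) ∎
    where
    open ≤-Reasoning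
    N = length (profiles k n)
    |g| |h| : Bool → ℕ
    |g| s = # (cube n) (g ∘ (s ∷_))
    |h| s = # (cube n) (h ∘ (s ∷_))
    lengthₛ : length (profiles k (suc n)) ≡ length R * N
    lengthₛ = trans (length-vecs R (suc n)) (cong (length R *_) (sym (length-vecs R n)))
    halves : ∀ g → # (cube (suc n)) g ≡ # (cube n) (g ∘ (true ∷_)) + # (cube n) (g ∘ (false ∷_))
    halves g = trans (∑-vecs-suc bools n (𝟙 ∘ g)) (cong (# (cube n) (g ∘ (true ∷_)) +_) (+-identityʳ _))
    fold : ∀ (F : Bool → ℕ) s → (if s then F true else F false) ≡ F s
    fold F true  = refl
    fold F false = refl
    e₁ : ∀ r N z → r * N * z ≡ N * (r * z)
    e₁ = solve-∀
    e₂ : ∀ N z → N * (16 * z) ≡ 16 * (N * z)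
    e₂ = solve-∀

-- Sorting a function on the cube coordinate by coordinate

sorted : (Vec Bool n → Bool) → Vec Bool n → Bool
sorted {zero}  G v           = G v
sorted {suc n} G (true  ∷ v) = sorted (λ u → G (true ∷ u) ∨ G (false ∷ u)) v
sorted {suc n} G (false ∷ v) = sorted (λ u → G (true ∷ u) ∧ G (false ∷ u)) v

_[_↦_] : Vec Bool n → Fin n → Bool → Vec Bool n
v [ i ↦ s ] = updateAt v i (λ _ → s)

-- Sorting the head leaves a disjunction and a conjunction that are sorted separately afterwards;
-- their order has to survive this.
sorted-mono : ∀ {n} {G H : Vec Bool n → Bool} → (∀ v → G v ≡ true → H v ≡ true) → ∀ v → sorted G v ≡ true → sorted H v ≡ true
sorted-mono {zero}  h v e = h v e
sorted-mono {suc n} {G} {H} h (true ∷ v) = sorted-mono (λ u → or (h (true ∷ u)) (h (false ∷ u))) v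
  where
  or : ∀ {a b c d} → (a ≡ true → c ≡ true) → (b ≡ true → d ≡ true) → a ∨ b ≡ true → c ∨ d ≡ true
  or {a = true} p q e rewrite p refl = refl
  or {a = false} {c = true} p q e = refl
  or {a = false} {c = false} p q e = q e
sorted-mono {suc n} {G} {H} h (false ∷ v) = sorted-mono (λ u → and (h (true ∷ u)) (h (false ∷ u))) v
  where
  and : ∀ {a b c d} → (a ≡ true → c ≡ true) → (b ≡ true → d ≡ true) → a ∧ b ≡ true → c ∧ d ≡ true
  and {a = true} p q e rewrite p refl = q e

sorted-monotone : ∀ (G : Vec Bool n → Bool) i v → sorted G (v [ i ↦ false ]) ≡ true → sorted G (v [ i ↦ true ]) ≡ true
sorted-monotone G Fin.zero    (s ∷ v)     = sorted-mono (λ u → ∧⇒∨ (G (true ∷ u)) (G (false ∷ u))) v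
  where
  ∧⇒∨ : ∀ a b → a ∧ b ≡ true → a ∨ b ≡ true
  ∧⇒∨ true b e = refl
sorted-monotone G (Fin.suc i) (true ∷ v)  = sorted-monotone _ i v
sorted-monotone G (Fin.suc i) (false ∷ v) = sorted-monotone _ i v

violated : (Vec Bool n → Bool) → Fin n → Vec Bool n → Bool
violated G i v = G (v [ i ↦ false ]) ∧ not (G (v [ i ↦ true ]))

-- Sorting one coordinate creates no new violation in the other ones.
sorted-distance : ∀ (G : Vec Bool n → Bool) →
  # (cube n) (λ v → G v xor sorted G v) ≤ ∑ (allFin n) (λ i → # (cube n) (violated G i))
sorted-distance {zero}  G rewrite xor-same (G []) = z≤n
sorted-distance {suc n} G = begin
  # (cube (suc n)) (λ v → G v xor sorted G v)
    ≡⟨ halves (λ v → G v xor sorted G v) ⟩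
  # C (λ v → G₁ v xor sorted G∨ v) + # C (λ v → G₀ v xor sorted G∧ v)
    ≤⟨ +-mono-≤ (∑-mono C λ v → xor-triangle (G₁ v) (G∨ v) _) (∑-mono C λ v → xor-triangle (G₀ v) (G∧ v) _) ⟩
  ∑ C (λ v → 𝟙 (G₁ v xor G∨ v) + 𝟙 (G∨ v xor sorted G∨ v)) + ∑ C (λ v → 𝟙 (G₀ v xor G∧ v) + 𝟙 (G∧ v xor sorted G∧ v))
    ≡⟨ cong₂ _+_ (∑-+ C _ _) (∑-+ C _ _) ⟩
  # C (λ v → G₁ v xor G∨ v) + # C (λ v → G∨ v xor sorted G∨ v) + (# C (λ v → G₀ v xor G∧ v) + # C (λ v → G∧ v xor sorted G∧ v))
    ≤⟨ +-mono-≤ (+-mono-≤ (≤-reflexive (∑-cong C λ v → cong 𝟙 (change∨ (G₁ v) (G₀ v)))) (sorted-distance G∨))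
         (+-mono-≤ (≤-reflexive (∑-cong C λ v → cong 𝟙 (change∧ (G₁ v) (G₀ v)))) (sorted-distance G∧)) ⟩
  -- A pair out of order in the head coordinate changes at both of its points. `violated` ignores
  -- the coordinate that it resets, so it counts such a pair twice as well.
  W + ∑ (allFin n) (λ i → # C (violated G∨ i)) + (W + ∑ (allFin n) (λ i → # C (violated G∧ i)))
    ≡⟨ regroup W _ _ ⟩
  W + W + (∑ (allFin n) (λ i → # C (violated G∨ i)) + ∑ (allFin n) (λ i → # C (violated G∧ i)))
    ≡⟨ cong (W + W +_) (sym (trans (∑-cong (allFin n) λ i → ∑-+ C _ _) (∑-+ (allFin n) _ _))) ⟩
  W + W + ∑ (allFin n) (λ i → ∑ C λ v → 𝟙 (violated G∨ i v) + 𝟙 (violated G∧ i v))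
    ≤⟨ +-monoʳ-≤ (W + W) (∑-mono (allFin n) λ i → ∑-mono C λ v →
         four (G₁ (v [ i ↦ false ])) (G₀ (v [ i ↦ false ])) (G₁ (v [ i ↦ true ])) (G₀ (v [ i ↦ true ]))) ⟩
  W + W + ∑ (allFin n) (λ i → ∑ C λ v → 𝟙 (violated G₁ i v) + 𝟙 (violated G₀ i v))
    ≡⟨ cong₂ _+_ (sym (halves (violated G Fin.zero)))
         (∑-cong (allFin n) λ i → trans (∑-+ C _ _) (sym (halves (violated G (Fin.suc i))))) ⟩
  # (cube (suc n)) (violated G Fin.zero) + ∑ (allFin n) (λ i → # (cube (suc n)) (violated G (Fin.suc i)))
    ≡⟨ ∑-allFin-suc n (λ i → # (cube (suc n)) (violated G i)) ⟨
  ∑ (allFin (suc n)) (λ i → # (cube (suc n)) (violated G i)) ∎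
  where
  open ≤-Reasoning
  C = cube n
  G₁ G₀ G∨ G∧ : Vec Bool n → Bool
  G₁ u = G (true ∷ u)
  G₀ u = G (false ∷ u)
  G∨ u = G₁ u ∨ G₀ u
  G∧ u = G₁ u ∧ G₀ u
  W = # C λ v → G₀ v ∧ not (G₁ v)
  halves : ∀ (P : Vec Bool (suc n) → Bool) → # (cube (suc n)) P ≡ # C (P ∘ (true ∷_)) + # C (P ∘ (false ∷_))
  halves P = trans (∑-vecs-suc bools n (𝟙 ∘ P)) (cong (# C (P ∘ (true ∷_)) +_) (+-identityʳ _))
  regroup : ∀ w p q → w + p + (w + q) ≡ w + w + (p + q)
  regroup = solve-∀
  change∨ : ∀ a b → a xor (a ∨ b) ≡ b ∧ not a
  change∨ true  true  = refl
  change∨ true  false = refl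
  change∨ false true  = refl
  change∨ false false = refl
  change∧ : ∀ a b → b xor (a ∧ b) ≡ b ∧ not a
  change∧ true  true  = refl
  change∧ true  false = refl
  change∧ false true  = refl
  change∧ false false = refl
  four : ∀ a b c d → 𝟙 ((a ∨ b) ∧ not (c ∨ d)) + 𝟙 ((a ∧ b) ∧ not (c ∧ d)) ≤ 𝟙 (a ∧ not c) + 𝟙 (b ∧ not d)
  four true  true  true  true  = z≤n
  four true  true  true  false = ≤-refl
  four true  true  false true  = ≤-refl
  four true  true  false false = ≤-refl
  four true  false true  d     = z≤n
  four true  false false true  = z≤n
  four true  false false false = ≤-refl
  four false true  true  true  = z≤n
  four false true  true  false = z≤n
  four false true  false true  = z≤n
  four false true  false false = ≤-refl
  four false false c     d     = z≤n

-- Bookkeeping for one changed ballot and for Boolean events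

at-at : ∀ (v : Fin n) {S T : Ranking k → Ranking k} σ → at v T (at v S σ) ≡ at v (T ∘ S) σ
at-at v σ = updateAt-updateAt v σ

at-local : ∀ (v : Fin n) {S T : Ranking k → Ranking k} σ → S (lookup σ v) ≡ T (lookup σ v) → at v S σ ≡ at v T σ
at-local v σ e = updateAt-cong-local v σ e

lookup-at : ∀ (v : Fin n) {T : Ranking k → Ranking k} σ → lookup (at v T σ) v ≡ T (lookup σ v)
lookup-at v σ = lookup∘updateAt v σ

at-sw-involutive : ∀ (v : Fin n) p (σ : Profile k n) → at v (sw p) (at v (sw p) σ) ≡ σ
at-sw-involutive v p σ = trans (at-at v σ) (updateAt-id-local v σ (sw-involutive p (lookup σ v)))

∧-true : ∀ {a b} → a ∧ b ≡ true → a ≡ true × b ≡ true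
∧-true {true} {true} e = refl , refl

true-∧ : ∀ {a b} → a ≡ true → b ≡ true → a ∧ b ≡ true
true-∧ refl refl = refl

not-true : ∀ {a} → not a ≡ true → a ≡ false
not-true {false} e = refl

true≢false : ∀ {a : Bool} → a ≡ true → a ≡ false → ⊥
true≢false refl ()

imp : ∀ {a b} → a ∧ not b ≡ false → a ≡ true → b ≡ true
imp {b = true} e refl = refl

xor-false : ∀ {a b} → a xor b ≡ false → a ≡ b
xor-false {true}  {true}  e = refl
xor-false {false} {false} e = refl

xor-≡ : ∀ {a b} → a xor b ≡ true → a ≡ b → ⊥
xor-≡ {true}  {false} e ()
xor-≡ {false} {true}  e ()

Adjacent-above : ∀ {p} (ρ : Ranking k) {x y} → Adjacent p ρ x y → above ρ x y ≡ true × above (sw p ρ) x y ≡ false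
Adjacent-above {p = p} ρ {x} {y} adj@(e , f) = <⇒above ρ x y x<y , above-asym (sw p ρ) (<⇒above (sw p ρ) y x
  (subst₂ Fin._<_ (sym (proj₁ (adjacent-sw {ρ = ρ} adj))) (sym (proj₂ (adjacent-sw {ρ = ρ} adj))) x<y))
  where
  x<y : pos ρ x Fin.< pos ρ y
  x<y = ≤-reflexive (trans (cong suc e) (sym f))

lift-adjacent-upper : ∀ {p} {ρ : Ranking k} {x y} → Adjacent p ρ x y → lift x (sw p ρ) ≡ lift x ρ
lift-adjacent-upper {p = p} {ρ} {x} {y} adj@(e , f) = trans (sym (lift-adjacent {ρ = sw p ρ} {x = y} {y = x}
  (trans (cong toℕ (proj₁ (adjacent-sw {ρ = ρ} adj))) e , trans (cong toℕ (proj₂ (adjacent-sw {ρ = ρ} adj))) f)))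
  (cong (lift x) (sw-involutive p ρ))

-- Events lost while an alternative rises to the top

module _ {k n : ℕ} where

  private
    Ω = profiles k n

  has-pos : Fin n → Fin k → ℕ → Profile k n → Bool
  has-pos v a j σ = does (toℕ (pos (lookup σ v) a) ℕ.≟ j)

  module _ (v : Fin n) (a : Fin k) (C : Profile k n → Bool) (Δ : ℕ)
    (step : ∀ p → # Ω (λ σ → has-pos v a (suc p) σ ∧ (C σ ∧ not (C (at v (sw p) σ)))) ≤ Δ) where

    private
      lost : ℕ → Profile k n → Bool
      lost j σ = has-pos v a j σ ∧ (C σ ∧ not (C (at v (front j) σ)))

      -- `lost j` looks only at profiles with `a` at position j. One swap carries these injectively
      -- to profiles with `a` one place higher, so j swaps cost `Δ` each.
      front-loss : ∀ j → # Ω (lost j) ≤ j * Δ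
      front-loss zero = ≤-trans (#-≤ Ω (lost 0) {λ _ → 0} λ σ e →
        let c , d = ∧-true {C σ} (proj₂ (∧-true {has-pos v a 0 σ} e)) in
        ⊥-elim (true≢false c (not-true (subst (λ τ → not (C τ) ≡ true) (updateAt-id v σ) d))))
        (≤-reflexive (∑-zero Ω))
      front-loss (suc j) = begin
        # Ω (lost (suc j))
          ≤⟨ #-≤ Ω (lost (suc j)) (λ σ e → pointwise σ (∧-true {has-pos v a (suc j) σ} e)) ⟩
        ∑ Ω (λ σ → 𝟙 (has-pos v a (suc j) σ ∧ (C σ ∧ not (C (at v (sw j) σ)))) + 𝟙 (lost j (at v (sw j) σ)))
          ≡⟨ ∑-+ Ω _ _ ⟩
        # Ω (λ σ → has-pos v a (suc j) σ ∧ (C σ ∧ not (C (at v (sw j) σ)))) + # Ω (lost j ∘ at v (sw j))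
          ≤⟨ +-mono-≤ (step j) (≤-trans (∑-∘ (expands-at (expands-sw j) v) (𝟙 ∘ lost j)) (≤-trans (≤-reflexive (+-identityʳ _)) (front-loss j))) ⟩
        Δ + j * Δ ∎
        where
        open ≤-Reasoning
        pointwise : ∀ σ → has-pos v a (suc j) σ ≡ true × C σ ∧ not (C (at v (front (suc j)) σ)) ≡ true →
          1 ≤ 𝟙 (has-pos v a (suc j) σ ∧ (C σ ∧ not (C (at v (sw j) σ)))) + 𝟙 (lost j (at v (sw j) σ))
        pointwise σ (h , e) = unless (has-pos v a (suc j) σ ∧ (C σ ∧ not (C (at v (sw j) σ)))) kept
          where
          c = proj₁ (∧-true {C σ} e)
          d = proj₂ (∧-true {C σ} e)
          kept : has-pos v a (suc j) σ ∧ (C σ ∧ not (C (at v (sw j) σ))) ≡ false → 1 ≤ 𝟙 (lost j (at v (sw j) σ))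
          kept q rewrite h | c = ≤-reflexive (cong 𝟙 (sym (true-∧
            (dec-true (toℕ (pos (lookup (at v (sw j) σ) v) a) ℕ.≟ j) (trans (cong (λ ρ → toℕ (pos ρ a)) (lookup-at v σ))
              (pos-sw-suc (lookup σ v) a (does-true (toℕ (pos (lookup σ v) a) ℕ.≟ suc j) h))))
            (true-∧ (imp {true} q refl) (subst (λ τ → not (C τ) ≡ true) (sym (at-at v σ)) d)))))

    -- There are k starting positions, each of cost at most `k * Δ`. Only swaps that move `a`
    -- upwards are charged, which is what suits a winner being raised.
    lift-loss : # Ω (λ σ → C σ ∧ not (C (at v (lift a) σ))) ≤ k * k * Δ
    lift-loss = begin
      # Ω (λ σ → C σ ∧ not (C (at v (lift a) σ)))  ≤⟨ ∑-mono Ω located ⟩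
      ∑ Ω (λ σ → ∑ (allFin k) λ j → 𝟙 (lost (toℕ j) σ))  ≡⟨ ∑-swap Ω (allFin k) _ ⟩
      ∑ (allFin k) (λ j → # Ω (lost (toℕ j)))  ≤⟨ ∑-≤-const (allFin k) (k * Δ) (λ j →
        ≤-trans (front-loss (toℕ j)) (*-monoˡ-≤ Δ (<⇒≤ (toℕ<n j)))) ⟩
      length (allFin k) * (k * Δ)  ≡⟨ cong (_* (k * Δ)) (length-allFin k) ⟩
      k * (k * Δ)  ≡⟨ *-assoc k k Δ ⟨
      k * k * Δ  ∎
      where
      open ≤-Reasoning
      located : ∀ σ → 𝟙 (C σ ∧ not (C (at v (lift a) σ))) ≤ ∑ (allFin k) (λ j → 𝟙 (lost (toℕ j) σ))
      located σ = ≤-trans (≤-reflexive (cong 𝟙 (sym found)))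
        (∑-∈ (λ j → 𝟙 (lost (toℕ j) σ)) (∈-allFin (pos (lookup σ v) a)))
        where
        found : lost (toℕ (pos (lookup σ v) a)) σ ≡ C σ ∧ not (C (at v (lift a) σ))
        found rewrite dec-true (toℕ (pos (lookup σ v) a) ℕ.≟ toℕ (pos (lookup σ v) a)) refl =
          cong (λ τ → C σ ∧ not (C τ)) (at-local v σ refl)

  lift-density : ∀ v a (C : Profile k n → Bool) → # Ω (C ∘ at v (lift a)) ≤ k * # Ω C
  lift-density v a C = ∑-∘ (expands-at (expands-lift a) v) (𝟙 ∘ C)

-- The local structure of a social choice function

module Local {k n : ℕ} (f : SCF k n) where

  private
    Ω = profiles k n

  is : Fin k → Profile k n → Bool
  is a σ = does (f σ Fin.≟ a)

  is⇒≡ : ∀ {a} σ → is a σ ≡ true → f σ ≡ a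
  is⇒≡ {a} σ = does-true (f σ Fin.≟ a)

  ≡⇒is : ∀ {a} σ → f σ ≡ a → is a σ ≡ true
  ≡⇒is {a} σ = dec-true (f σ Fin.≟ a)

  ≢⇒is : ∀ {a} σ → f σ ≢ a → is a σ ≡ false
  ≢⇒is {a} σ = dec-false (f σ Fin.≟ a)

  is-cong : ∀ {a} σ τ → (f σ ≡ a → f τ ≡ a) → (f τ ≡ a → f σ ≡ a) → is a σ ≡ is a τ
  is-cong {a} σ τ g h with f τ Fin.≟ a
  ... | yes e = ≡⇒is σ (h e)
  ... | no ¬e = ≢⇒is σ (¬e ∘ g)

  differ : SCF k n → Profile k n → Bool
  differ g σ = not (does (f σ Fin.≟ g σ))

  differ⇒≢ : ∀ g σ → differ g σ ≡ true → f σ ≢ g σ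
  differ⇒≢ g σ e h with f σ Fin.≟ g σ
  ... | no ¬h = ¬h h

  improves : Fin n → ℕ → Profile k n → Bool
  improves v p σ = above (lookup σ v) (f (at v (sw p) σ)) (f σ)

  abstract
    -- Positions below `k` suffice, since later swaps do nothing. Abstract, like `m`, so that
    -- counting never unfolds the search.
    manipulable? : ∀ σ → Dec (∃[ v ] ∃[ p ] improves v (toℕ {k} p) σ ≡ true)
    manipulable? σ = any? λ v → any? λ p → improves v (toℕ p) σ Bool.≟ true

  manip : Profile k n → Bool
  manip σ = does (manipulable? σ)

  abstract
    m : ℕ
    m = # Ω manip

    m≡ : m ≡ # Ω manip
    m≡ = refl

  no-improvement : ∀ σ v p → manip σ ≡ false → improves v p σ ≡ false
  no-improvement σ v p e with improves v p σ in eq | p ℕ.<? k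
  ... | false | _ = refl
  ... | true | yes l = ⊥-elim (true≢false (dec-true (manipulable? σ) (v , Fin.fromℕ< l ,
          subst (λ q → improves v q σ ≡ true) (sym (toℕ-fromℕ< l)) eq)) e)
  ... | true | no ¬l = ⊥-elim (true≢false eq (subst (λ τ → above (lookup σ v) (f τ) (f σ) ≡ false)
          (sym (updateAt-id-local v σ (sw-trivial p (lookup σ v) (≤-trans (≮⇒≥ ¬l) (n≤1+n p))))) (above-irrefl (lookup σ v) (f σ))))

  -- If the outcome changes, the old winner is above the new one before the swap, or σ would be
  -- manipulable, and below it afterwards, or the other end would be. A swap reverses only the two
  -- neighbours that it exchanges.
  edge : ∀ σ v p → manip σ ≡ false → manip (at v (sw p) σ) ≡ false →
    f σ ≡ f (at v (sw p) σ) ⊎ Adjacent p (lookup σ v) (f σ) (f (at v (sw p) σ))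
  edge σ v p m₁ m₂ with f σ Fin.≟ f (at v (sw p) σ)
  ... | yes e = inj₁ e
  ... | no ne with above-sw p (lookup σ v) (f σ) (f (at v (sw p) σ))
                   (above-total (lookup σ v) (ne ∘ sym) (no-improvement σ v p m₁))
  ...   | inj₂ adj = inj₂ adj
  ...   | inj₁ e = ⊥-elim (true≢false e (subst (λ ρ → above ρ (f σ) (f (at v (sw p) σ)) ≡ false) (lookup-at v σ)
          (subst (λ τ → above (lookup (at v (sw p) σ) v) (f τ) (f (at v (sw p) σ)) ≡ false) (at-sw-involutive v p σ)
            (no-improvement (at v (sw p) σ) v p m₂))))

  manip-count : ∀ {c U} → Expands Ω c U → # Ω (manip ∘ U) ≤ c * m
  manip-count {c} e = ≤-trans (∑-∘ e (𝟙 ∘ manip)) (≤-reflexive (cong (c *_) (sym m≡)))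

  -- A union bound in contrapositive form: `P` forces a manipulable profile at `U σ` or `V σ`, and
  -- the constants of `Expands` count the preimages.
  two-bad : ∀ P {c d U V} → Expands Ω c U → Expands Ω d V →
    (∀ σ → P σ ≡ true → manip (U σ) ≡ false → manip (V σ) ≡ false → ⊥) → # Ω P ≤ c * m + d * m
  two-bad P {c} {d} {U} {V} u v h = begin
    # Ω P  ≤⟨ #-≤ Ω P (λ σ e → unless (manip (U σ)) λ e₁ →
      surely (manip (V σ)) λ e₂ → h σ e e₁ e₂) ⟩
    ∑ Ω (λ σ → 𝟙 (manip (U σ)) + 𝟙 (manip (V σ)))  ≡⟨ ∑-+ Ω _ _ ⟩
    # Ω (manip ∘ U) + # Ω (manip ∘ V)  ≤⟨ +-mono-≤ (manip-count u) (manip-count v) ⟩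
    c * m + d * m  ∎
    where open ≤-Reasoning

  expands-step : ∀ v p → Expands Ω 1 (at v (sw p))
  expands-step v p = expands-at (expands-sw p) v

  expands-raise : ∀ v a → Expands Ω k (at v (lift a))
  expands-raise v a = expands-at (expands-lift a) v

  raised : Fin n → Fin k → Profile k n → Bool
  raised v a σ = is a (at v (lift a) σ)

  raising-winner : ∀ v a → # Ω (λ σ → is a σ ∧ not (raised v a σ)) ≤ k * k * (1 * m + 1 * m)
  raising-winner v a = lift-loss v a (is a) _ λ p → two-bad _ expands-id (expands-step v p) λ σ e m₁ m₂ →
    let h , e′ = ∧-true {has-pos v a (suc p) σ} e
        c , d = ∧-true {is a σ} e′
    in stay σ p h (is⇒≡ σ c) (not-true d) (edge σ v p m₁ m₂)
    where
    stay : ∀ σ p → has-pos v a (suc p) σ ≡ true → f σ ≡ a → is a (at v (sw p) σ) ≡ false →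
      f σ ≡ f (at v (sw p) σ) ⊎ Adjacent p (lookup σ v) (f σ) (f (at v (sw p) σ)) → ⊥
    stay σ p h e ne (inj₁ e′) = true≢false (≡⇒is (at v (sw p) σ) (trans (sym e′) e)) ne
    stay σ p h refl ne (inj₂ (q , _)) = 1+n≢n (trans (sym (does-true (toℕ (pos (lookup σ v) a) ℕ.≟ suc p) h)) q)

  -- The swap `suc q` spares position 0, and by `edge` only a participant of the swap can gain or
  -- lose the win.
  top-stable : ∀ (σ : Profile k n) v (a : Fin k) q → toℕ (pos (lookup σ v) a) ≡ 0 → manip σ ≡ false → manip (at v (sw (suc q)) σ) ≡ false →
    is a σ ≡ is a (at v (sw (suc q)) σ)
  top-stable σ v a q top m₁ m₂ with edge σ v (suc q) m₁ m₂
  ... | inj₁ e = is-cong σ (at v (sw (suc q)) σ) (trans (sym e)) (trans e)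
  ... | inj₂ (x , y) = is-cong σ (at v (sw (suc q)) σ)
          (λ { refl → ⊥-elim (0≢1+n (trans (sym top) x)) }) (λ { refl → ⊥-elim (0≢1+n (trans (sym top) y)) })

  top-of-lift : ∀ v (a : Fin k) (σ : Profile k n) → toℕ (pos (lookup (at v (lift a) σ) v) a) ≡ 0
  top-of-lift v a σ = trans (cong (λ ρ → toℕ (pos ρ a)) (lookup-at v σ)) (pos-lift a (lookup σ v))

  at-lift-sw : ∀ v (a : Fin k) p (σ : Profile k n) → at v (lift a) (at v (sw p) σ) ≡ at v (lift a) σ
    ⊎ (∃[ q ] at v (lift a) (at v (sw p) σ) ≡ at v (sw (suc q)) (at v (lift a) σ))
  at-lift-sw v a p σ with lift-sw a p (lookup σ v)
  ... | inj₁ e = inj₁ (trans (at-at v σ) (at-local v σ e))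
  ... | inj₂ (q , e) = inj₂ (q , trans (at-at v σ) (trans (at-local v σ e) (sym (at-at v σ))))

  -- Changing the ballot of `v` beforehand alters the raised ballot at most below the top. Apart
  -- from manipulable profiles, the other voters decide whether raising `a` makes it win.
  raised-sw : ∀ v (a : Fin k) p (σ : Profile k n) → manip (at v (lift a) σ) ≡ false → manip (at v (lift a) (at v (sw p) σ)) ≡ false →
    raised v a σ ≡ raised v a (at v (sw p) σ)
  raised-sw v a p σ m₁ m₂ with at-lift-sw v a p σ
  ... | inj₁ e = cong (is a) (sym e)
  ... | inj₂ (q , e) = trans (top-stable (at v (lift a) σ) v a q (top-of-lift v a σ) m₁ (subst (λ τ → manip τ ≡ false) e m₂))
          (cong (is a) (sym e))

  raised-invariant : ∀ v a p → # Ω (λ σ → raised v a σ xor raised v a (at v (sw p) σ)) ≤ k * m + 1 * k * m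
  raised-invariant v a p = two-bad _ (expands-raise v a) (expands-∘ (expands-raise v a) (expands-step v p))
    λ σ e m₁ m₂ → xor-≡ e (raised-sw v a p σ m₁ m₂)

  private
    ∧-not⇒xor : ∀ h a b → 𝟙 (h ∧ (a ∧ not b)) ≤ 𝟙 (a xor b)
    ∧-not⇒xor true  true  b     = ≤-refl
    ∧-not⇒xor true  false b     = z≤n
    ∧-not⇒xor false a     b     = z≤n

    xor-not : ∀ a b → not a xor not b ≡ a xor b
    xor-not true  true  = refl
    xor-not true  false = refl
    xor-not false true  = refl
    xor-not false false = refl

  raised-lift : ∀ v a b → # Ω (λ σ → raised v a σ ∧ not (raised v a (at v (lift b) σ))) ≤ k * k * (k * m + 1 * k * m)
  raised-lift v a b = lift-loss v b (raised v a) _ λ p → ≤-trans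
    (∑-mono Ω λ σ → ∧-not⇒xor (has-pos v b (suc p) σ) (raised v a σ) _) (raised-invariant v a p)

  -- `lift-loss` is one-sided. Applied to the complement, it gives the way back from a lifted ballot
  -- that `clash` needs.
  unraised-lift : ∀ v a b → # Ω (λ σ → not (raised v a σ) ∧ not (not (raised v a (at v (lift b) σ)))) ≤ k * k * (k * m + 1 * k * m)
  unraised-lift v a b = lift-loss v b (not ∘ raised v a) _ λ p → ≤-trans
    (∑-mono Ω λ σ → ≤-trans (∧-not⇒xor (has-pos v b (suc p) σ) (not (raised v a σ)) _) (≤-reflexive (cong 𝟙 (xor-not (raised v a σ) _))))
    (raised-invariant v a p)

  -- Voter v decides between a and b by ranking them first and second.
  pivotal : Fin n → Fin k → Fin k → Profile k n → Bool
  pivotal v a b σ = raised v a (at v (lift b) σ) ∧ raised v b (at v (lift a) σ)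

  slack : ℕ
  slack = m + (m + (k * k * (1 * m + 1 * m) + (k * k * (k * m + 1 * k * m) + (k * k * (1 * m + 1 * m) + k * k * (k * m + 1 * k * m)))))

  -- By `edge`, `x` and `y` are the exchanged neighbours. As `x` wins, it still wins after being
  -- raised, also when `y` was raised before. The same holds for `y` from the other end, and both
  -- ends agree once `x` has been raised. The six summands of `slack` are the exceptions.
  boundary-pivotal : ∀ v p {x y} → x ≢ y →
    # Ω (λ σ → is x σ ∧ is y (at v (sw p) σ)) ≤ # Ω (pivotal v x y) + slack
  boundary-pivotal v p {x} {y} x≢y = begin
    # Ω (λ σ → is x σ ∧ is y (at v (sw p) σ)) ≤⟨ #-≤ Ω _ pointwise ⟩
    ∑ Ω (λ σ → 𝟙 (pivotal v x y σ) + (𝟙 (manip σ) + (𝟙 (manip (s σ)) + (𝟙 (A₁ σ) + (𝟙 (A₂ σ) + (𝟙 (B₁ (s σ)) + 𝟙 (B₂ (s σ))))))))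
      ≡⟨ ∑-+₇ ⟩
    # Ω (pivotal v x y) + (# Ω manip + (# Ω (manip ∘ s) + (# Ω A₁ + (# Ω A₂ + (# Ω (B₁ ∘ s) + # Ω (B₂ ∘ s))))))
      ≤⟨ +-monoʳ-≤ (# Ω (pivotal v x y)) (+-mono-≤ (≤-reflexive (sym m≡)) (+-mono-≤ (≤-trans (via manip) (≤-reflexive (sym m≡))) (+-mono-≤ (raising-winner v x)
           (+-mono-≤ (raised-lift v x y) (+-mono-≤ (≤-trans (via B₁) (raising-winner v y)) (≤-trans (via B₂) (raised-lift v y x))))))) ⟩
    # Ω (pivotal v x y) + slack ∎
    where
    open ≤-Reasoning
    s : Profile k n → Profile k n
    s = at v (sw p)
    A₁ A₂ B₁ B₂ : Profile k n → Bool
    A₁ σ = is x σ ∧ not (raised v x σ)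
    A₂ σ = raised v x σ ∧ not (raised v x (at v (lift y) σ))
    B₁ σ = is y σ ∧ not (raised v y σ)
    B₂ σ = raised v y σ ∧ not (raised v y (at v (lift x) σ))
    via : ∀ C → # Ω (C ∘ s) ≤ # Ω C
    via C = ≤-trans (∑-∘ (expands-step v p) (𝟙 ∘ C)) (≤-reflexive (+-identityʳ _))
    ∑-+₇ : ∀ {a b c d e g h : Profile k n → ℕ} →
      ∑ Ω (λ σ → a σ + (b σ + (c σ + (d σ + (e σ + (g σ + h σ)))))) ≡
      ∑ Ω a + (∑ Ω b + (∑ Ω c + (∑ Ω d + (∑ Ω e + (∑ Ω g + ∑ Ω h)))))
    ∑-+₇ {a} {b} {c} {d} {e} {g} {h} = trans (∑-+ Ω a _) (cong (∑ Ω a +_) (trans (∑-+ Ω b _) (cong (∑ Ω b +_)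
      (trans (∑-+ Ω c _) (cong (∑ Ω c +_) (trans (∑-+ Ω d _) (cong (∑ Ω d +_) (trans (∑-+ Ω e _) (cong (∑ Ω e +_) (∑-+ Ω g h))))))))))
    pointwise : ∀ σ → is x σ ∧ is y (s σ) ≡ true →
      1 ≤ 𝟙 (pivotal v x y σ) + (𝟙 (manip σ) + (𝟙 (manip (s σ)) + (𝟙 (A₁ σ) + (𝟙 (A₂ σ) + (𝟙 (B₁ (s σ)) + 𝟙 (B₂ (s σ)))))))
    pointwise σ e = unless (pivotal v x y σ) λ ¬piv → unless (manip σ) λ m₁ → unless (manip (s σ)) λ m₂ →
      unless (A₁ σ) λ a₁ → unless (A₂ σ) λ a₂ → unless (B₁ (s σ)) λ b₁ →
      surely (B₂ (s σ)) λ b₂ → absurd ¬piv a₁ a₂ b₁ b₂ (edge σ v p m₁ m₂)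
      where
      fσ = is⇒≡ σ (proj₁ (∧-true {is x σ} e))
      fσ′ = is⇒≡ (s σ) (proj₂ (∧-true {is x σ} e))
      absurd : pivotal v x y σ ≡ false → A₁ σ ≡ false → A₂ σ ≡ false → B₁ (s σ) ≡ false → B₂ (s σ) ≡ false →
        f σ ≡ f (s σ) ⊎ Adjacent p (lookup σ v) (f σ) (f (s σ)) → ⊥
      absurd ¬piv a₁ a₂ b₁ b₂ (inj₁ e′) = x≢y (trans (sym fσ) (trans e′ fσ′))
      absurd ¬piv a₁ a₂ b₁ b₂ (inj₂ adj) = true≢false (true-∧ (imp a₂ (imp a₁ (≡⇒is σ fσ)))
        (subst (λ τ → raised v y τ ≡ true) (trans (at-at v σ) (at-local v σ
            (lift-adjacent-upper {ρ = lookup σ v} (subst₂ (Adjacent p (lookup σ v)) fσ fσ′ adj))))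
          (imp b₂ (imp b₁ (≡⇒is (s σ) fσ′))))) ¬piv

signs-at : ∀ {x y : Fin k} (v : Fin n) {T} (σ : Profile k n) → (∀ ρ → above (T ρ) x y ≡ above ρ x y) → signs x y (at v T σ) ≡ signs x y σ
signs-at {x = x} {y} Fin.zero    (ρ ∷ σ) h = cong (_∷ signs x y σ) (h ρ)
signs-at {x = x} {y} (Fin.suc v) (ρ ∷ σ) h = cong (above ρ x y ∷_) (signs-at v σ h)

pos-zero-unique : ∀ (ρ : Ranking k) {x y} → toℕ (pos ρ x) ≡ 0 → toℕ (pos ρ y) ≡ 0 → x ≡ y
pos-zero-unique ρ e f = pos-injective ρ (toℕ-injective (trans e (sym f)))

-- Pivotal voters for a pair, and the clash of two of them

module PivotalPairs {k n : ℕ} (f : SCF k n) where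

  open Local f

  private
    Ω = profiles k n

  pair-up : Fin n → Fin k → Fin k → Profile k n → Profile k n
  pair-up i a b σ = at i (lift a) (at i (lift b) σ)

  expands-pair-up : ∀ i a b → Expands Ω (k * k) (pair-up i a b)
  expands-pair-up i a b = expands-∘ (expands-raise i a) (expands-raise i b)

  pair-up-swap : ∀ i {a b} (σ : Profile k n) → a ≢ b → at i (sw 0) (pair-up i a b σ) ≡ pair-up i b a σ
  pair-up-swap i {a} {b} σ a≢b = trans (cong (at i (sw 0)) (at-at i σ)) (trans (at-at i σ)
    (trans (at-local i σ (sym (lift-lift (lookup σ i) a≢b))) (sym (at-at i σ))))

  pair-up-at : ∀ {i v} a b {T : Ranking k → Ranking k} (σ : Profile k n) → i ≢ v → pair-up i a b (at v T σ) ≡ at v T (pair-up i a b σ)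
  pair-up-at {i} {v} a b σ i≢v = trans (cong (at i (lift a)) (updateAt-commutes i v i≢v σ)) (updateAt-commutes i v i≢v (at i (lift b) σ))

  pair-up-top : ∀ i a b (σ : Profile k n) → toℕ (pos (lookup (pair-up i a b σ) i) a) ≡ 0
  pair-up-top i a b σ = top-of-lift i a (at i (lift b) σ)

  -- The two ballots differ by the swap of their top two. Away from manipulable profiles, being
  -- pivotal therefore means no more than that the two outcomes differ.
  pair-outcomes : ∀ i {a b} (σ : Profile k n) → a ≢ b → manip (pair-up i a b σ) ≡ false → manip (pair-up i b a σ) ≡ false →
    f (pair-up i a b σ) ≡ f (pair-up i b a σ) ⊎ (f (pair-up i a b σ) ≡ a × f (pair-up i b a σ) ≡ b)
  pair-outcomes i {a} {b} σ a≢b m₁ m₂ with edge (pair-up i a b σ) i 0 m₁ (subst (λ τ → manip τ ≡ false) (sym (pair-up-swap i σ a≢b)) m₂)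
  ... | inj₁ e = inj₁ (trans e (cong f (pair-up-swap i σ a≢b)))
  ... | inj₂ adj@(p , q) = inj₂ (pos-zero-unique (lookup (pair-up i a b σ) i) p (pair-up-top i a b σ) ,
          pos-zero-unique (lookup (pair-up i b a σ) i)
            (trans (cong₂ (λ τ x → toℕ (pos (lookup τ i) x)) (sym (pair-up-swap i σ a≢b)) (cong f (sym (pair-up-swap i σ a≢b))))
              (trans (cong (λ ρ → toℕ (pos ρ (f (at i (sw 0) τ)))) (lookup-at i τ))
                (trans (cong toℕ (proj₁ (adjacent-sw {ρ = lookup τ i} adj))) p)))
            (pair-up-top i b a σ))
    where τ = pair-up i a b σ

  Clean : Fin n → Fin k → Fin k → Fin n → ℕ → Profile k n → Set
  Clean i a b v p σ = manip (pair-up i a b σ) ≡ false × manip (pair-up i b a σ) ≡ false ×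
    manip (pair-up i a b (at v (sw p) σ)) ≡ false × manip (pair-up i b a (at v (sw p) σ)) ≡ false

  -- If the two outcomes still differ after the swap, `pair-outcomes` makes them `a` and `b`. If
  -- they coincide, one of them has moved. One that moves alone arrives at the other's value, so the
  -- swap exchanges `a` and `b`, which is excluded; if both move, then `a` and `b` share the
  -- position `p`.
  pivotal-other : ∀ {i v a b p} σ → i ≢ v → a ≢ b → above (lookup σ v) a b ≡ above (sw p (lookup σ v)) a b → Clean i a b v p σ →
    pivotal i a b σ ≡ true → pivotal i a b (at v (sw p) σ) ≡ true
  pivotal-other {i} {v} {a} {b} {p} σ i≢v a≢b unchanged (m₁ , m₂ , m₁′ , m₂′) e = true-∧ (≡⇒is τ₁′ (proj₁ both)) (≡⇒is τ₂′ (proj₂ both))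
    where
    ρ = lookup σ v
    τ₁ = pair-up i a b σ
    τ₂ = pair-up i b a σ
    τ₁′ = pair-up i a b (at v (sw p) σ)
    τ₂′ = pair-up i b a (at v (sw p) σ)
    fτ₁ : f τ₁ ≡ a
    fτ₁ = is⇒≡ τ₁ (proj₁ (∧-true {is a τ₁} e))
    fτ₂ : f τ₂ ≡ b
    fτ₂ = is⇒≡ τ₂ (proj₂ (∧-true {is a τ₁} e))
    moved : ∀ a b x → f (pair-up i a b σ) ≡ x → manip (pair-up i a b σ) ≡ false → manip (pair-up i a b (at v (sw p) σ)) ≡ false →
      f (pair-up i a b (at v (sw p) σ)) ≡ x ⊎ Adjacent p ρ x (f (pair-up i a b (at v (sw p) σ)))
    moved a b x refl m m′ with edge (pair-up i a b σ) v p m (subst (λ τ → manip τ ≡ false) (pair-up-at a b σ i≢v) m′)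
    ... | inj₁ e = inj₁ (trans (cong f (pair-up-at a b σ i≢v)) (sym e))
    ... | inj₂ adj = inj₂ (subst₂ (λ ρ y → Adjacent p ρ (f (pair-up i a b σ)) y) lookup-v (cong f (sym (pair-up-at a b σ i≢v))) adj)
      where
      lookup-v : lookup (pair-up i a b σ) v ≡ ρ
      lookup-v = trans (lookup∘updateAt′ v i (i≢v ∘ sym) (at i (lift b) σ)) (lookup∘updateAt′ v i (i≢v ∘ sym) σ)
    not-ab : ¬ Adjacent p ρ a b
    not-ab adj = true≢false (proj₁ (Adjacent-above ρ adj)) (trans unchanged (proj₂ (Adjacent-above ρ adj)))
    not-ba : ¬ Adjacent p ρ b a
    not-ba adj = true≢false (above-total (sw p ρ) (a≢b ∘ sym) (proj₂ (Adjacent-above ρ adj)))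
      (trans (sym unchanged) (above-asym ρ (proj₁ (Adjacent-above ρ adj))))
    both : f τ₁′ ≡ a × f τ₂′ ≡ b
    both with pair-outcomes i (at v (sw p) σ) a≢b m₁′ m₂′
    ... | inj₂ r = r
    ... | inj₁ same with moved a b a fτ₁ m₁ m₁′ | moved b a b fτ₂ m₂ m₂′
    ...   | inj₁ x | inj₁ y = x , y
    ...   | inj₁ x | inj₂ y = ⊥-elim (not-ba (subst (Adjacent p ρ b) (trans (sym same) x) y))
    ...   | inj₂ x | inj₁ y = ⊥-elim (not-ab (subst (Adjacent p ρ a) (trans same y) x))
    ...   | inj₂ (x , _) | inj₂ (y , _) = ⊥-elim (a≢b (pos-injective ρ (toℕ-injective (trans x (sym y)))))

  is-pair-up-sw : ∀ i a b p (σ : Profile k n) → manip (pair-up i a b σ) ≡ false → manip (pair-up i a b (at i (sw p) σ)) ≡ false →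
    is a (pair-up i a b σ) ≡ is a (pair-up i a b (at i (sw p) σ))
  is-pair-up-sw i a b p σ m₁ m₂ with at-lift-sw i b p σ
  ... | inj₁ e = cong (λ τ → is a (at i (lift a) τ)) (sym e)
  ... | inj₂ (q , e) = trans (raised-sw i a (suc q) (at i (lift b) σ) m₁
          (subst (λ τ → manip (at i (lift a) τ) ≡ false) e m₂)) (cong (λ τ → is a (at i (lift a) τ)) (sym e))

  pivotal-slack : ℕ
  pivotal-slack = k * k * m + (k * k * m + (1 * (k * k) * m + 1 * (k * k) * m))

  four-bad : ∀ P {c₁ c₂ c₃ c₄ U₁ U₂ U₃ U₄} → Expands Ω c₁ U₁ → Expands Ω c₂ U₂ → Expands Ω c₃ U₃ → Expands Ω c₄ U₄ →
    (∀ σ → P σ ≡ true → manip (U₁ σ) ≡ false → manip (U₂ σ) ≡ false → manip (U₃ σ) ≡ false → manip (U₄ σ) ≡ false → ⊥) →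
    # Ω P ≤ c₁ * m + (c₂ * m + (c₃ * m + c₄ * m))
  four-bad P {c₁} {c₂} {c₃} {c₄} {U₁} {U₂} {U₃} {U₄} u₁ u₂ u₃ u₄ h = begin
    # Ω P ≤⟨ #-≤ Ω P (λ σ e → unless (manip (U₁ σ)) λ e₁ → unless (manip (U₂ σ)) λ e₂ → unless (manip (U₃ σ)) λ e₃ →
      surely (manip (U₄ σ)) λ e₄ → h σ e e₁ e₂ e₃ e₄) ⟩
    ∑ Ω (λ σ → 𝟙 (manip (U₁ σ)) + (𝟙 (manip (U₂ σ)) + (𝟙 (manip (U₃ σ)) + 𝟙 (manip (U₄ σ)))))
      ≡⟨ trans (∑-+ Ω _ _) (cong (# Ω (manip ∘ U₁) +_) (trans (∑-+ Ω _ _) (cong (# Ω (manip ∘ U₂) +_) (∑-+ Ω _ _)))) ⟩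
    # Ω (manip ∘ U₁) + (# Ω (manip ∘ U₂) + (# Ω (manip ∘ U₃) + # Ω (manip ∘ U₄)))
      ≤⟨ +-mono-≤ (manip-count u₁) (+-mono-≤ (manip-count u₂) (+-mono-≤ (manip-count u₃) (manip-count u₄))) ⟩
    c₁ * m + (c₂ * m + (c₃ * m + c₄ * m)) ∎
    where open ≤-Reasoning

  pivotal-invariant : ∀ {i a b} → a ≢ b → ∀ v p → # Ω (λ σ → (pivotal i a b σ xor pivotal i a b (at v (sw p) σ)) ∧
    not (above (lookup σ v) a b xor above (sw p (lookup σ v)) a b)) ≤ pivotal-slack
  pivotal-invariant {i} {a} {b} a≢b v p = four-bad _ (expands-pair-up i a b) (expands-pair-up i b a)
    (expands-∘ (expands-pair-up i a b) (expands-step v p)) (expands-∘ (expands-pair-up i b a) (expands-step v p))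
    λ σ e m₁ m₂ m₁′ m₂′ → let x , u = ∧-true {pivotal i a b σ xor pivotal i a b (at v (sw p) σ)} e in
      xor-≡ x (same σ (xor-false (not-true u)) (m₁ , m₂ , m₁′ , m₂′) (i Fin.≟ v))
    where
    bool-ext : ∀ {s t : Bool} → (s ≡ true → t ≡ true) → (t ≡ true → s ≡ true) → s ≡ t
    bool-ext {true}  {t}     g h = sym (g refl)
    bool-ext {false} {true}  g h = h refl
    bool-ext {false} {false} g h = refl
    same : ∀ σ → above (lookup σ v) a b ≡ above (sw p (lookup σ v)) a b → Clean i a b v p σ → Dec (i ≡ v) →
      pivotal i a b σ ≡ pivotal i a b (at v (sw p) σ)
    same σ u (m₁ , m₂ , m₁′ , m₂′) (yes refl) = cong₂ _∧_ (is-pair-up-sw i a b p σ m₁ m₁′) (is-pair-up-sw i b a p σ m₂ m₂′)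
    same σ u c@(m₁ , m₂ , m₁′ , m₂′) (no i≢v) = bool-ext (pivotal-other σ i≢v a≢b u c)
      -- Swapping back is the same swap, so the converse is the same implication read from the other
      -- end.
      λ e → subst (λ τ → pivotal i a b τ ≡ true) (at-sw-involutive v p σ) (pivotal-other (at v (sw p) σ) i≢v a≢b
        (trans (cong (λ ρ → above ρ a b) (lookup-at v σ)) (trans (sym u) (sym (trans
          (cong (λ ρ → above (sw p ρ) a b) (lookup-at v σ)) (cong (λ ρ → above ρ a b) (sw-involutive p (lookup σ v)))))))
        (m₁′ , m₂′ , subst (λ τ → manip (pair-up i a b τ) ≡ false) (sym (at-sw-involutive v p σ)) m₁ ,
          subst (λ τ → manip (pair-up i b a τ) ≡ false) (sym (at-sw-involutive v p σ)) m₂) e)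

  pivotal-error : ℕ
  pivotal-error = n * (k * k) * pivotal-slack

  abstract
   pivotal-signs : ∀ i {a b} → a ≢ b → Σ (Vec Bool n → Bool) λ g → # Ω (λ σ → pivotal i a b σ xor g (signs a b σ)) ≤ pivotal-error
   pivotal-signs i {a} {b} a≢b = sign-determined a≢b (pivotal i a b) pivotal-slack (pivotal-invariant a≢b)

  clash-bound : ℕ
  clash-bound = k * pivotal-error + (k * (k * k * (k * m + 1 * k * m)) + (k * pivotal-error + k * (k * k * (k * m + 1 * k * m))))

  module Clash {i j : Fin n} (i≢j : i ≢ j) {a b c d : Fin k} (a≢b : a ≢ b) (c≢d : c ≢ d) (diff : Different a b c d) where

    g = proj₁ (pivotal-signs i a≢b)
    h = proj₁ (pivotal-signs j c≢d)

    -- Raising `y` on ballot j leaves the votes on `a` and `b` alone, so i remains pivotal and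
    -- raising `x` makes `x` win; likewise with the roles exchanged. Since i ≠ j, both routes end in
    -- the same profile. `unraised-lift` removes the detour through `x′` and `y′` that pivotality
    -- contains.
    clash : ∀ {x x′ y y′} → (x ≡ a × x′ ≡ b) ⊎ (x ≡ b × x′ ≡ a) → (y ≡ c × y′ ≡ d) ⊎ (y ≡ d × y′ ≡ c) →
      x ≢ c → x ≢ d → y ≢ a → y ≢ b → # Ω (λ σ → g (signs a b σ) ∧ h (signs c d σ)) ≤ clash-bound
    clash {x} {x′} {y} {y′} xx yy x≢c x≢d y≢a y≢b = begin
      # Ω (λ σ → g (signs a b σ) ∧ h (signs c d σ)) ≤⟨ #-≤ Ω _ pointwise ⟩
      ∑ Ω (λ σ → 𝟙 (P (at j (lift y) σ)) + (𝟙 (P′ (at j (lift y) σ)) + (𝟙 (Q (at i (lift x) σ)) + 𝟙 (Q′ (at i (lift x) σ)))))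
        ≡⟨ trans (∑-+ Ω _ _) (cong (# Ω (P ∘ at j (lift y)) +_) (trans (∑-+ Ω _ _) (cong (# Ω (P′ ∘ at j (lift y)) +_) (∑-+ Ω _ _)))) ⟩
      # Ω (P ∘ at j (lift y)) + (# Ω (P′ ∘ at j (lift y)) + (# Ω (Q ∘ at i (lift x)) + # Ω (Q′ ∘ at i (lift x))))
        ≤⟨ +-mono-≤ (via j y P (proj₂ (pivotal-signs i a≢b))) (+-mono-≤ (via j y P′ (unraised-lift i x x′))
            (+-mono-≤ (via i x Q (proj₂ (pivotal-signs j c≢d))) (via i x Q′ (unraised-lift j y y′)))) ⟩
      clash-bound ∎
      where
      open ≤-Reasoning
      P P′ Q Q′ : Profile k n → Bool
      P  σ = pivotal i a b σ xor g (signs a b σ)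
      P′ σ = not (raised i x σ) ∧ not (not (raised i x (at i (lift x′) σ)))
      Q  σ = pivotal j c d σ xor h (signs c d σ)
      Q′ σ = not (raised j y σ) ∧ not (not (raised j y (at j (lift y′) σ)))
      via : ∀ v z (C : Profile k n → Bool) {e} → # Ω C ≤ e → # Ω (C ∘ at v (lift z)) ≤ k * e
      via v z C h = ≤-trans (lift-density v z C) (*-monoʳ-≤ k h)
      winner : ∀ {z z′ u w : Fin k} v τ → (z ≡ u × z′ ≡ w) ⊎ (z ≡ w × z′ ≡ u) → pivotal v u w τ ≡ true → raised v z (at v (lift z′) τ) ≡ true
      winner {u = u} {w} v τ (inj₁ (refl , refl)) e = proj₁ (∧-true {raised v u (at v (lift w) τ)} e)
      winner {u = u} {w} v τ (inj₂ (refl , refl)) e = proj₂ (∧-true {raised v u (at v (lift w) τ)} e)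
      back : ∀ {s t} → not s ∧ not (not t) ≡ false → t ≡ true → s ≡ true
      back {true}  e refl = refl
      back {false} () refl
      x≢y : x ≢ y
      x≢y x≡y = go xx
        where
        go : (x ≡ a × x′ ≡ b) ⊎ (x ≡ b × x′ ≡ a) → ⊥
        go (inj₁ (e , _)) = y≢a (trans (sym x≡y) e)
        go (inj₂ (e , _)) = y≢b (trans (sym x≡y) e)
      pointwise : ∀ σ → g (signs a b σ) ∧ h (signs c d σ) ≡ true →
        1 ≤ 𝟙 (P (at j (lift y) σ)) + (𝟙 (P′ (at j (lift y) σ)) + (𝟙 (Q (at i (lift x) σ)) + 𝟙 (Q′ (at i (lift x) σ))))
      pointwise σ e = unless (P σ*) λ p → unless (P′ σ*) λ p′ → unless (Q σ°) λ q → surely (Q′ σ°) λ q′ → x≢y (trans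
        (sym (is⇒≡ _ (back p′ (winner i σ* xx (trans (xor-false p) (trans (cong g (signs-at j σ λ ρ → above-lift y ρ (y≢a ∘ sym) (y≢b ∘ sym))) gσ))))))
        (trans (cong f (updateAt-commutes i j i≢j σ))
          (is⇒≡ _ (back q′ (winner j σ° yy (trans (xor-false q) (trans (cong h (signs-at i σ λ ρ → above-lift x ρ (x≢c ∘ sym) (x≢d ∘ sym))) hσ)))))))
        where
        σ* = at j (lift y) σ
        σ° = at i (lift x) σ
        gσ = proj₁ (∧-true {g (signs a b σ)} e)
        hσ = proj₂ (∧-true {g (signs a b σ)} e)

    clash-count : # Ω (λ σ → g (signs a b σ) ∧ h (signs c d σ)) ≤ clash-bound
    clash-count with a Fin.≟ c | a Fin.≟ d | b Fin.≟ c | b Fin.≟ d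
    ... | yes refl | yes refl | _ | _ = ⊥-elim (c≢d refl)
    ... | yes refl | no a≢d | yes refl | _ = ⊥-elim (a≢b refl)
    ... | yes refl | no a≢d | no b≢c | yes refl = ⊥-elim (proj₁ diff (refl , refl))
    ... | yes refl | no a≢d | no b≢c | no b≢d = clash (inj₂ (refl , refl)) (inj₂ (refl , refl)) b≢c b≢d (a≢d ∘ sym) (b≢d ∘ sym)
    ... | no a≢c | yes refl | yes refl | _ = ⊥-elim (proj₂ diff (refl , refl))
    ... | no a≢c | yes refl | no b≢c | yes refl = ⊥-elim (a≢b refl)
    ... | no a≢c | yes refl | no b≢c | no b≢d = clash (inj₂ (refl , refl)) (inj₁ (refl , refl)) b≢c b≢d (a≢c ∘ sym) (b≢c ∘ sym)
    ... | no a≢c | no a≢d | yes refl | _ = clash (inj₁ (refl , refl)) (inj₂ (refl , refl)) a≢c a≢d (a≢d ∘ sym) (c≢d ∘ sym)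
    ... | no a≢c | no a≢d | no b≢c | _ = clash (inj₁ (refl , refl)) (inj₁ (refl , refl)) a≢c a≢d (a≢c ∘ sym) (b≢c ∘ sym)

    private
      N = length Ω
      Γ = # Ω λ σ → g (signs a b σ)
      Η = # Ω λ σ → h (signs c d σ)

    -- `∑-signs` turns counts on the cube into counts of profiles; the four factors `2 ^ n` this
    -- takes absorb `16 ^ n`.
    joint : square (Γ * Η) ≤ N * N * N * clash-bound
    joint = *-cancelˡ-≤ (16 ^ n * N) {{m*n≢0 (16 ^ n) N {{m^n≢0 16 n}} {{ℕ.>-nonZero (profiles-nonempty k n)}}}} (begin
      16 ^ n * N * square (Γ * Η)  ≡⟨ cong (λ z → z * N * square (Γ * Η)) (16^ n) ⟩
      2 ^ n * 2 ^ n * (2 ^ n * 2 ^ n) * N * square (Γ * Η)  ≡⟨ e₁ (2 ^ n) N Γ Η ⟩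
      N * square ((2 ^ n * Γ) * (2 ^ n * Η))  ≡⟨ cong₂ (λ p q → N * square (p * q)) (∑-signs a≢b n (𝟙 ∘ g)) (∑-signs c≢d n (𝟙 ∘ h)) ⟩
      N * square ((N * # (cube n) g) * (N * # (cube n) h))  ≡⟨ e₂ N (# (cube n) g) (# (cube n) h) ⟩
      N * N * (N * N) * (N * square (# (cube n) g * # (cube n) h))  ≤⟨ *-monoʳ-≤ (N * N * (N * N)) (reverse-hypercontractivity a≢b c≢d diff g h) ⟩
      N * N * (N * N) * (16 ^ n * # Ω (λ σ → g (signs a b σ) ∧ h (signs c d σ)))
        ≤⟨ *-monoʳ-≤ (N * N * (N * N)) (*-monoʳ-≤ (16 ^ n) clash-count) ⟩
      N * N * (N * N) * (16 ^ n * clash-bound)  ≡⟨ e₃ N (16 ^ n) clash-bound ⟩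
      16 ^ n * N * (N * N * N * clash-bound)  ∎)
      where
      open ≤-Reasoning
      16^ : ∀ n → 16 ^ n ≡ 2 ^ n * 2 ^ n * (2 ^ n * 2 ^ n)
      16^ zero    = refl
      16^ (suc n) = trans (cong (16 *_) (16^ n)) (eq (2 ^ n))
        where
        eq : ∀ t → 16 * (t * t * (t * t)) ≡ 2 * t * (2 * t) * (2 * t * (2 * t))
        eq = solve-∀
      e₁ : ∀ t N x y → t * t * (t * t) * N * ((x * y) * (x * y)) ≡ N * (((t * x) * (t * y)) * ((t * x) * (t * y)))
      e₁ = solve-∀
      e₂ : ∀ N x y → N * (((N * x) * (N * y)) * ((N * x) * (N * y))) ≡ N * N * (N * N) * (N * ((x * y) * (x * y)))
      e₂ = solve-∀
      e₃ : ∀ N s z → N * N * (N * N) * (s * z) ≡ s * N * (N * N * N * z)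
      e₃ = solve-∀

    recover : ∀ (C D : Profile k n → Bool) → # Ω C ≤ # Ω D + # Ω (λ σ → C σ xor D σ)
    recover C D = ≤-trans (∑-mono Ω λ σ → go (C σ) (D σ)) (≤-reflexive (∑-+ Ω _ _))
      where
      go : ∀ s t → 𝟙 s ≤ 𝟙 t + 𝟙 (s xor t)
      go true  true  = s≤s z≤n
      go true  false = s≤s z≤n
      go false t     = z≤n

    -- μ is the smaller of the two counts, so μ⁴ is at most the squared product. `pivotal-error`
    -- pays for replacing pivotality by a function of the votes.
    min-pivotal : ∀ e → e ≤ # Ω (pivotal i a b) → e ≤ # Ω (pivotal j c d) →
      ∃[ μ ] e ≤ μ + pivotal-error × square (square μ) ≤ N * N * N * clash-bound
    min-pivotal e p q with ≤-total Γ Η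
    ... | inj₁ l = Γ , ≤-trans p (≤-trans (recover (pivotal i a b) (g ∘ signs a b)) (+-monoʳ-≤ Γ (proj₂ (pivotal-signs i a≢b)))) ,
          ≤-trans (*-mono-≤ (*-monoʳ-≤ Γ l) (*-monoʳ-≤ Γ l)) joint
    ... | inj₂ l = Η , ≤-trans q (≤-trans (recover (pivotal j c d) (h ∘ signs c d)) (+-monoʳ-≤ Η (proj₂ (pivotal-signs j c≢d)))) ,
          ≤-trans (*-mono-≤ (*-monoˡ-≤ Η l) (*-monoˡ-≤ Η l)) joint

top-exists : ∀ {H : Subset k} → Nonempty H → ∀ ρ → ∃[ a ] IsTop H ρ a
top-exists {k} {H} (h , h∈H) ρ with ¬∀⟶∃¬-smallest k (λ p → ¬ (lookup (order ρ) p ∈ₛ H)) (λ p → ¬? (lookup (order ρ) p ∈? H))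
    (λ none → none (pos ρ h) (subst (_∈ₛ H) (sym (lookup-pos ρ h)) h∈H))
... | i , ¬¬i∈H , smaller = lookup (order ρ) i , decidable-stable (lookup (order ρ) i ∈? H) ¬¬i∈H , highest
  where
  highest : ∀ b → b ∈ₛ H → b ≢ lookup (order ρ) i → lookup (order ρ) i >[ ρ ] b
  highest b b∈H b≢ with Fin.<-cmp i (pos ρ b)
  ... | tri< l _ _ = i , pos ρ b , l , refl , lookup-pos ρ b
  ... | tri≈ _ e _ = ⊥-elim (b≢ (trans (sym (lookup-pos ρ b)) (cong (lookup (order ρ)) (sym e))))
  ... | tri> _ _ l = ⊥-elim (smaller j (subst (λ q → lookup (order ρ) q ∈ₛ H) (sym j≡) (subst (_∈ₛ H) (sym (lookup-pos ρ b)) b∈H)))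
    where
    j : Fin (toℕ i)
    j = Fin.fromℕ< l
    j≡ : Fin.inject {i = i} j ≡ pos ρ b
    j≡ = toℕ-injective (trans (toℕ-inject j) (toℕ-fromℕ< l))

some-profile : Profile k n
some-profile = Vec.replicate _ identity

-- A constant does not take two values; it belongs to `NONMANIP` as the top of a singleton, for any
-- voter.
constant-nonmanip : ∀ (g : SCF k n) → Fin n → ∀ a → (∀ σ → g σ ≡ a) → NONMANIP g
constant-nonmanip g i a h = inj₁ (i , ⁅ a ⁆ , (a , x∈⁅x⁆ a) , λ σ → subst (_∈ₛ ⁅ a ⁆) (sym (h σ)) (x∈⁅x⁆ a) ,
  λ b b∈ b≢ → ⊥-elim (b≢ (trans (x∈⁅y⁆⇒x≡y a b∈) (sym (h σ)))))

-- Influence confined to one voter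

module Cases {k n : ℕ} (f : SCF k n) (θ : ℕ) where

  open Local f
  open PivotalPairs f

  private
    Ω = profiles k n

  Rare : Fin n → Fin k → Fin k → Set
  Rare v x y = # Ω (pivotal v x y) ≤ θ

  boundary : ℕ
  boundary = k * (k * (θ + slack))

  -- At a change from x to y the moving voter is pivotal for x and y, up to `slack`. `Q` selects the
  -- changes concerned, and the union runs over k² pairs.
  transitions : ∀ v p (Q : Fin k → Fin k → Bool) → (∀ x y → Q x y ≡ true → x ≢ y × Rare v x y) →
    # Ω (λ σ → Q (f σ) (f (at v (sw p) σ))) ≤ boundary
  transitions v p Q h = begin
    # Ω (λ σ → Q (f σ) (f (at v (sw p) σ)))  ≤⟨ ∑-mono Ω located ⟩
    ∑ Ω (λ σ → ∑ (allFin k) λ x → ∑ (allFin k) λ y → 𝟙 (R x y σ))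
      ≡⟨ trans (∑-swap Ω (allFin k) _) (∑-cong (allFin k) λ x → ∑-swap Ω (allFin k) _) ⟩
    ∑ (allFin k) (λ x → ∑ (allFin k) λ y → # Ω (R x y))
      ≤⟨ ∑-≤-const (allFin k) _ (λ x → ∑-≤-const (allFin k) (θ + slack) (rare x)) ⟩
    length (allFin k) * (length (allFin k) * (θ + slack))  ≡⟨ cong (λ l → l * (l * (θ + slack))) (length-allFin k) ⟩
    boundary  ∎
    where
    open ≤-Reasoning
    R : Fin k → Fin k → Profile k n → Bool
    R x y σ = Q x y ∧ (is x σ ∧ is y (at v (sw p) σ))
    located : ∀ σ → 𝟙 (Q (f σ) (f (at v (sw p) σ))) ≤ ∑ (allFin k) λ x → ∑ (allFin k) λ y → 𝟙 (R x y σ)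
    located σ = ≤-trans (≤-reflexive (cong 𝟙 (sym found)))
      (≤-trans (∑-∈ (λ y → 𝟙 (R (f σ) y σ)) (∈-allFin (f (at v (sw p) σ))))
        (∑-∈ (λ x → ∑ (allFin k) λ y → 𝟙 (R x y σ)) (∈-allFin (f σ))))
      where
      found : R (f σ) (f (at v (sw p) σ)) σ ≡ Q (f σ) (f (at v (sw p) σ))
      found rewrite ≡⇒is σ refl | ≡⇒is (at v (sw p) σ) refl = ∧-identityʳ _
    rare : ∀ x y → # Ω (R x y) ≤ θ + slack
    rare x y with Q x y in e
    ... | true  = ≤-trans (boundary-pivotal v p (proj₁ (h x y e))) (+-monoˡ-≤ slack (proj₂ (h x y e)))
    ... | false = ≤-trans (≤-reflexive (∑-zero Ω)) z≤n

  union : ∀ (C : Fin k → Profile k n → Bool) e → (∀ x → # Ω (C x) ≤ e) → ∑ Ω (λ σ → ∑ (allFin k) λ x → 𝟙 (C x σ)) ≤ k * e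
  union C e h = ≤-trans (≤-reflexive (∑-swap Ω (allFin k) _)) (≤-trans (∑-≤-const (allFin k) e h)
    (≤-reflexive (cong (_* e) (length-allFin k))))

  ≢-bool : Fin k → Fin k → Bool
  ≢-bool x y = not (does (x Fin.≟ y))

  ≢-bool⇒≢ : ∀ x y → ≢-bool x y ≡ true → x ≢ y
  ≢-bool⇒≢ x y e h with x Fin.≟ y
  ... | no ¬h = ¬h h

  ≢⇒≢-bool : ∀ {x y} → x ≢ y → ≢-bool x y ≡ true
  ≢⇒≢-bool {x} {y} ne = cong not (dec-false (x Fin.≟ y) ne)

  is-xor⇒≢ : ∀ c σ τ → is c σ xor is c τ ≡ true → f σ ≢ f τ × (f σ ≡ c ⊎ f τ ≡ c)
  is-xor⇒≢ c σ τ e with f σ Fin.≟ c | f τ Fin.≟ c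
  ... | yes p | no q = (λ r → q (trans (sym r) p)) , inj₁ p
  ... | no p | yes q = (λ r → p (trans r q)) , inj₂ q

  change-error stable-error win-error dictator-error : ℕ
  change-error = k * boundary + (k * m + 1 * k * m)
  stable-error = n * (k * k) * change-error
  win-error = k * k * (1 * m + 1 * m)
  dictator-error = k * (stable-error + win-error) + k * (k * (win-error + stable-error))

  -- Here f is close to the top, for voter i, of the set of alternatives that i can enforce.
  module OneVoter (i : Fin n) (rare : ∀ v → v ≢ i → ∀ x y → x ≢ y → Rare v x y) where

    -- Swaps on ballot i are overridden by raising `b`; swaps of any other voter rarely change the
    -- outcome at all, and the lift multiplies their number by at most k.
    raised-change : ∀ b v p → # Ω (λ σ → raised i b σ xor raised i b (at v (sw p) σ)) ≤ change-error
    raised-change b v p = go (v Fin.≟ i)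
      where
      go : Dec (v ≡ i) → # Ω (λ σ → raised i b σ xor raised i b (at v (sw p) σ)) ≤ change-error
      go (yes refl) = ≤-trans (raised-invariant i b p) (m≤n+m _ (k * boundary))
      go (no v≢i) = ≤-trans (≤-trans (#-≤ Ω _ λ σ e → changed σ (proj₁ (is-xor⇒≢ b _ _
          (subst (λ τ → is b (at i (lift b) σ) xor is b τ ≡ true) (updateAt-commutes i v (v≢i ∘ sym) σ) e))))
          (≤-trans (lift-density i b (λ σ → ≢-bool (f σ) (f (at v (sw p) σ)))) (*-monoʳ-≤ k
            (transitions v p ≢-bool λ x y e → ≢-bool⇒≢ x y e , rare v v≢i x y (≢-bool⇒≢ x y e))))) (m≤m+n (k * boundary) _)
        where
        changed : ∀ σ → f (at i (lift b) σ) ≢ f (at v (sw p) (at i (lift b) σ)) →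
          1 ≤ 𝟙 (≢-bool (f (at i (lift b) σ)) (f (at v (sw p) (at i (lift b) σ))))
        changed σ ne = ≤-reflexive (cong 𝟙 (sym (≢⇒≢-bool ne)))

    enforced : Fin k → Bool
    enforced b = does (# Ω (not ∘ raised i b) ≤? stable-error)

    enforced⇒ : ∀ b → enforced b ≡ true → # Ω (not ∘ raised i b) ≤ stable-error
    enforced⇒ b = does-true (# Ω (not ∘ raised i b) ≤? stable-error)

    rarely-wins : ∀ b → enforced b ≡ false → # Ω (is b) ≤ stable-error + win-error
    rarely-wins b e = raised-or (zero-one (raised i b) change-error (raised-change b))
     where
     raised-or : # Ω (raised i b) ≤ stable-error ⊎ # Ω (not ∘ raised i b) ≤ stable-error → # Ω (is b) ≤ stable-error + win-error
     raised-or (inj₂ h) = ⊥-elim (true≢false (dec-true (# Ω (not ∘ raised i b) ≤? stable-error) h) e)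
     raised-or (inj₁ h) = begin
        # Ω (is b)  ≤⟨ ∑-mono Ω (λ σ → go (is b σ) (raised i b σ)) ⟩
        ∑ Ω (λ σ → 𝟙 (raised i b σ) + 𝟙 (is b σ ∧ not (raised i b σ)))  ≡⟨ ∑-+ Ω _ _ ⟩
        # Ω (raised i b) + # Ω (λ σ → is b σ ∧ not (raised i b σ))  ≤⟨ +-mono-≤ h (raising-winner i b) ⟩
        stable-error + win-error  ∎
        where
        open ≤-Reasoning
        go : ∀ s t → 𝟙 s ≤ 𝟙 t + 𝟙 (s ∧ not t)
        go true  true  = s≤s z≤n
        go true  false = s≤s z≤n
        go false t     = z≤n

    worse-wins : Fin k → Fin k → Profile k n → Bool
    worse-wins a b σ = above (lookup σ i) a b ∧ is b σ

    -- `b` is below `a` from the start, so raising `a` never exchanges the two and `b` goes on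
    -- winning. In the end `a` is on top and `b` wins, which is rare for an enforced `a`.
    rarely-worse : ∀ a b → enforced a ≡ true → # Ω (worse-wins a b) ≤ win-error + stable-error
    rarely-worse a b e = begin
      # Ω (worse-wins a b)  ≤⟨ #-≤ Ω _ pointwise ⟩
      ∑ Ω (λ σ → 𝟙 (worse-wins a b σ ∧ not (worse-wins a b (at i (lift a) σ))) + 𝟙 (not (raised i a σ)))  ≡⟨ ∑-+ Ω _ _ ⟩
      # Ω (λ σ → worse-wins a b σ ∧ not (worse-wins a b (at i (lift a) σ))) + # Ω (not ∘ raised i a)
        ≤⟨ +-mono-≤ (lift-loss i a (worse-wins a b) _ λ p → two-bad _ expands-id (expands-step i p) (kept p)) (enforced⇒ a e) ⟩
      win-error + stable-error ∎
      where
      open ≤-Reasoning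
      a≢b : ∀ σ → worse-wins a b σ ≡ true → a ≢ b
      a≢b σ w refl = true≢false (proj₁ (∧-true {above (lookup σ i) a a} w)) (above-irrefl (lookup σ i) a)
      pointwise : ∀ σ → worse-wins a b σ ≡ true →
        1 ≤ 𝟙 (worse-wins a b σ ∧ not (worse-wins a b (at i (lift a) σ))) + 𝟙 (not (raised i a σ))
      pointwise σ w = unless (worse-wins a b σ ∧ not (worse-wins a b (at i (lift a) σ))) λ q →
        ≤-reflexive (cong (𝟙 ∘ not) (sym (≢⇒is (at i (lift a) σ) λ r → a≢b σ w (trans (sym r)
          (is⇒≡ (at i (lift a) σ) (proj₂ (∧-true {above (lookup (at i (lift a) σ) i) a b} (imp q w))))))))
      kept : ∀ p σ → has-pos i a (suc p) σ ∧ (worse-wins a b σ ∧ not (worse-wins a b (at i (sw p) σ))) ≡ true →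
        manip σ ≡ false → manip (at i (sw p) σ) ≡ false → ⊥
      kept p σ e m₁ m₂ = true≢false (true-∧ (subst (λ ρ → above ρ a b ≡ true) (sym (lookup-at i σ)) still-above)
          (≡⇒is (at i (sw p) σ) still-b)) (not-true (proj₂ (∧-true {worse-wins a b σ} (proj₂ parts))))
        where
        ρ = lookup σ i
        parts = ∧-true {has-pos i a (suc p) σ} e
        pos-a : toℕ (pos ρ a) ≡ suc p
        pos-a = does-true (toℕ (pos ρ a) ℕ.≟ suc p) (proj₁ parts)
        w = ∧-true {above ρ a b} (proj₁ (∧-true {worse-wins a b σ} (proj₂ parts)))
        still-above : above (sw p ρ) a b ≡ true
        still-above with above-sw p ρ a b (proj₁ w)
        ... | inj₁ r = r
        ... | inj₂ (q , _) = ⊥-elim (1+n≢n (trans (sym pos-a) q))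
        still-b : f (at i (sw p) σ) ≡ b
        still-b with edge σ i p m₁ m₂
        ... | inj₁ r = trans (sym r) (is⇒≡ σ (proj₂ w))
        -- The loser at an edge stands at position p, whereas `b` stands below `a`, which is at p +
        -- 1.
        ... | inj₂ (q , _) = ⊥-elim (<-irrefl refl (≤-trans (s≤s (n≤1+n p)) (subst (λ z → suc (suc p) ≤ z)
                (trans (cong (λ c → toℕ (pos ρ c)) (sym (is⇒≡ σ (proj₂ w)))) q)
                (subst (λ z → suc z ≤ toℕ (pos ρ b)) pos-a (above⇒< ρ a b (proj₁ w))))))

    H : Subset k
    H = Vec.tabulate enforced

    H∋ : ∀ b → b ∈ₛ H → enforced b ≡ true
    H∋ b h = trans (sym (lookup∘tabulate enforced b)) ([]=⇒lookup h)

    ∋H : ∀ b → enforced b ≡ true → b ∈ₛ H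
    ∋H b e = lookup⇒[]= b H (trans (lookup∘tabulate enforced b) e)

    -- Either the winner is not enforced, or an enforced alternative ranked above it was passed
    -- over. `g` only has to be right where the winner is enforced, so an empty `H` is covered as
    -- well.
    distance : ∀ g → (∀ σ → enforced (f σ) ≡ true → IsTop H (lookup σ i) (g σ)) → # Ω (differ g) ≤ dictator-error
    distance g top = begin
      # Ω (differ g) ≤⟨ #-≤ Ω (differ g) pointwise ⟩
      ∑ Ω (λ σ → ∑ (allFin k) (λ b → 𝟙 (P b σ)) + ∑ (allFin k) (λ a → ∑ (allFin k) λ b → 𝟙 (Q a b σ)))
        ≡⟨ ∑-+ Ω _ _ ⟩
      ∑ Ω (λ σ → ∑ (allFin k) (λ b → 𝟙 (P b σ))) + ∑ Ω (λ σ → ∑ (allFin k) (λ a → ∑ (allFin k) λ b → 𝟙 (Q a b σ)))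
        ≤⟨ +-mono-≤ (union P _ P-bound) (≤-trans (≤-reflexive (∑-swap Ω (allFin k) _)) (≤-trans (∑-≤-const (allFin k) _
             (λ a → union (Q a) _ (Q-bound a))) (≤-reflexive (cong (_* (k * (win-error + stable-error))) (length-allFin k))))) ⟩
      dictator-error ∎
      where
      open ≤-Reasoning
      P : Fin k → Profile k n → Bool
      P b σ = not (enforced b) ∧ is b σ
      Q : Fin k → Fin k → Profile k n → Bool
      Q a b σ = enforced a ∧ worse-wins a b σ
      P-bound : ∀ b → # Ω (P b) ≤ stable-error + win-error
      P-bound b with enforced b in e
      ... | false = rarely-wins b e
      ... | true  = ≤-trans (≤-reflexive (∑-zero Ω)) z≤n
      Q-bound : ∀ a b → # Ω (Q a b) ≤ win-error + stable-error
      Q-bound a b with enforced a in e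
      ... | true  = rarely-worse a b e
      ... | false = ≤-trans (≤-reflexive (∑-zero Ω)) z≤n
      pointwise : ∀ σ → differ g σ ≡ true → 1 ≤ ∑ (allFin k) (λ b → 𝟙 (P b σ)) + ∑ (allFin k) (λ a → ∑ (allFin k) λ b → 𝟙 (Q a b σ))
      pointwise σ ne with enforced (f σ) in e
      ... | false = ≤-trans (≤-trans (≤-reflexive (cong 𝟙 (sym (true-∧ (cong not e) (≡⇒is σ refl)))))
              (∑-∈ (λ b → 𝟙 (P b σ)) (∈-allFin (f σ)))) (m≤m+n _ _)
      ... | true  = ≤-trans (≤-trans (≤-trans (≤-reflexive (cong 𝟙 (sym (true-∧ (H∋ (g σ) (proj₁ t)) (true-∧
              (>⇒above (proj₂ t (f σ) (∋H (f σ) e) (differ⇒≢ g σ ne))) (≡⇒is σ refl))))))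
              (∑-∈ (λ b → 𝟙 (Q (g σ) b σ)) (∈-allFin (f σ)))) (∑-∈ (λ a → ∑ (allFin k) λ b → 𝟙 (Q a b σ)) (∈-allFin (g σ)))) (m≤n+m _ _)
        where t = top σ e

    near-dictator : Σ (SCF k n) λ g → NONMANIP g × # Ω (differ g) ≤ dictator-error
    near-dictator = go (nonempty? H)
      where
      go : Dec (Nonempty H) → Σ (SCF k n) λ g → NONMANIP g × # Ω (differ g) ≤ dictator-error
      go (yes ne) = g , inj₁ (i , H , ne , λ σ → proj₂ (top-exists ne (lookup σ i))) ,
          distance g (λ σ _ → proj₂ (top-exists ne (lookup σ i)))
        where
        g : SCF k n
        g σ = proj₁ (top-exists ne (lookup σ i))
      -- With nothing enforced the premise on `g` is vacuous and any constant is close; the value of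
      -- `f` at an arbitrary profile supplies an alternative.
      go (no empty) = (λ _ → a) , constant-nonmanip (λ _ → a) i a (λ _ → refl) ,
          distance (λ _ → a) λ σ e → ⊥-elim (empty (f σ , ∋H (f σ) e))
        where
        a : Fin k
        a = f some-profile

-- Monotone functions of the votes on one pair

signs-update : ∀ {a b : Fin k} (v : Fin n) {T} (σ : Profile k n) → signs a b (at v T σ) ≡ signs a b σ [ v ↦ above (T (lookup σ v)) a b ]
signs-update {a = a} {b} Fin.zero    {T} (ρ ∷ σ) = refl
signs-update {a = a} {b} (Fin.suc v) {T} (ρ ∷ σ) = cong (above ρ a b ∷_) (signs-update v σ)

signs-self : ∀ {a b : Fin k} (v : Fin n) (σ : Profile k n) → signs a b σ ≡ signs a b σ [ v ↦ above (lookup σ v) a b ]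
signs-self {a = a} {b} v σ = trans (cong (signs a b) (sym (updateAt-id v σ))) (signs-update v σ)

module _ {k n : ℕ} {a b : Fin k} (a≢b : a ≢ b) (i₀ : Fin n) (G : Vec Bool n → Bool)
  (monotone : ∀ i v → G (v [ i ↦ false ]) ≡ true → G (v [ i ↦ true ]) ≡ true) where

  choose : SCF k n
  choose σ = if G (signs a b σ) then a else b

  choose-a : ∀ σ → G (signs a b σ) ≡ true → choose σ ≡ a
  choose-a σ e = cong (if_then a else b) e

  choose-b : ∀ σ → G (signs a b σ) ≡ false → choose σ ≡ b
  choose-b σ e = cong (if_then a else b) e

  a⇒true : ∀ σ → choose σ ≡ a → G (signs a b σ) ≡ true
  a⇒true σ e with G (signs a b σ)
  ... | true  = refl
  ... | false = ⊥-elim (a≢b (sym e))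

  b⇒false : ∀ σ → choose σ ≡ b → G (signs a b σ) ≡ false
  b⇒false σ e with G (signs a b σ)
  ... | false = refl
  ... | true  = ⊥-elim (a≢b e)

  attains? : ∀ s → Dec (∃[ σ ] G (signs a b σ) ≡ s)
  attains? s = map′ (λ w → let σ , _ , e = find w in σ , e)
    (λ (σ , e) → lose (vecs-complete (images-complete identity) σ) e)
    (Any.any? (λ σ → G (signs a b σ) Bool.≟ s) (profiles k n))

  -- If `G` takes one value on all sign vectors of profiles, then `choose` is constant and enters
  -- through a singleton and voter `i₀`. Otherwise both values occur, and monotonicity of `G` forces
  -- the direction of the changed vote.
  choose-nonmanip : NONMANIP choose
  choose-nonmanip with attains? true | attains? false
  ... | no ¬t | _ = constant-nonmanip choose i₀ b λ σ → choose-b σ (¬-not (λ e → ¬t (σ , e)))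
  ... | yes _ | no ¬f = constant-nonmanip choose i₀ a λ σ → choose-a σ (not-¬′ σ)
    where
    not-¬′ : ∀ σ → G (signs a b σ) ≡ true
    not-¬′ σ with G (signs a b σ) in e
    ... | true  = refl
    ... | false = ⊥-elim (¬f (σ , e))
  ... | yes (σ₁ , e₁) | yes (σ₀ , e₀) = inj₂ (a , b , (a≢b , values , (σ₁ , choose-a σ₁ e₁) , (σ₀ , choose-b σ₀ e₀)) , mono)
    where
    values : ∀ σ → choose σ ≡ a ⊎ choose σ ≡ b
    values σ with G (signs a b σ)
    ... | true  = inj₁ refl
    ... | false = inj₂ refl
    mono : ∀ σ i τ → choose σ ≡ a → choose (σ Vec.[ i ]≔ τ) ≡ b → (a >[ lookup σ i ] b) × (b >[ τ ] a)
    mono σ i τ ea eb = above⇒> (lookup σ i) a b before , above⇒> τ b a (above-total τ a≢b after)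
      where
      s = signs a b σ
      old : G (s [ i ↦ above (lookup σ i) a b ]) ≡ true
      old = subst (λ t → G t ≡ true) (signs-self i σ) (a⇒true σ ea)
      new : G (s [ i ↦ above τ a b ]) ≡ false
      new = subst (λ t → G t ≡ false) (signs-update i {λ _ → τ} σ) (b⇒false (σ Vec.[ i ]≔ τ) eb)
      G-true : G (s [ i ↦ true ]) ≡ true
      G-true with above (lookup σ i) a b | old
      ... | true  | e = e
      ... | false | e = monotone i s e
      after : above τ a b ≡ false
      after with above τ a b | new
      ... | true  | e = ⊥-elim (true≢false G-true e)
      ... | false | e = refl
      before : above (lookup σ i) a b ≡ true
      before with above (lookup σ i) a b | old
      ... | true  | e = refl
      ... | false | e = ⊥-elim (true≢false e (subst (λ t → G (s [ i ↦ t ]) ≡ false) after new))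

-- Influence confined to one pair of alternatives

module PairCase {k n : ℕ} (f : SCF k n) (θ : ℕ) where

  open Local f
  open PivotalPairs f
  open Cases f θ

  private
    Ω = profiles k n

  Same : Fin k → Fin k → Fin k → Fin k → Set
  Same a b x y = (x ≡ a × y ≡ b) ⊎ (x ≡ b × y ≡ a)

  same? : ∀ a b x y → Dec (Same a b x y)
  same? a b x y = ((x Fin.≟ a) ×-dec (y Fin.≟ b)) ⊎-dec ((x Fin.≟ b) ×-dec (y Fin.≟ a))

  outsider-error sign-change sign-error violation-error pair-error : ℕ
  outsider-error = n * (k * k) * boundary
  sign-change = boundary + (m + m)
  sign-error = n * (k * k) * sign-change
  violation-error = k * k * sign-error + (k * k * sign-error + (k * k * m + k * k * m))
  pair-error = k * outsider-error + (sign-error + n * violation-error)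

  -- Here f is close to an increasing function of the votes on {a, b}.
  module OnePair (i₀ : Fin n) {a b : Fin k} (a≢b : a ≢ b)
    (rare : ∀ v x y → x ≢ y → ¬ Same a b x y → Rare v x y) where

    foreign : Fin k → Fin k → Bool
    foreign x y = ≢-bool x y ∧ not (does (same? a b x y))

    foreign⇒ : ∀ x y → foreign x y ≡ true → x ≢ y × ¬ Same a b x y
    foreign⇒ x y e = ≢-bool⇒≢ x y (proj₁ (∧-true {≢-bool x y} e)) ,
      λ s → true≢false (dec-true (same? a b x y) s) (not-true (proj₂ (∧-true {≢-bool x y} e)))

    ⇒foreign : ∀ {x y} → x ≢ y → ¬ Same a b x y → foreign x y ≡ true
    ⇒foreign {x} {y} ne ns = true-∧ (≢⇒≢-bool ne) (cong not (dec-false (same? a b x y) ns))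

    foreign-count : ∀ v p → # Ω (λ σ → foreign (f σ) (f (at v (sw p) σ))) ≤ boundary
    foreign-count v p = transitions v p foreign λ x y e → let ne , ns = foreign⇒ x y e in ne , rare v x y ne ns

    outsider : ∀ {c} → c ≢ a → c ≢ b → # Ω (is c) ≤ outsider-error ⊎ # Ω (not ∘ is c) ≤ outsider-error
    outsider {c} c≢a c≢b = zero-one (is c) boundary λ v p → ≤-trans
      (#-≤ Ω _ λ σ e → ≤-reflexive (cong 𝟙 (sym (crossing σ (at v (sw p) σ) (is-xor⇒≢ c σ (at v (sw p) σ) e))))) (foreign-count v p)
      where
      crossing : ∀ σ τ → f σ ≢ f τ × (f σ ≡ c ⊎ f τ ≡ c) → foreign (f σ) (f τ) ≡ true
      crossing σ τ (ne , inj₁ e) = ⇒foreign ne λ { (inj₁ (p , _)) → c≢a (trans (sym e) p) ; (inj₂ (p , _)) → c≢b (trans (sym e) p) }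
      crossing σ τ (ne , inj₂ e) = ⇒foreign ne λ { (inj₁ (_ , p)) → c≢b (trans (sym e) p) ; (inj₂ (_ , p)) → c≢a (trans (sym e) p) }

    -- A change between `a` and a third alternative is foreign, hence rare. A change between `a` and
    -- `b` is by `edge` a swap of these two, which the second factor of the event rules out.
    is-a-change : ∀ v p → # Ω (λ σ → (is a σ xor is a (at v (sw p) σ)) ∧
      not (above (lookup σ v) a b xor above (sw p (lookup σ v)) a b)) ≤ sign-change
    is-a-change v p = begin
      _ ≤⟨ #-≤ Ω _ (λ σ e → pointwise σ (∧-true {is a σ xor is a (at v (sw p) σ)} e)) ⟩
      ∑ Ω (λ σ → 𝟙 (foreign (f σ) (f (at v (sw p) σ))) + (𝟙 (manip σ) + 𝟙 (manip (at v (sw p) σ))))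
        ≡⟨ trans (∑-+ Ω _ _) (cong (# Ω (λ σ → foreign (f σ) (f (at v (sw p) σ))) +_) (∑-+ Ω _ _)) ⟩
      # Ω (λ σ → foreign (f σ) (f (at v (sw p) σ))) + (# Ω manip + # Ω (manip ∘ at v (sw p)))
        ≤⟨ +-mono-≤ (foreign-count v p) (+-mono-≤ (≤-reflexive (sym m≡)) (≤-trans (manip-count (expands-step v p)) (≤-reflexive (+-identityʳ m)))) ⟩
      sign-change ∎
      where
      open ≤-Reasoning
      pointwise : ∀ σ → (is a σ xor is a (at v (sw p) σ) ≡ true) × (not (above (lookup σ v) a b xor above (sw p (lookup σ v)) a b) ≡ true) →
        1 ≤ 𝟙 (foreign (f σ) (f (at v (sw p) σ))) + (𝟙 (manip σ) + 𝟙 (manip (at v (sw p) σ)))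
      pointwise σ (x , u) = unless (foreign (f σ) (f (at v (sw p) σ))) λ nf → unless (manip σ) λ m₁ →
        surely (manip (at v (sw p) σ)) λ m₂ → absurd nf (edge σ v p m₁ m₂)
        where
        ρ = lookup σ v
        changed = proj₁ (is-xor⇒≢ a σ (at v (sw p) σ) x)
        unchanged : above ρ a b ≡ above (sw p ρ) a b
        unchanged = xor-false (not-true u)
        absurd : foreign (f σ) (f (at v (sw p) σ)) ≡ false → f σ ≡ f (at v (sw p) σ) ⊎ Adjacent p ρ (f σ) (f (at v (sw p) σ)) → ⊥
        absurd nf (inj₁ e) = changed e
        absurd nf (inj₂ adj) = true≢false (⇒foreign changed λ
          { (inj₁ (q , r)) → sign-changes (subst₂ (Adjacent p ρ) q r adj)
          ; (inj₂ (q , r)) → sign-changes′ (subst₂ (Adjacent p ρ) q r adj) }) nf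
          where
          sign-changes : ¬ Adjacent p ρ a b
          sign-changes adj = true≢false (proj₁ (Adjacent-above ρ adj)) (trans unchanged (proj₂ (Adjacent-above ρ adj)))
          sign-changes′ : ¬ Adjacent p ρ b a
          sign-changes′ adj = true≢false (above-total (sw p ρ) (a≢b ∘ sym) (proj₂ (Adjacent-above ρ adj)))
            (trans (sym unchanged) (above-asym ρ (proj₁ (Adjacent-above ρ adj))))

    abstract
      vote : Σ (Vec Bool n → Bool) λ G → # Ω (λ σ → is a σ xor G (signs a b σ)) ≤ sign-error
      vote = sign-determined a≢b (is a) sign-change is-a-change

    G : Vec Bool n → Bool
    G = proj₁ vote

    G* : Vec Bool n → Bool
    G* = sorted G

    -- Put `a` and `b` on top of ballot v in both orders. At a violation `G` lets `a` win when `b`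
    -- is first but not when `a` is first. `pair-outcomes` forbids this unless one of the two
    -- profiles is manipulable or `G` errs there.
    violations : ∀ v → # Ω (violated G v ∘ signs a b) ≤ violation-error
    violations v = begin
      # Ω (violated G v ∘ signs a b) ≤⟨ #-≤ Ω _ pointwise ⟩
      ∑ Ω (λ σ → 𝟙 (wrong (pair-up v a b σ)) + (𝟙 (wrong (pair-up v b a σ)) + (𝟙 (manip (pair-up v a b σ)) + 𝟙 (manip (pair-up v b a σ)))))
        ≡⟨ trans (∑-+ Ω _ _) (cong (# Ω (wrong ∘ pair-up v a b) +_) (trans (∑-+ Ω _ _) (cong (# Ω (wrong ∘ pair-up v b a) +_) (∑-+ Ω _ _)))) ⟩
      # Ω (wrong ∘ pair-up v a b) + (# Ω (wrong ∘ pair-up v b a) + (# Ω (manip ∘ pair-up v a b) + # Ω (manip ∘ pair-up v b a)))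
        ≤⟨ +-mono-≤ (wrong-count a b) (+-mono-≤ (wrong-count b a)
             (+-mono-≤ (manip-count (expands-pair-up v a b)) (manip-count (expands-pair-up v b a)))) ⟩
      violation-error ∎
      where
      open ≤-Reasoning
      wrong : Profile k n → Bool
      wrong σ = is a σ xor G (signs a b σ)
      wrong-count : ∀ x y → # Ω (wrong ∘ pair-up v x y) ≤ k * k * sign-error
      wrong-count x y = ≤-trans (∑-∘ (expands-pair-up v x y) (𝟙 ∘ wrong)) (*-monoʳ-≤ (k * k) (proj₂ vote))
      signs-pair-up : ∀ x y s (σ : Profile k n) → (∀ ρ → above (lift x (lift y ρ)) a b ≡ s) → signs a b (pair-up v x y σ) ≡ signs a b σ [ v ↦ s ]
      signs-pair-up x y s σ h = trans (cong (signs a b) (at-at v σ)) (trans (signs-update v σ)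
        (cong (λ t → signs a b σ [ v ↦ t ]) (h (lookup σ v))))
      pointwise : ∀ σ → violated G v (signs a b σ) ≡ true → 1 ≤ 𝟙 (wrong (pair-up v a b σ)) +
        (𝟙 (wrong (pair-up v b a σ)) + (𝟙 (manip (pair-up v a b σ)) + 𝟙 (manip (pair-up v b a σ))))
      pointwise σ e = unless (wrong (pair-up v a b σ)) λ w₁ → unless (wrong (pair-up v b a σ)) λ w₂ → unless (manip (pair-up v a b σ)) λ m₁ →
        surely (manip (pair-up v b a σ)) λ m₂ → absurd w₁ w₂ (pair-outcomes v σ a≢b m₁ m₂)
        where
        parts = ∧-true {G (signs a b σ [ v ↦ false ])} e
        absurd : wrong (pair-up v a b σ) ≡ false → wrong (pair-up v b a σ) ≡ false →
          f (pair-up v a b σ) ≡ f (pair-up v b a σ) ⊎ (f (pair-up v a b σ) ≡ a × f (pair-up v b a σ) ≡ b) → ⊥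
        absurd w₁ w₂ outcomes = contradictory outcomes
          where
          not-a : is a (pair-up v a b σ) ≡ false
          not-a = trans (xor-false w₁) (trans (cong G (signs-pair-up a b true σ λ ρ → lift-top a (lift b ρ) (a≢b ∘ sym))) (not-true (proj₂ parts)))
          is-a : is a (pair-up v b a σ) ≡ true
          is-a = trans (xor-false w₂) (trans (cong G (signs-pair-up b a false σ λ ρ → above-asym (lift b (lift a ρ)) (lift-top b (lift a ρ) a≢b))) (proj₁ parts))
          contradictory : f (pair-up v a b σ) ≡ f (pair-up v b a σ) ⊎ (f (pair-up v a b σ) ≡ a × f (pair-up v b a σ) ≡ b) → ⊥
          contradictory (inj₁ q) = true≢false (≡⇒is (pair-up v a b σ) (trans q (is⇒≡ (pair-up v b a σ) is-a))) not-a
          contradictory (inj₂ (q , _)) = true≢false (≡⇒is (pair-up v a b σ) q) not-a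

    sorting-error : # Ω (λ σ → G (signs a b σ) xor G* (signs a b σ)) ≤ n * violation-error
    sorting-error = *-cancelˡ-≤ (2 ^ n) {{2^n≢0 n}} (begin
      2 ^ n * # Ω (λ σ → G (signs a b σ) xor G* (signs a b σ))  ≡⟨ ∑-signs a≢b n (λ s → 𝟙 (G s xor G* s)) ⟩
      length Ω * # (cube n) (λ s → G s xor G* s)  ≤⟨ *-monoʳ-≤ (length Ω) (sorted-distance G) ⟩
      length Ω * ∑ (allFin n) (λ v → # (cube n) (violated G v))  ≡⟨ ∑-* (allFin n) (length Ω) _ ⟨
      ∑ (allFin n) (λ v → length Ω * # (cube n) (violated G v))  ≡⟨ ∑-cong (allFin n) (λ v → ∑-signs a≢b n (𝟙 ∘ violated G v)) ⟨
      ∑ (allFin n) (λ v → 2 ^ n * # Ω (violated G v ∘ signs a b))  ≡⟨ ∑-* (allFin n) (2 ^ n) _ ⟩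
      2 ^ n * ∑ (allFin n) (λ v → # Ω (violated G v ∘ signs a b))
        ≤⟨ *-monoʳ-≤ (2 ^ n) (≤-trans (∑-≤-const (allFin n) violation-error violations) (≤-reflexive (cong (_* violation-error) (length-allFin n)))) ⟩
      2 ^ n * (n * violation-error)  ∎)
      where open ≤-Reasoning

    Outsider : Fin k → Set
    Outsider c = c ≢ a × c ≢ b × # Ω (not ∘ is c) ≤ outsider-error

    outsider? : ∀ c → Dec (Outsider c)
    outsider? c = ¬? (c Fin.≟ a) ×-dec (¬? (c Fin.≟ b) ×-dec (# Ω (not ∘ is c) ≤? outsider-error))

    -- The factor k fits the bound to the first summand of `pair-error`, so that both cases of
    -- `near-monotone` share one estimate.
    constant-close : ∀ {c} → Outsider c → # Ω (differ (λ _ → c)) ≤ k * outsider-error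
    constant-close {c} (_ , _ , h) = ≤-trans h (m≤n*m outsider-error k {{k≢0 c}})
      where
      k≢0 : ∀ {k} → Fin k → NonZero k
      k≢0 {suc k} _ = _

    choice-close : ¬ (∃[ c ] Outsider c) → # Ω (differ (choose a≢b i₀ G* (sorted-monotone G))) ≤ pair-error
    choice-close none = begin
      # Ω (differ g) ≤⟨ #-≤ Ω (differ g) pointwise ⟩
      ∑ Ω (λ σ → ∑ (allFin k) (λ c → 𝟙 (P c σ)) + (𝟙 (is a σ xor G (signs a b σ)) + 𝟙 (G (signs a b σ) xor G* (signs a b σ))))
        ≡⟨ trans (∑-+ Ω _ _) (cong (∑ Ω (λ σ → ∑ (allFin k) (λ c → 𝟙 (P c σ))) +_) (∑-+ Ω _ _)) ⟩
      ∑ Ω (λ σ → ∑ (allFin k) (λ c → 𝟙 (P c σ))) + (# Ω (λ σ → is a σ xor G (signs a b σ)) + # Ω (λ σ → G (signs a b σ) xor G* (signs a b σ)))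
        ≤⟨ +-mono-≤ (union P _ P-bound) (+-mono-≤ (proj₂ vote) sorting-error) ⟩
      pair-error ∎
      where
      open ≤-Reasoning
      g = choose a≢b i₀ G* (sorted-monotone G)
      P : Fin k → Profile k n → Bool
      P c σ = (≢-bool c a ∧ ≢-bool c b) ∧ is c σ
      P-bound : ∀ c → # Ω (P c) ≤ outsider-error
      P-bound c = go (≢-bool c a ∧ ≢-bool c b) refl
        where
        go : ∀ t → ≢-bool c a ∧ ≢-bool c b ≡ t → # Ω (λ σ → t ∧ is c σ) ≤ outsider-error
        go false e = ≤-trans (≤-reflexive (∑-zero Ω)) z≤n
        go true  e = rare-outsider (outsider c≢a c≢b)
          where
          c≢a = ≢-bool⇒≢ c a (proj₁ (∧-true {≢-bool c a} e))
          c≢b = ≢-bool⇒≢ c b (proj₂ (∧-true {≢-bool c a} e))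
          rare-outsider : # Ω (is c) ≤ outsider-error ⊎ # Ω (not ∘ is c) ≤ outsider-error → # Ω (is c) ≤ outsider-error
          rare-outsider (inj₁ h) = h
          rare-outsider (inj₂ h) = ⊥-elim (none (c , c≢a , c≢b , h))
      pointwise : ∀ σ → differ g σ ≡ true → 1 ≤ ∑ (allFin k) (λ c → 𝟙 (P c σ)) +
        (𝟙 (is a σ xor G (signs a b σ)) + 𝟙 (G (signs a b σ) xor G* (signs a b σ)))
      pointwise σ d = go (f σ Fin.≟ a) (f σ Fin.≟ b)
        where
        g≢f = differ⇒≢ g σ d
        go : Dec (f σ ≡ a) → Dec (f σ ≡ b) → 1 ≤ ∑ (allFin k) (λ c → 𝟙 (P c σ)) +
          (𝟙 (is a σ xor G (signs a b σ)) + 𝟙 (G (signs a b σ) xor G* (signs a b σ)))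
        go (no fa) (no fb) = ≤-trans (≤-trans (≤-reflexive (cong 𝟙 (sym (true-∧ (true-∧ (≢⇒≢-bool fa) (≢⇒≢-bool fb)) (≡⇒is σ refl)))))
          (∑-∈ (λ c → 𝟙 (P c σ)) (∈-allFin (f σ)))) (m≤m+n _ _)
        go (yes fa) _ = ≤-trans (unless (is a σ xor G (signs a b σ)) λ x → surely (G (signs a b σ) xor G* (signs a b σ)) λ y → g≢f (trans fa (sym (choose-a a≢b i₀ G* (sorted-monotone G) σ
              (trans (sym (xor-false y)) (trans (sym (xor-false x)) (≡⇒is σ fa))))))) (m≤n+m _ (∑ (allFin k) (λ c → 𝟙 (P c σ))))
        go (no ¬fa) (yes fb) = ≤-trans (unless (is a σ xor G (signs a b σ)) λ x → surely (G (signs a b σ) xor G* (signs a b σ)) λ y → g≢f (trans fb (sym (choose-b a≢b i₀ G* (sorted-monotone G) σ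
              (trans (sym (xor-false y)) (trans (sym (xor-false x)) (≢⇒is σ ¬fa))))))) (m≤n+m _ (∑ (allFin k) (λ c → 𝟙 (P c σ))))

    near-monotone : Σ (SCF k n) λ g → NONMANIP g × # Ω (differ g) ≤ pair-error
    near-monotone = go (any? outsider?)
      where
      go : Dec (∃[ c ] Outsider c) → Σ (SCF k n) λ g → NONMANIP g × # Ω (differ g) ≤ pair-error
      go (yes (c , o)) = (λ _ → c) , constant-nonmanip (λ _ → c) i₀ c (λ _ → refl) , ≤-trans (constant-close o) (m≤m+n _ _)
      go (no none) = choose a≢b i₀ G* (sorted-monotone G) , choose-nonmanip a≢b i₀ G* (sorted-monotone G) , choice-close none

different? : ∀ (a b c d : Fin k) → Dec (Different a b c d)
different? a b c d = ¬? ((a Fin.≟ c) ×-dec (b Fin.≟ d)) ×-dec ¬? ((a Fin.≟ d) ×-dec (b Fin.≟ c))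

-- Dichotomy between one voter and one pair

module Dichotomy {k n : ℕ} (f : SCF k n) (θ : ℕ) (i₀ : Fin n) where

  open Local f
  open PivotalPairs f
  open Cases f θ
  open PairCase f θ

  private
    Ω = profiles k n

  Frequent : Fin n → Fin k → Fin k → Set
  Frequent v x y = x ≢ y × θ < # Ω (pivotal v x y)

  frequent? : ∀ v x y → Dec (Frequent v x y)
  frequent? v x y = ¬? (x Fin.≟ y) ×-dec (θ <? # Ω (pivotal v x y))

  module _ (no-clash : ∀ {i j a b c d} → i ≢ j → Different a b c d → Frequent i a b → Frequent j c d → ⊥) where

    Near : Set
    Near = Σ (SCF k n) λ g → NONMANIP g × # Ω (differ g) ≤ dictator-error + pair-error

    private
      rare-if : ∀ {v x y} → x ≢ y → ¬ Frequent v x y → Rare v x y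
      rare-if ne h = ≮⇒≥ λ l → h (ne , l)

      dictator : ∀ i → (∀ v → v ≢ i → ∀ x y → x ≢ y → Rare v x y) → Near
      dictator i rare = let g , nm , h = OneVoter.near-dictator i rare in g , nm , ≤-trans h (m≤m+n dictator-error pair-error)

      pair : ∀ {a b} → a ≢ b → (∀ v x y → x ≢ y → ¬ Same a b x y → Rare v x y) → Near
      pair a≢b rare = let g , nm , h = OnePair.near-monotone i₀ a≢b rare in g , nm , ≤-trans h (m≤n+m pair-error dictator-error)

      different⇒ : ∀ {a b x y} → ¬ Same a b x y → Different a b x y
      different⇒ h = (λ { (refl , refl) → h (inj₁ (refl , refl)) }) , (λ { (refl , refl) → h (inj₂ (refl , refl)) })

      -- A second frequent pair must belong to the same voter i, by `no-clash`. Then no other voter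
      -- is frequent for any pair, because that pair would differ from at least one of the two pairs
      -- of i.
      one-frequent : ∀ {i a b} → Frequent i a b → Dec (∃[ j ] ∃[ c ] ∃[ d ] (Frequent j c d × Different a b c d)) → Near
      one-frequent {i} {a} {b} (a≢b , l) (no none) = pair a≢b λ v x y ne ns → rare-if ne λ fr → none (v , x , y , fr , different⇒ ns)
      one-frequent {i} {a} {b} fr (yes (j , c , d , fr′ , diff)) = same-voter (i Fin.≟ j)
        where
        same-voter : Dec (i ≡ j) → Near
        same-voter (no i≢j) = ⊥-elim (no-clash i≢j diff fr fr′)
        same-voter (yes refl) = dictator i λ v v≢i x y ne → rare-if ne λ fr″ → matches v≢i fr″ (different? a b x y)
          where
          matches : ∀ {v x y} → v ≢ i → Frequent v x y → Dec (Different a b x y) → ⊥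
          matches v≢i fr″ (yes h) = no-clash (v≢i ∘ sym) h fr fr″
          matches {v} {x} {y} v≢i fr″ (no ¬h) = no-clash (v≢i ∘ sym) (other-pair (a Fin.≟ x) (b Fin.≟ y) (a Fin.≟ y) (b Fin.≟ x)) fr′ fr″
            where
            other-pair : Dec (a ≡ x) → Dec (b ≡ y) → Dec (a ≡ y) → Dec (b ≡ x) → Different c d x y
            other-pair (yes refl) (yes refl) _ _ = (λ { (refl , refl) → proj₁ diff (refl , refl) }) , (λ { (refl , refl) → proj₂ diff (refl , refl) })
            other-pair _ _ (yes refl) (yes refl) = (λ { (refl , refl) → proj₂ diff (refl , refl) }) , (λ { (refl , refl) → proj₁ diff (refl , refl) })
            other-pair (no p) _ (no q) _ = ⊥-elim (¬h ((p ∘ proj₁) , (q ∘ proj₁)))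
            other-pair (no p) _ _ (no q) = ⊥-elim (¬h ((p ∘ proj₁) , (q ∘ proj₂)))
            other-pair _ (no p) (no q) _ = ⊥-elim (¬h ((p ∘ proj₂) , (q ∘ proj₁)))
            other-pair _ (no p) _ (no q) = ⊥-elim (¬h ((p ∘ proj₂) , (q ∘ proj₂)))

    near : Near
    near = go (any? λ i → any? λ a → any? λ b → frequent? i a b)
      where
      go : Dec (∃[ i ] ∃[ a ] ∃[ b ] Frequent i a b) → Near
      -- Nobody is often pivotal, so any voter can play the dictator.
      go (no none) = dictator i₀ λ v _ x y ne → rare-if ne λ fr → none (v , x , y , fr)
      go (yes (i , a , b , fr)) = one-frequent fr (any? λ j → any? λ c → any? λ d → frequent? j c d ×-dec different? a b c d)

-- Fourth powers

pow4 : ℕ → ℕ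
pow4 x = square (square x)

square-mono : ∀ {x y} → x ≤ y → square x ≤ square y
square-mono h = *-mono-≤ h h

pow4-mono : ∀ {x y} → x ≤ y → pow4 x ≤ pow4 y
pow4-mono h = square-mono (square-mono h)

square-mono-< : ∀ {x y} → x < y → square x < square y
square-mono-< h = *-mono-< h h

pow4-mono-< : ∀ {x y} → x < y → pow4 x < pow4 y
pow4-mono-< h = square-mono-< (square-mono-< h)

square-+ : ∀ x y → square (x + y) ≤ 2 * (square x + square y)
square-+ x y = ≤-trans (≤-reflexive (e₁ x y)) (≤-trans (+-monoʳ-≤ (square x + square y) (am-gm x y)) (≤-reflexive (e₂ (square x + square y))))
  where
  e₁ : ∀ x y → (x + y) * (x + y) ≡ x * x + y * y + 2 * (x * y)
  e₁ = solve-∀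
  e₂ : ∀ z → z + z ≡ 2 * z
  e₂ = solve-∀

pow4-+ : ∀ x y → pow4 (x + y) ≤ 8 * (pow4 x + pow4 y)
pow4-+ x y = begin
  pow4 (x + y)  ≤⟨ square-mono (square-+ x y) ⟩
  square (2 * (square x + square y))  ≡⟨ e₁ (square x + square y) ⟩
  4 * square (square x + square y)  ≤⟨ *-monoʳ-≤ 4 (square-+ (square x) (square y)) ⟩
  4 * (2 * (pow4 x + pow4 y))  ≡⟨ *-assoc 4 2 (pow4 x + pow4 y) ⟨
  8 * (pow4 x + pow4 y)  ∎
  where
  open ≤-Reasoning
  e₁ : ∀ z → 2 * z * (2 * z) ≡ 4 * (z * z)
  e₁ = solve-∀

pow4-* : ∀ x y → pow4 (x * y) ≡ pow4 x * pow4 y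
pow4-* = solve-pow4
  where
  solve-pow4 : ∀ x y → x * y * (x * y) * (x * y * (x * y)) ≡ x * x * (x * x) * (y * y * (y * y))
  solve-pow4 = solve-∀

-- An integer fourth root, found by counting upwards. Its upper bound makes two frequent events
-- contradictory; its lower bound controls θ in the final error.
root : ∀ Z → ∃[ θ ] (pow4 θ ≤ Z × Z < pow4 (suc θ))
root zero = 0 , z≤n , s≤s z≤n
root (suc Z) with root Z
... | θ , l , u with suc Z <? pow4 (suc θ)
...   | yes h = θ , ≤-trans l (n≤1+n Z) , h
...   | no ¬h = suc θ , ≮⇒≥ ¬h , ≤-trans (s≤s u) (pow4-mono-< ≤-refl)

-- Monomial bounds

-- A bound by a monomial in n and k times `u`, carried as data so that the coefficient and degrees
-- of a composite error are obtained by evaluation. The unit `u` will be 1, `m` or `θ + m`.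
record Bounded (n k u x : ℕ) : Set where
  constructor bounded
  field
    coefficient n-power k-power : ℕ
    bound-≤ : x ≤ coefficient * (n ^ n-power * k ^ k-power) * u

module Monomials (n k : ℕ) .{{n≢0 : NonZero n}} .{{k≢0 : NonZero k}} where

  open Bounded

  constant : ∀ c → Bounded n k 1 c
  constant c = bounded c 0 0 (≤-reflexive (e c))
    where
    e : ∀ c → c ≡ c * (1 * 1) * 1
    e = solve-∀

  var-n : Bounded n k 1 n
  var-n = bounded 1 1 0 (≤-reflexive (e n))
    where
    e : ∀ c → c ≡ 1 * (c * 1 * 1) * 1
    e = solve-∀

  var-k : Bounded n k 1 k
  var-k = bounded 1 0 1 (≤-reflexive (e k))
    where
    e : ∀ c → c ≡ 1 * (1 * (c * 1)) * 1
    e = solve-∀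

  below : ∀ {u x} → x ≤ u → Bounded n k u x
  below {u} h = bounded 1 0 0 (≤-trans h (≤-reflexive (e u)))
    where
    e : ∀ c → c ≡ 1 * (1 * 1) * c
    e = solve-∀

  infixl 6 _⊕_
  infixl 7 _⊗_

  _⊕_ : ∀ {u x y} → Bounded n k u x → Bounded n k u y → Bounded n k u (x + y)
  _⊕_ {u} {x} {y} (bounded c i j p) (bounded c′ i′ j′ p′) = bounded (c + c′) (i ⊔ i′) (j ⊔ j′) (begin
    x + y  ≤⟨ +-mono-≤ p p′ ⟩
    c * (n ^ i * k ^ j) * u + c′ * (n ^ i′ * k ^ j′) * u
      ≤⟨ +-mono-≤ (*-monoˡ-≤ u (*-monoʳ-≤ c (*-mono-≤ (^-monoʳ-≤ n (m≤m⊔n i i′)) (^-monoʳ-≤ k (m≤m⊔n j j′)))))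
                  (*-monoˡ-≤ u (*-monoʳ-≤ c′ (*-mono-≤ (^-monoʳ-≤ n (m≤n⊔m i i′)) (^-monoʳ-≤ k (m≤n⊔m j j′))))) ⟩
    c * M * u + c′ * M * u  ≡⟨ e c c′ M u ⟩
    (c + c′) * M * u  ∎)
    where
    open ≤-Reasoning
    M = n ^ (i ⊔ i′) * k ^ (j ⊔ j′)
    e : ∀ c c′ M u → c * M * u + c′ * M * u ≡ (c + c′) * M * u
    e = solve-∀

  _⊗_ : ∀ {u x y} → Bounded n k 1 x → Bounded n k u y → Bounded n k u (x * y)
  _⊗_ {u} {x} {y} (bounded c i j p) (bounded c′ i′ j′ p′) = bounded (c * c′) (i + i′) (j + j′) (begin
    x * y  ≤⟨ *-mono-≤ p p′ ⟩
    c * (n ^ i * k ^ j) * 1 * (c′ * (n ^ i′ * k ^ j′) * u)  ≡⟨ e c c′ (n ^ i) (k ^ j) (n ^ i′) (k ^ j′) u ⟩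
    c * c′ * (n ^ i * n ^ i′ * (k ^ j * k ^ j′)) * u
      ≡⟨ cong₂ (λ p q → c * c′ * (p * q) * u) (sym (^-distribˡ-+-* n i i′)) (sym (^-distribˡ-+-* k j j′)) ⟩
    c * c′ * (n ^ (i + i′) * k ^ (j + j′)) * u  ∎)
    where
    open ≤-Reasoning
    e : ∀ c c′ a b d f u → c * (a * b) * 1 * (c′ * (d * f) * u) ≡ c * c′ * (a * d * (b * f)) * u
    e = solve-∀

  monomial : ∀ c i j → Bounded n k 1 (c * (n ^ i * k ^ j))
  monomial c i j = bounded c i j (≤-reflexive (sym (*-identityʳ _)))

  within : ∀ {x} (b : Bounded n k 1 x) c i j → coefficient b ≤ c → n-power b ≤ i → k-power b ≤ j → x ≤ c * n ^ i * k ^ j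
  within {x} (bounded c₀ i₀ j₀ h) c i j p q r = begin
    x  ≤⟨ h ⟩
    c₀ * (n ^ i₀ * k ^ j₀) * 1  ≡⟨ *-identityʳ _ ⟩
    c₀ * (n ^ i₀ * k ^ j₀)  ≤⟨ *-mono-≤ p (*-mono-≤ (^-monoʳ-≤ n q) (^-monoʳ-≤ k r)) ⟩
    c * (n ^ i * k ^ j)  ≡⟨ *-assoc c (n ^ i) (k ^ j) ⟨
    c * n ^ i * k ^ j  ∎
    where open ≤-Reasoning

-- Fourth powers make all terms comparable with m N³: `pow4 m` because m ≤ N, and `pow4 θ` by the
-- choice of the threshold. The factors 8 outside come from `pow4-+`.
assemble : ∀ D θ m N P Q R K → m ≤ N → D ≤ P * (θ + m) → pow4 θ ≤ 8 * (N * N * N * (Q * m) + pow4 (R * m)) →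
  pow4 P * (8 * (8 * (Q + pow4 R) + 1)) ≤ K → pow4 D ≤ K * (m * (N * N * N))
assemble D θ m N P Q R K m≤N D≤ θ≤ K≤ = begin
  pow4 D  ≤⟨ pow4-mono D≤ ⟩
  pow4 (P * (θ + m))  ≡⟨ pow4-* P (θ + m) ⟩
  pow4 P * pow4 (θ + m)  ≤⟨ *-monoʳ-≤ (pow4 P) (≤-trans (pow4-+ θ m) (*-monoʳ-≤ 8 (+-mono-≤ θ≤′ m⁴≤))) ⟩
  pow4 P * (8 * (8 * ((Q + pow4 R) * V) + V))  ≡⟨ e₁ (pow4 P) (Q + pow4 R) V ⟩
  pow4 P * (8 * (8 * (Q + pow4 R) + 1)) * V  ≤⟨ *-monoˡ-≤ V K≤ ⟩
  K * V  ∎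
  where
  open ≤-Reasoning
  V = m * (N * N * N)
  m⁴≤ : pow4 m ≤ V
  m⁴≤ = ≤-trans (≤-reflexive (e m)) (*-monoʳ-≤ m (*-mono-≤ (*-mono-≤ m≤N m≤N) m≤N))
    where
    e : ∀ m → m * m * (m * m) ≡ m * (m * m * m)
    e = solve-∀
  θ≤′ : pow4 θ ≤ 8 * ((Q + pow4 R) * V)
  θ≤′ = ≤-trans θ≤ (*-monoʳ-≤ 8 (begin
    N * N * N * (Q * m) + pow4 (R * m)  ≡⟨ cong (N * N * N * (Q * m) +_) (pow4-* R m) ⟩
    N * N * N * (Q * m) + pow4 R * pow4 m  ≤⟨ +-monoʳ-≤ (N * N * N * (Q * m)) (*-monoʳ-≤ (pow4 R) m⁴≤) ⟩
    N * N * N * (Q * m) + pow4 R * V  ≡⟨ e₂ (N * N * N) Q m (pow4 R) ⟩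
    (Q + pow4 R) * V  ∎))
    where
    e₂ : ∀ M Q m R → M * (Q * m) + R * (m * M) ≡ (Q + R) * (m * M)
    e₂ = solve-∀
  e₁ : ∀ p s V → p * (8 * (8 * (s * V) + V)) ≡ p * (8 * (8 * s + 1)) * V
  e₁ = solve-∀

-- Choice of the threshold and evaluation of the constants

module Quantitative (n k : ℕ) .{{n≢0 : NonZero n}} .{{k≢0 : NonZero k}} (f : SCF k n) (i₀ : Fin n) where

  open Local f
  open PivotalPairs f
  open Monomials n k
  open Bounded

  private
    Ω = profiles k n
    N = length Ω
    -- Two frequent events would give θ + 1 ≤ μ + `pivotal-error` with μ⁴ at most N³ times
    -- `clash-bound`; by `pow4-+` the fourth power of θ + 1 would then be at most this number.
    Z = 8 * (N * N * N * clash-bound + pow4 pivotal-error)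
    θ = proj₁ (root Z)

    no-clash : ∀ {i j a b c d} → i ≢ j → Different a b c d → Dichotomy.Frequent f θ i₀ i a b → Dichotomy.Frequent f θ i₀ j c d → ⊥
    no-clash i≢j diff (a≢b , p) (c≢d , q) = contradict (Clash.min-pivotal i≢j a≢b c≢d diff (suc θ) p q)
      where
      contradict : ∃[ μ ] suc θ ≤ μ + pivotal-error × pow4 μ ≤ N * N * N * clash-bound → ⊥
      contradict (μ , l , h) = <-irrefl refl (≤-trans (proj₂ (proj₂ (root Z)))
        (≤-trans (pow4-mono l) (≤-trans (pow4-+ μ pivotal-error) (*-monoʳ-≤ 8 (+-monoˡ-≤ (pow4 pivotal-error) h)))))

    open Dichotomy f θ i₀
    open Cases f θ
    open PairCase f θ

    result : Near no-clash
    result = near no-clash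

    m≤N : m ≤ N
    m≤N = ≤-trans (≤-reflexive m≡) (≤-trans (∑-≤-const Ω 1 (λ σ → 𝟙≤1 (manip σ))) (≤-reflexive (*-identityʳ N)))

    kk : Bounded n k 1 (k * k)
    kk = var-k ⊗ var-k

    nkk : Bounded n k 1 (n * (k * k))
    nkk = var-n ⊗ kk

    module Linear {u : ℕ} (m≤u : m ≤ u) where

      mᵇ : Bounded n k u m
      mᵇ = below m≤u

      2m : Bounded n k u (1 * m + 1 * m)
      2m = constant 1 ⊗ mᵇ ⊕ constant 1 ⊗ mᵇ

      2km : Bounded n k u (k * m + 1 * k * m)
      2km = var-k ⊗ mᵇ ⊕ (constant 1 ⊗ var-k) ⊗ mᵇ

      slackᵇ : Bounded n k u slack
      slackᵇ = mᵇ ⊕ (mᵇ ⊕ (kk ⊗ 2m ⊕ (kk ⊗ 2km ⊕ (kk ⊗ 2m ⊕ kk ⊗ 2km))))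

      pivotal-errorᵇ : Bounded n k u pivotal-error
      pivotal-errorᵇ = nkk ⊗ (kk ⊗ mᵇ ⊕ (kk ⊗ mᵇ ⊕ ((constant 1 ⊗ kk) ⊗ mᵇ ⊕ (constant 1 ⊗ kk) ⊗ mᵇ)))

      clash-boundᵇ : Bounded n k u clash-bound
      clash-boundᵇ = var-k ⊗ pivotal-errorᵇ ⊕ (var-k ⊗ (kk ⊗ 2km) ⊕ (var-k ⊗ pivotal-errorᵇ ⊕ var-k ⊗ (kk ⊗ 2km)))

    module M = Linear {m} ≤-refl
    module W = Linear {θ + m} (m≤n+m m θ)

    boundaryᵇ : Bounded n k (θ + m) boundary
    boundaryᵇ = var-k ⊗ (var-k ⊗ (below (m≤m+n θ m) ⊕ W.slackᵇ))

    win-errorᵇ : Bounded n k (θ + m) win-error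
    win-errorᵇ = kk ⊗ W.2m

    stable-errorᵇ : Bounded n k (θ + m) stable-error
    stable-errorᵇ = nkk ⊗ (var-k ⊗ boundaryᵇ ⊕ W.2km)

    sign-errorᵇ : Bounded n k (θ + m) sign-error
    sign-errorᵇ = nkk ⊗ (boundaryᵇ ⊕ (W.mᵇ ⊕ W.mᵇ))

    totalᵇ : Bounded n k (θ + m) (dictator-error + pair-error)
    totalᵇ = (var-k ⊗ (stable-errorᵇ ⊕ win-errorᵇ) ⊕ var-k ⊗ (var-k ⊗ (win-errorᵇ ⊕ stable-errorᵇ))) ⊕
      (var-k ⊗ (nkk ⊗ boundaryᵇ) ⊕ (sign-errorᵇ ⊕ var-n ⊗ (kk ⊗ sign-errorᵇ ⊕ (kk ⊗ sign-errorᵇ ⊕ (kk ⊗ W.mᵇ ⊕ kk ⊗ W.mᵇ)))))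

    leading : ∀ {u x} → Bounded n k u x → ℕ
    leading b = coefficient b * (n ^ n-power b * k ^ k-power b)

    leadingᵇ : ∀ {u x} (b : Bounded n k u x) → Bounded n k 1 (leading b)
    leadingᵇ b = monomial (coefficient b) (n-power b) (k-power b)

    pow4ᵇ : ∀ {x} → Bounded n k 1 x → Bounded n k 1 (pow4 x)
    pow4ᵇ b = (b ⊗ b) ⊗ (b ⊗ b)

    P = leading totalᵇ
    Q = leading M.clash-boundᵇ
    R = leading M.pivotal-errorᵇ

    finalᵇ : Bounded n k 1 (pow4 P * (8 * (8 * (Q + pow4 R) + 1)))
    finalᵇ = pow4ᵇ (leadingᵇ totalᵇ) ⊗ (constant 8 ⊗ (constant 8 ⊗ (leadingᵇ M.clash-boundᵇ ⊕ pow4ᵇ (leadingᵇ M.pivotal-errorᵇ)) ⊕ constant 1))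

    θ-bound : pow4 θ ≤ 8 * (N * N * N * (Q * m) + pow4 (R * m))
    θ-bound = ≤-trans (proj₁ (proj₂ (root Z))) (*-monoʳ-≤ 8 (+-mono-≤
      (*-monoʳ-≤ (N * N * N) (bound-≤ M.clash-boundᵇ)) (pow4-mono (bound-≤ M.pivotal-errorᵇ))))

    -- The evaluated monomial has a coefficient below 10¹² and the powers n¹² and k⁵⁶, of which
    -- `pow4 P` contributes n⁸k⁴⁰ and `pow4 R` contributes n⁴k¹⁶.
    final-≤ : pow4 P * (8 * (8 * (Q + pow4 R) + 1)) ≤ 10 ^ 39 * n ^ 67 * k ^ 166
    final-≤ = within finalᵇ (10 ^ 39) 67 166 (≤ᵇ⇒≤ (coefficient finalᵇ) (10 ^ 39) _) (≤ᵇ⇒≤ (n-power finalᵇ) 67 _) (≤ᵇ⇒≤ (k-power finalᵇ) 166 _)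

  near-nonmanip : ∀ K → 10 ^ 39 * n ^ 67 * k ^ 166 ≤ K →
    Σ (SCF k n) λ g → NONMANIP g × pow4 (# (profiles k n) (differ g)) ≤
      K * (# (profiles k n) manip * (length (profiles k n) * length (profiles k n) * length (profiles k n)))
  near-nonmanip K K≥ = conclude result
    where
    conclude : Near no-clash → Σ (SCF k n) λ g → NONMANIP g × pow4 (# Ω (differ g)) ≤ K * (# Ω manip * (N * N * N))
    conclude (g , nm , h) = g , nm , subst (λ z → pow4 (# Ω (differ g)) ≤ K * (z * (N * N * N))) m≡
      (assemble (# Ω (differ g)) θ m N P Q R K m≤N (≤-trans h (bound-≤ totalᵇ)) θ-bound (≤-trans final-≤ K≥))

-- From counts to lists of distinct profiles

unique-⊆⇒length-≤ : ∀ {xs ys : List A} → Unique xs → All (_∈ ys) xs → length xs ≤ length ys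
unique-⊆⇒length-≤ [] [] = z≤n
unique-⊆⇒length-≤ {xs = x ∷ xs} (x∉xs ∷ u) (x∈ys ∷ h) with ∈-∃++ x∈ys
... | as , bs , refl = subst (suc (length xs) ≤_) (sym (trans (length-++ as) (trans (+-suc (length as) (length bs)) (cong suc (sym (length-++ as))))))
        (s≤s (unique-⊆⇒length-≤ u (All.zipWith remove (x∉xs , h))))
  where
  remove : ∀ {y} → (x ≢ y) × (y ∈ as ++ x ∷ bs) → y ∈ as ++ bs
  remove (x≢y , y∈) with ∈-++⁻ as y∈
  ... | inj₁ y∈as = ∈-++⁺ˡ y∈as
  ... | inj₂ (here e) = ⊥-elim (x≢y (sym e))
  ... | inj₂ (there y∈bs) = ∈-++⁺ʳ as y∈bs

select : (A → Bool) → List A → List A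
select P = filter (λ x → P x Bool.≟ true)

length-select : ∀ (P : A → Bool) xs → length (select P xs) ≡ # xs P
length-select P []       = refl
length-select P (x ∷ xs) with P x
... | true  = cong suc (length-select P xs)
... | false = length-select P xs

profiles-complete : ∀ (σ : Profile k n) → σ ∈ profiles k n
profiles-complete = vecs-complete (images-complete identity)

profiles-unique : ∀ k n → Unique (profiles k n)
profiles-unique k n = vecs-unique (images-unique identity) n

-- Only positions p and p + 1 move, and both lie in the window of four that starts at p; the window
-- may reach past the last position.
sw-window : ∀ p (ρ : Ranking k) → AdjacentPermutation 4 ρ (sw p ρ)
sw-window p ρ = p , λ q outside → sym (trans (lookup-swapAt p (order ρ) q) (cong (lookup (order ρ)) (fixed q outside)))
  where
  fixed : ∀ q → toℕ q < p ⊎ p + 4 ≤ toℕ q → swapFin p q ≡ q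
  fixed q (inj₁ l) = swapFin-fix p q (<⇒≢ l) (<⇒≢ (≤-trans l (n≤1+n p)))
  fixed q (inj₂ l) = swapFin-fix p q (λ e → beyond 0 (trans e (sym (+-identityʳ p))) (s≤s z≤n))
    (λ e → beyond 1 (trans e (+-comm 1 p)) (s≤s (s≤s z≤n)))
    where
    beyond : ∀ d → toℕ q ≡ p + d → d < 4 → ⊥
    beyond d e d<4 = <⇒≱ (+-monoʳ-< p d<4) (subst (p + 4 ≤_) e l)

manip⇒ : ∀ (f : SCF k n) σ → Local.manip f σ ≡ true → IsRManipulationPoint 4 f σ
manip⇒ f σ e with does-true (Local.manipulable? f σ) e
... | v , p , better = v , sw (toℕ p) (lookup σ v) , sw-window (toℕ p) (lookup σ v) ,
  subst (λ τ → f τ >[ lookup σ v ] f σ) (at-local v σ refl) (above⇒> (lookup σ v) (f (at v (sw (toℕ p)) σ)) (f σ) better)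

-- Rational arithmetic

-- `_/_` cancels common factors, so fractions are compared and multiplied through their unnormalised
-- forms.
toℚᵘ-/ : ∀ a b → ℚ.toℚᵘ (ℤ.+ a / suc b) ℚᵘ.≃ mkℚᵘ (ℤ.+ a) b
toℚᵘ-/ a b = ℚ.toℚᵘ-fromℚᵘ (mkℚᵘ (ℤ.+ a) b)

/-mono : ∀ a b c d → a * suc d ≤ c * suc b → ℤ.+ a / suc b ℚ.≤ ℤ.+ c / suc d
/-mono a b c d h = ℚ.toℚᵘ-cancel-≤ (ℚᵘ.≤-respˡ-≃ (ℚᵘ.≃-sym (toℚᵘ-/ a b)) (ℚᵘ.≤-respʳ-≃ (ℚᵘ.≃-sym (toℚᵘ-/ c d))
  (*≤* (subst₂ ℤ._≤_ (ℤ.pos-* a (suc d)) (ℤ.pos-* c (suc b)) (ℤ.+≤+ h)))))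

/-* : ∀ a b c d → (ℤ.+ a / suc b) ℚ.* (ℤ.+ c / suc d) ≡ ℤ.+ (a * c) / (suc b * suc d)
/-* a b c d = ℚ.toℚᵘ-injective (ℚᵘ.≃-trans (ℚ.toℚᵘ-homo-* (ℤ.+ a / suc b) (ℤ.+ c / suc d))
  (ℚᵘ.≃-trans (ℚᵘ.*-cong (toℚᵘ-/ a b) (toℚᵘ-/ c d)) (ℚᵘ.≃-trans (ℚᵘ.≃-reflexive (cong (λ z → mkℚᵘ z (d + b * suc d)) (sym (ℤ.pos-* a c))))
    (ℚᵘ.≃-sym (toℚᵘ-/ (a * c) (d + b * suc d))))))

power-mono : ∀ {ε q} t l → 0ℚ ℚ.≤ ε → ε ℚ.≤ 1ℚ → ε ℚ.≤ q → 0ℚ ℚ.≤ ε ^ℚ (l + t) × ε ^ℚ (l + t) ℚ.≤ q ^ℚ l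
power-mono {ε} {q} t l 0≤ε ε≤1 ε≤q = go l
  where
  mul : ∀ {x y z w} → 0ℚ ℚ.≤ x → x ℚ.≤ y → 0ℚ ℚ.≤ z → z ℚ.≤ w → 0ℚ ℚ.≤ x ℚ.* z × x ℚ.* z ℚ.≤ y ℚ.* w
  mul {x} {y} {z} {w} 0≤x x≤y 0≤z z≤w =
    ℚ.≤-trans (ℚ.≤-reflexive (sym (ℚ.*-zeroˡ z))) (ℚ.*-monoʳ-≤-nonNeg z {{ℚ.nonNegative 0≤z}} 0≤x) ,
    ℚ.≤-trans (ℚ.*-monoʳ-≤-nonNeg z {{ℚ.nonNegative 0≤z}} x≤y) (ℚ.*-monoˡ-≤-nonNeg y {{ℚ.nonNegative (ℚ.≤-trans 0≤x x≤y)}} z≤w)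
  base : ∀ t → 0ℚ ℚ.≤ ε ^ℚ t × ε ^ℚ t ℚ.≤ 1ℚ
  base zero    = ℚ.nonNegative⁻¹ 1ℚ , ℚ.≤-refl
  base (suc t) = let p , q = base t in
    proj₁ (mul 0≤ε ε≤1 p q) , ℚ.≤-trans (proj₂ (mul 0≤ε ε≤1 p q)) (ℚ.≤-reflexive (ℚ.*-identityˡ 1ℚ))
  go : ∀ l → 0ℚ ℚ.≤ ε ^ℚ (l + t) × ε ^ℚ (l + t) ℚ.≤ q ^ℚ l
  go zero    = base t
  go (suc l) = let p , r = go l in mul 0≤ε ε≤q p r

rational-bound : ∀ D N K M ε → 0ℚ ℚ.≤ ε → ε ℚ.≤ ℤ.+ D / suc N → D ≤ suc N →
  pow4 D ≤ suc K * (M * (suc N * suc N * suc N)) → (ε ^ℚ 15) ℚ.* (ℤ.+ 1 / suc K) ℚ.≤ ℤ.+ M / suc N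
rational-bound D N K M ε 0≤ε ε≤q D≤N h = begin
  -- 15 = 4 + 11: four factors are compared with D/N, matching the fourth power in the hypothesis,
  -- and the other eleven with 1, as ε ≤ D/N ≤ 1.
  (ε ^ℚ 15) ℚ.* (ℤ.+ 1 / suc K)  ≤⟨ ℚ.*-monoʳ-≤-nonNeg (ℤ.+ 1 / suc K) {{ℚ.nonNegative 0≤1/K}} (proj₂ (power-mono 11 4 0≤ε ε≤1 ε≤q)) ⟩
  (q ^ℚ 4) ℚ.* (ℤ.+ 1 / suc K)  ≡⟨ cong (ℚ._* (ℤ.+ 1 / suc K)) fraction ⟩
  (ℤ.+ D⁴ / N⁴) ℚ.* (ℤ.+ 1 / suc K)  ≡⟨ /-* D⁴ _ 1 K ⟩
  ℤ.+ (D⁴ * 1) / (N⁴ * suc K)  ≤⟨ /-mono (D⁴ * 1) _ M N (cross (suc N) (suc K) h) ⟩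
  ℤ.+ M / suc N  ∎
  where
  open ℚ.≤-Reasoning
  q = ℤ.+ D / suc N
  D⁴ = D * (D * (D * (D * 1)))
  N⁴ = suc N * (suc N * (suc N * (suc N * 1)))
  fraction : q ^ℚ 4 ≡ ℤ.+ D⁴ / N⁴
  fraction = trans (cong (λ z → q ℚ.* (q ℚ.* (q ℚ.* z))) (/-* D N 1 0)) (trans (cong (λ z → q ℚ.* (q ℚ.* z)) (/-* D N (D * 1) _))
    (trans (cong (q ℚ.*_) (/-* D N (D * (D * 1)) _)) (/-* D N (D * (D * (D * 1))) _)))
  0≤1/K : 0ℚ ℚ.≤ ℤ.+ 1 / suc K
  0≤1/K = /-mono 0 0 1 K z≤n
  ε≤1 : ε ℚ.≤ 1ℚ
  ε≤1 = ℚ.≤-trans ε≤q (/-mono D N 1 0 (≤-trans (≤-reflexive (*-identityʳ D)) (≤-trans D≤N (≤-reflexive (sym (*-identityˡ (suc N)))))))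
  cross : ∀ N K → pow4 D ≤ K * (M * (N * N * N)) → D⁴ * 1 * N ≤ M * (N * (N * (N * (N * 1))) * K)
  cross N K h = ≤-trans (≤-reflexive (e₁ D N)) (≤-trans (*-monoˡ-≤ N h) (≤-reflexive (e₂ N K M)))
    where
    e₁ : ∀ D N → D * (D * (D * (D * 1))) * 1 * N ≡ D * D * (D * D) * N
    e₁ = solve-∀
    e₂ : ∀ N K M → K * (M * (N * N * N)) * N ≡ M * (N * (N * (N * (N * 1))) * K)
    e₂ = solve-∀

rational-bound′ : ∀ D N K M ε .{{_ : NonZero N}} .{{_ : NonZero K}} → 0ℚ ℚ.≤ ε → ε ℚ.≤ ℤ.+ D / N → D ≤ N →
  pow4 D ≤ K * (M * (N * N * N)) → (ε ^ℚ 15) ℚ.* (ℤ.+ 1 / K) ℚ.≤ ℤ.+ M / N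
rational-bound′ D (suc N) (suc K) M ε = rational-bound D N K M ε

-- The lower bound in terms of probabilities

module _ (k n : ℕ) .{{_ : NonZero n}} .{{_ : NonZero k}} (i₀ : Fin n) (f : SCF k n) (ε : ℚ) (0<ε : 0ℚ ℚ.< ε) (far : DistNONMANIPAtLeast f ε) where

  open Local f using (manip; differ)

  private
    Ω = profiles k n
    instance
      N≢0 : NonZero ((k !) ^ n)
      N≢0 = m^n≢0 (k !) n {{k !≢0}}

  far⇒many : ∀ K .{{_ : NonZero K}} → (Σ (SCF k n) λ g → NONMANIP g × pow4 (# Ω (differ g)) ≤ K * (# Ω manip * (length Ω * length Ω * length Ω))) →
    ProbAtLeast k n (IsRManipulationPoint 4 f) ((ε ^ℚ 15) ℚ.* (ℤ.+ 1 / K))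
  far⇒many K (g , nonmanip , h) = compare (far g nonmanip)
    where
    compare : DistAtLeast f g ε → ProbAtLeast k n (IsRManipulationPoint 4 f) ((ε ^ℚ 15) ℚ.* (ℤ.+ 1 / K))
    compare (L , unique , differs , ε≤) = select manip Ω , Unique.filter⁺ (λ σ → manip σ Bool.≟ true) (profiles-unique k n) ,
      All.map (λ {σ} → manip⇒ f σ) (All.all-filter (λ σ → manip σ Bool.≟ true) Ω) ,
      rational-bound′ (length L) ((k !) ^ n) K (length (select manip Ω)) ε (ℚ.<⇒≤ 0<ε) ε≤
        (≤-trans (≤-trans few (∑-≤-const Ω 1 λ σ → 𝟙≤1 (differ g σ))) (≤-reflexive (trans (*-identityʳ (length Ω)) (length-profiles k n))))
        (≤-trans (pow4-mono few) (≤-trans h (≤-reflexive (cong₂ (λ x y → K * (x * (y * y * y)))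
          (sym (length-select manip Ω)) (length-profiles k n)))))
      where
      few : length L ≤ # Ω (differ g)
      few = ≤-trans (unique-⊆⇒length-≤ unique (All.map (λ {σ} ne → ∈-filter⁺ (λ τ → differ g τ Bool.≟ true)
          (profiles-complete σ) (cong not (dec-false (f σ Fin.≟ g σ) ne))) differs))
        (≤-reflexive (length-select (differ g) Ω))

  many-manipulations : ∀ K .{{_ : NonZero K}} → 10 ^ 39 * n ^ 67 * k ^ 166 ≤ K →
    ProbAtLeast k n (IsRManipulationPoint 4 f) ((ε ^ℚ 15) ℚ.* (ℤ.+ 1 / K))
  many-manipulations K K≥ = far⇒many K (Quantitative.near-nonmanip n k f i₀ K K≥)

-- K was a variable until here, since Agda must never unfold a product with the literal 10 ^ 39.
bound-≡ : ∀ n k ε → bound (suc n) (suc k) ε ≡ (ε ^ℚ 15) ℚ.* (ℤ.+ 1 / (10 ^ 39 * (suc n ^ 67) * (suc k ^ 166)))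
  {{m*n≢0 _ _ {{m*n≢0 _ _ {{m^n≢0 10 39}} {{m^n≢0 (suc n) 67}}}} {{m^n≢0 (suc k) 166}}}}
bound-≡ n k ε = refl

theorem1p2 : (n k : ℕ) → 1 ≤ n → 3 ≤ k → (ε : ℚ) → 0ℚ ℚ.< ε →
    (f : SCF k n) → DistNONMANIPAtLeast f ε →
    ((r : ℚ) → ProbAtLeast k n (IsRManipulationPoint 4 f) r →
    ProbAtLeast k n (IsManipulationPoint f) r)
    × ProbAtLeast k n (IsRManipulationPoint 4 f) (bound n k ε)
theorem1p2 (suc n) (suc k) _ _ ε 0<ε f far =
  (λ r (L , u , h , r≤) → L , u , All.map (λ (i , τ , _ , better) → i , τ , better) h , r≤) ,
  subst (ProbAtLeast (suc k) (suc n) (IsRManipulationPoint 4 f)) (sym (bound-≡ n k ε))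
    (many-manipulations (suc k) (suc n) Fin.zero f ε 0<ε far (10 ^ 39 * (suc n ^ 67) * (suc k ^ 166))
      {{m*n≢0 _ _ {{m*n≢0 _ _ {{m^n≢0 10 39}} {{m^n≢0 (suc n) 67}}}} {{m^n≢0 (suc k) 166}}}} ≤-refl)
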